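{- Let $(\mathcal N,\mathcal O,\mathfrak l)$ be a plabic network representing a point $[A]\in\mathcal S^{\mathrm{TNN}}_{\mathcal M}\subset Gr^{\mathrm{TNN}}(k,n)$, with orientation $\mathcal O$ associated to the base $I=\{1\le i_1<i_2<\dots<i_k\le n\}$ in $\mathcal M$ and gauge ray direction $\mathfrak l$. Let $e$ be the edge starting at the boundary source $b_{i_r}$ and let $b_j$, $j\in\bar I=[n]\setminus I$, be a boundary sink. Then the number $\mathrm{wind}(F)+\mathrm{int}(F)$ has the same parity for all edge flows $F$ from $b_{i_r}$ to $b_j$ (i.e. all $F\in\mathcal F_{e,b_j}(\mathcal G)$), and this parity is that of the number of boundary sources strictly between $i_r$ and $j$ in the orientation $\mathcal O$, $$N_{rj}=\#\{i_s\in I:\ \min\{i_r,j\}<i_s<\max\{i_r,j\}\}.$$ Therefore, with the choice of the canonical basis vectors of $\mathbb R^n$ as boundary vectors at the sinks, $$(E_e)_j=(-1)^{N_{rj}}\frac{\sum_{F\in\mathcal F_{e,b_j}(\mathcal G)}w(F)}{\sum_{C\in\mathcal C(\mathcal G)}w(C)}=A^r_j,$$ where $A^r_j$ is the entry of the reduced row echelon matrix $A$ of the point $[A]$ with respect to the base $I$.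
   Context: $Gr^{\mathrm{TNN}}(k,n)=GL_k^+\backslash Mat^{\mathrm{TNN}}_{k,n}$, where $Mat^{\mathrm{TNN}}_{k,n}$ is the set of real $k\times n$ matrices of rank $k$ with non-negative maximal minors $\Delta_J$. For a matroid $\mathcal M$, $\mathcal S^{\mathrm{TNN}}_{\mathcal M}=\{[A]:\Delta_J(A)>0\text{ if }J\in\mathcal M,\ \Delta_J(A)=0\text{ if }J\notin\mathcal M\}$. The reduced row echelon matrix with respect to $I$ is the representative whose submatrix in the columns $I$ is the identity. Fix positive integers $k<n$. A plabic graph $\mathcal G$ of type $(k,n)$ is a finite directed graph drawn planarly in a disk, with no component isolated from the boundary, such that: it has $n$ boundary vertices $b_1,\dots,b_n$ labelled clockwise, all on a common straight interval of the boundary of the disk, each of degree 1 (a boundary source if its edge is outgoing, a boundary sink if incoming; exactly $k$ are sources); all other (internal) vertices are strictly inside the disk and are bivalent or trivalent; each internal vertex either has exactly one incoming edge (white) or exactly one outgoing edge (black), bivalent vertices being assigned either colour. Edges are straight segments, regarded as vectors directed by the orientation $\mathcal O$. $I$ indexes the boundary sources. A plabic network $\mathcal N$ is a plabic graph with a positive weight $w_e$ on each edge. $\mathcal N$ represents $[A]$ if $[A]$ is the class of the matrix with identity submatrix in the columns $I$ and entries $A^r_j=(-1)^{\sigma(i_r,j)}\sum_{P:b_{i_r}\to b_j}(-1)^{\mathrm{wind}_{top}(P)}w(P)$ for $j\in\bar I$, where $\sigma(i_r,j)$ is the number of elements of $I$ strictly between $i_r$ and $j$, the sum is over directed walks from $b_{i_r}$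 to $b_j$ (it sums to a rational function of the weights), and $\mathrm{wind}_{top}$ is the topological winding index ($(-1)^{\mathrm{wind}_{top}(P)}=(-1)^{\text{number of loops removed in the loop erasure of }P}$). A gauge ray direction $\mathfrak l$ is an oriented direction such that the ray in direction $\mathfrak l$ from any boundary vertex points inside the disk, no internal edge is parallel to $\mathfrak l$, and the rays starting at boundary vertices contain no internal vertices. $\mathfrak l_i$ is the ray starting at $b_i$. For plane vectors $s(u,v)=+1,0,-1$ if $(u,v)$ is positively (counterclockwise) oriented, parallel, negatively oriented. For consecutive edges, $\mathrm{wind}(e,f)=\pm1$ if $s(e,f)=s(e,\mathfrak l)=s(\mathfrak l,f)=\pm1$, and $0$ otherwise. $\mathrm{int}(e)$ is the number of intersections of $e$ with the rays $\mathfrak l_{i_r}$, $r\in[k]$ (the common starting point of $\mathfrak l_{i_r}$ and the edge at $b_{i_r}$ is not counted). For a directed path $\mathcal P=(e_1,\dots,e_m)$ (edges may repeat): $w(\mathcal P)=\prod w_{e_l}$ with multiplicity, $\mathrm{wind}(\mathcal P)=\sum_{l=1}^{m-1}\mathrm{wind}(e_l,e_{l+1})$, $\mathrm{int}(\mathcal P)=\sum_{l=1}^m\mathrm{int}(e_l)$. The edge vector $E_e\in\mathbb R^n$ (canonical boundary vectors) has components $(E_e)_j=\sum_{\mathcal P:e\to b_j}(-1)^{\mathrm{wind}(\mathcal P)+\mathrm{int}(\mathcal P)}w(\mathcal P)$, the sum over all directed paths with first edge $e$ ending at $b_j$, understood as the rational function of the weights to which it sums (zero if there is no path). An edge flow at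 $e$ is a collection $F$ of distinct edges such that: $e\in F$; at every internal vertex other than the starting vertex $V$ of $e$ the number of edges of $F$ arriving equals the number leaving; at $V$ the number arriving equals the number leaving minus 1; $F$ contains no edges at boundary sources except possibly $e$. $\mathcal F_{e,b_j}(\mathcal G)$ is the set of edge flows at $e$ containing the edge at the sink $b_j$; each such $F$ is the union of a directed path $P_{e,b_j}$ from $e$ to $b_j$ with all edges distinct and a (possibly trivial) conservative flow having no common edges with it. $w(F)$ is the product of the weights of the edges in $F$, $\mathrm{wind}(F)=\mathrm{wind}(P_{e,b_j})$, $\mathrm{int}(F)=\mathrm{int}(P_{e,b_j})$. A conservative flow is a collection $C$ of distinct edges, none incident to the boundary, such that at each internal vertex the numbers of edges of $C$ arriving and leaving coincide; $\mathcal C(\mathcal G)$ is the set of conservative flows, including the empty one with weight 1, and $w(C)$ is the product of the weights of its edges. -}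

module Defs where

open import Algebra.Bundles using (CommutativeRing)
open import Data.Bool.Base using (if_then_else_)
open import Data.Empty using (⊥-elim)
open import Data.Fin.Base as Fin using (Fin; zero; suc; toℕ; punchIn)
open import Data.Fin.Properties as FinP using (all?; any?)
open import Data.Fin.Subset using (Subset; ⊥; inside; outside; _∈_; _∉_; ∣_∣; ⁅_⁆; _∪_; _-_; ⋃)
open import Data.Fin.Subset.Properties using (_∈?_; ∉⊥)
open import Data.Integer.Base as ℤ using (ℤ; 0ℤ; 1ℤ; -1ℤ)
open import Data.Integer.Properties as ℤP using ()
open import Data.List.Base as List using (List; []; _∷_; [_]; length; map; filter; foldr; concatMap; allFin; dropWhile; head; _++_)
open import Data.List.Membership.DecPropositional using () renaming (_∈?_ to mem?)
open import Data.List.Membership.Propositional using () renaming (_∈_ to _∈ₗ_)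
open import Data.List.Membership.Propositional.Properties using (∈-filter⁺; ∈-map⁺; ∈-++⁺ˡ)
open import Data.List.Properties using (filter-none)
open import Data.List.Relation.Unary.All using (universal)
open import Data.List.Relation.Unary.Any using (here)
open import Data.List.Relation.Unary.Unique.Propositional using (Unique)
open import Data.Maybe.Base using (just)
open import Data.Maybe.Properties as MaybeP using ()
open import Data.Nat.Base as ℕ using (ℕ; zero; suc; parity; _⊓_; _⊔_)
open import Data.Nat.ListAction as ℕL using ()
open import Data.Nat.Properties as ℕP using ()
open import Data.Parity.Base using (0ℙ; 1ℙ)
open import Data.Product using (∃; ∃-syntax; ∃₂; _×_; _,_; proj₁; proj₂)
open import Data.Sum.Base using (_⊎_; inj₁; inj₂)
open import Data.Sum.Properties as SumP using ()
open import Data.Vec.Base as Vec using (Vec; []; _∷_; lookup; tabulate; zipWith)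
open import Data.Vec.Properties as VecP using ()
open import Data.Vec.Relation.Binary.Pointwise.Inductive as Pointwise using (Pointwise)
open import Function.Base using (_∘_)
open import Function.Bundles using (_⇔_)
open import Level using (Level; 0ℓ) renaming (_⊔_ to _⊔ˡ_; suc to lsuc)
open import Relation.Binary.Construct.Closure.Equivalence using (EqClosure)
import Relation.Binary.Construct.StrictToNonStrict as StrictToNonStrict
open import Relation.Binary.Core using (Rel)
open import Relation.Binary.Definitions using (DecidableEquality; tri<; tri≈; tri>)
open import Relation.Binary.PropositionalEquality as ≡ using (_≡_; _≢_; refl)
open import Relation.Binary.Structures using (IsStrictTotalOrder)
open import Relation.Nullary using (¬_; Dec; yes; no; does; ¬?)
open import Relation.Nullary.Decidable using (_×-dec_; _⊎-dec_; _→-dec_; map′)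
open import Relation.Unary using (Decidable)

------------------------------------------------------------------------
-- Scalars stand for the real numbers: any ordered field with trichotomous
-- order, of which ℝ (with classical logic) and ℚ are instances.

record OrderedField (c ℓ₁ ℓ₂ : Level) : Set (lsuc (c ⊔ˡ ℓ₁ ⊔ˡ ℓ₂)) where
  infix 4 _<_
  field
    commutativeRing : CommutativeRing c ℓ₁
  open CommutativeRing commutativeRing public
  field
    _<_                : Rel Carrier ℓ₂
    isStrictTotalOrder : IsStrictTotalOrder _≈_ _<_
    0<1                : 0# < 1#
    +-monoˡ-<          : ∀ z {x y} → x < y → x + z < y + z
    *-pos              : ∀ {x y} → 0# < x → 0# < y → 0# < x * y
    invertible         : ∀ {x} → ¬ x ≈ 0# → ∃[ y ] x * y ≈ 1#
  module Order = IsStrictTotalOrder isStrictTotalOrder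
  open Order public using (compare; _≟_; _<?_)
  open StrictToNonStrict _≈_ _<_ public using (_≤_)
  _≤?_ : ∀ x y → Dec (x ≤ y)
  _≤?_ = StrictToNonStrict.decidable′ _≈_ _<_ compare

  divide : ∀ x {y} → ¬ y ≈ 0# → Carrier
  divide x y≉0 = x * proj₁ (invertible y≉0)

record Columns (k n : ℕ) : Set where
  field
    at         : Fin k → Fin n
    increasing : ∀ {r s} → r Fin.< s → at r Fin.< at s
  set : Subset n
  set = ⋃ (List.tabulate (⁅_⁆ ∘ at))

record Matroid (k n : ℕ) : Set₁ where
  field
    IsBasis     : Subset n → Set
    isBasis?    : Decidable IsBasis
    cardinality : ∀ {B} → IsBasis B → ∣ B ∣ ≡ k
    nonempty    : ∃ IsBasis
    exchange    : ∀ {B B′} → IsBasis B → IsBasis B′ → ∀ {x} → x ∈ B → x ∉ B′ →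
                  ∃[ y ] y ∈ B′ × y ∉ B × IsBasis ((B - x) ∪ ⁅ y ⁆)

subsets : ∀ m → List (Subset m)
subsets zero    = [] ∷ []
subsets (suc m) = map (outside ∷_) (subsets m) ++ map (inside ∷_) (subsets m)

record Digraph (n : ℕ) : Set where
  field
    #internals #edges : ℕ

  Edge : Set
  Edge = Fin #edges

  Vertex : Set
  Vertex = Fin n ⊎ Fin #internals

  field
    src tgt : Edge → Vertex

  b : Fin n → Vertex
  b = inj₁

  internal : Fin #internals → Vertex
  internal = inj₂

  _≟ᵥ_ : DecidableEquality Vertex
  _≟ᵥ_ = SumP.≡-dec FinP._≟_ FinP._≟_

  indegree outdegree degree : Vertex → ℕ
  indegree v  = length (filter (λ f → tgt f ≟ᵥ v) (allFin #edges))
  outdegree v = length (filter (λ f → src f ≟ᵥ v) (allFin #edges))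
  degree v    = indegree v ℕ.+ outdegree v

  Adjacent : Rel Vertex 0ℓ
  Adjacent u v = ∃[ f ] src f ≡ u × tgt f ≡ v

  IsInternalEdge : Edge → Set
  IsInternalEdge f = ∀ i → src f ≢ b i × tgt f ≢ b i

  isInternalEdge? : Decidable IsInternalEdge
  isInternalEdge? f = all? λ i → ¬? (src f ≟ᵥ b i) ×-dec ¬? (tgt f ≟ᵥ b i)

  IsWalk : Vertex → List Edge → Vertex → Set
  IsWalk u []       v = u ≡ v
  IsWalk u (f ∷ fs) v = src f ≡ u × IsWalk (tgt f) fs v

  isWalk? : ∀ u P v → Dec (IsWalk u P v)
  isWalk? u []       v = u ≟ᵥ v
  isWalk? u (f ∷ fs) v = src f ≟ᵥ u ×-dec isWalk? (tgt f) fs v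

  IsPathFrom : Edge → Fin n → List Edge → Set
  IsPathFrom e j P = head P ≡ just e × IsWalk (src e) P (b j)

  isPathFrom? : ∀ e j → Decidable (IsPathFrom e j)
  isPathFrom? e j P = MaybeP.≡-dec FinP._≟_ (head P) (just e) ×-dec isWalk? (src e) P (b j)

  -- Chronological loop erasure: the first argument is the stack of vertices
  -- of the loop-erased walk so far, most recent first.  Returning to a vertex
  -- of the stack erases the loop just closed.
  erase : List Vertex → List Edge → ℕ
  erase visited []       = 0
  erase visited (f ∷ fs) with mem? _≟ᵥ_ (tgt f) visited
  ... | yes _ = suc (erase (dropWhile (λ v → ¬? (v ≟ᵥ tgt f)) visited) fs)
  ... | no  _ = erase (tgt f ∷ visited) fs

  loopsErased : Vertex → List Edge → ℕ
  loopsErased u P = erase [ u ] P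

  inflow outflow : Subset #edges → Vertex → ℕ
  inflow  F v = length (filter (λ f → f ∈? F ×-dec tgt f ≟ᵥ v) (allFin #edges))
  outflow F v = length (filter (λ f → f ∈? F ×-dec src f ≟ᵥ v) (allFin #edges))

  IsConservativeFlow : Subset #edges → Set
  IsConservativeFlow C =
    (∀ f → f ∈ C → IsInternalEdge f) ×
    (∀ v → inflow C (internal v) ≡ outflow C (internal v))

  isConservativeFlow? : Decidable IsConservativeFlow
  isConservativeFlow? C =
    all? (λ f → f ∈? C →-dec isInternalEdge? f) ×-dec
    all? (λ v → inflow C (internal v) ℕP.≟ outflow C (internal v))

  IsEdgeFlow : Edge → Subset #edges → Set
  IsEdgeFlow e F =
    e ∈ F ×
    (∀ v → internal v ≢ src e → inflow F (internal v) ≡ outflow F (internal v)) ×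
    suc (inflow F (src e)) ≡ outflow F (src e) ×
    (∀ f → f ∈ F → ∀ i → src f ≡ b i → f ≡ e)

  isEdgeFlow? : ∀ e → Decidable (IsEdgeFlow e)
  isEdgeFlow? e F =
    e ∈? F ×-dec
    all? (λ v → ¬? (internal v ≟ᵥ src e) →-dec inflow F (internal v) ℕP.≟ outflow F (internal v)) ×-dec
    suc (inflow F (src e)) ℕP.≟ outflow F (src e) ×-dec
    all? (λ f → f ∈? F →-dec all? (λ i → src f ≟ᵥ b i →-dec f FinP.≟ e))

  -- The edge flows at e containing the edge at the sink b j.
  ℱ : Edge → Fin n → Subset #edges → Set
  ℱ e j F = IsEdgeFlow e F × ∃[ f ] f ∈ F × tgt f ≡ b j

  ℱ? : ∀ e j → Decidable (ℱ e j)
  ℱ? e j F = isEdgeFlow? e F ×-dec any? (λ f → f ∈? F ×-dec tgt f ≟ᵥ b j)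

  edgeFlows : Edge → Fin n → List (Subset #edges)
  edgeFlows e j = filter (ℱ? e j) (subsets #edges)

  conservativeFlows : List (Subset #edges)
  conservativeFlows = filter isConservativeFlow? (subsets #edges)

  -- P is the path P_{e,b_j} of F: F is the disjoint union of the edges of P,
  -- all distinct, and of a conservative flow.
  IsPathOf : Edge → Fin n → Subset #edges → List Edge → Set
  IsPathOf e j F P =
    IsPathFrom e j P × Unique P ×
    ∃[ C ] IsConservativeFlow C ×
           (∀ f → f ∈ F ⇔ (f ∈ₗ P ⊎ f ∈ C)) ×
           (∀ f → ¬ (f ∈ₗ P × f ∈ C))

data Colour : Set where
  white black : Colour

record PlabicGraph (k n : ℕ) : Set where
  field
    digraph : Digraph n
  open Digraph digraph public
  field
    I               : Columns k n
    colour          : Fin #internals → Colour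
    boundary-degree : ∀ i → degree (b i) ≡ 1
    boundary-source : ∀ i → i ∈ Columns.set I ⇔ outdegree (b i) ≡ 1
    internal-degree : ∀ v → degree (internal v) ≡ 2 ⊎ degree (internal v) ≡ 3
    white-vertex    : ∀ v → colour v ≡ white → indegree (internal v) ≡ 1
    black-vertex    : ∀ v → colour v ≡ black → outdegree (internal v) ≡ 1
    not-isolated    : ∀ v → ∃[ i ] EqClosure Adjacent (internal v) (b i)

  -- number of boundary sources strictly between b i and b j
  sourcesBetween : Fin n → Fin n → ℕ
  sourcesBetween i j =
    length (filter (λ s → toℕ i ⊓ toℕ j ℕP.<? toℕ (Columns.at I s) ×-dec
                          toℕ (Columns.at I s) ℕP.<? toℕ i ⊔ toℕ j)
                   (allFin k))

------------------------------------------------------------------------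

module Plabic {c ℓ₁ ℓ₂ : Level} (K : OrderedField c ℓ₁ ℓ₂) where

  open OrderedField K hiding (_-_; zero; refl)
  open OrderedField K using () renaming (_-_ to _∸_; refl to ref)
  open import Algebra.Definitions.RawMonoid +-rawMonoid using (sum)
  open import Algebra.Properties.Semiring.Exp semiring using (_^_)
  open import Relation.Binary.Reasoning.Setoid setoid
  open import Algebra.Properties.Group +-group using () renaming (∙-cancelʳ to +-cancelʳ)
  import Algebra.Solver.Ring.NaturalCoefficients.Default commutativeSemiring as Solver

  ∑ ∏ : ∀ {a} {A : Set a} → List A → (A → Carrier) → Carrier
  ∑ xs f = foldr (λ x s → f x + s) 0# xs
  ∏ xs f = foldr (λ x s → f x * s) 1# xs

  -1^ : ℤ → Carrier
  -1^ z with parity ℤ.∣ z ∣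
  ... | 0ℙ = 1#
  ... | 1ℙ = - 1#

  -- A point of the Grassmannian GL⁺ \ Mat is handled through its representing
  -- matrices.

  Matrix : ℕ → ℕ → Set c
  Matrix k n = Fin k → Fin n → Carrier

  det : ∀ {k} → Matrix k k → Carrier
  det {zero}  A = 1#
  det {suc k} A =
    sum λ i → -1^ (ℤ.+ toℕ i) * A zero i * det (λ r s → A (suc r) (punchIn i s))

  Δ : ∀ {k n} → Columns k n → Matrix k n → Carrier
  Δ J A = det λ r s → A r (Columns.at J s)

  RowsIndependent : ∀ {k n} → Matrix k n → Set (c ⊔ˡ ℓ₁)
  RowsIndependent {k} A = ∀ (a : Fin k → Carrier) → (∀ j → sum (λ r → a r * A r j) ≈ 0#) → ∀ r → a r ≈ 0#

  record MatTNN {k n : ℕ} (A : Matrix k n) : Set (c ⊔ˡ ℓ₁ ⊔ˡ ℓ₂) where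
    field
      rank-k : RowsIndependent A
      minors : ∀ J → 0# ≤ Δ J A

  record STNN {k n : ℕ} (M : Matroid k n) (A : Matrix k n) : Set (c ⊔ˡ ℓ₁ ⊔ˡ ℓ₂) where
    open Matroid M
    field
      matTNN   : MatTNN A
      positive : ∀ J → IsBasis (Columns.set J) → 0# < Δ J A
      vanish   : ∀ J → ¬ IsBasis (Columns.set J) → Δ J A ≈ 0#

  SameClass : ∀ {k n} → Matrix k n → Matrix k n → Set (c ⊔ˡ ℓ₁ ⊔ˡ ℓ₂)
  SameClass {k} A A′ =
    ∃[ g ] 0# < det {k} g × (∀ r j → A r j ≈ sum (λ s → g r s * A′ s j))

  IdentityOn : ∀ {k n} → Columns k n → Matrix k n → Set ℓ₁
  IdentityOn I A = ∀ r s → A r (Columns.at I s) ≈ (if does (r FinP.≟ s) then 1# else 0#)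

  IsReducedEchelon : ∀ {k n} → Columns k n → Matrix k n → Matrix k n → Set (c ⊔ˡ ℓ₁ ⊔ˡ ℓ₂)
  IsReducedEchelon I A B = SameClass A B × IdentityOn I A

  -- Infinite sums of monomials understood as rational functions.  A formal
  -- power series S in m variables is the rational function p / q when
  -- q S = p as power series.

  Monomial : ℕ → Set
  Monomial m = Vec ℕ m

  _≟ₘ_ : ∀ {m} → DecidableEquality (Monomial m)
  _≟ₘ_ = VecP.≡-dec ℕP._≟_

  Series : ℕ → Set c
  Series m = Monomial m → Carrier

  Polynomial : ℕ → Set c
  Polynomial m = List (Carrier × Monomial m)

  coefficient : ∀ {m} → Polynomial m → Series m
  coefficient p α = ∑ p λ (a , β) → if does (β ≟ₘ α) then a else 0#

  _⊛_ : ∀ {m} → Polynomial m → Series m → Series m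
  (q ⊛ S) α = ∑ q λ (a , β) →
    if does (Pointwise.decidable ℕP._≤?_ β α) then a * S (zipWith ℕ._∸_ α β) else 0#

  evaluate : ∀ {m} → Polynomial m → (Fin m → Carrier) → Carrier
  evaluate {m} p w = ∑ p λ (a , β) → a * ∏ (allFin m) (λ i → w i ^ lookup β i)

  -- S is a rational function, regular at w and with value x there.
  SumsTo : ∀ {m} → Series m → (Fin m → Carrier) → Carrier → Set (c ⊔ˡ ℓ₁)
  SumsTo S w x = ∃₂ λ p q →
    (∀ α → (q ⊛ S) α ≈ coefficient p α) ×
    ¬ evaluate q w ≈ 0# ×
    x * evaluate q w ≈ evaluate p w

  -- The series Σ ε(P) w(P) over the words P in the m letters that satisfy a
  -- given property, w being the formal variables: the coefficient of wᵅ is the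
  -- sum of ε(P) over the finitely many P in which the letter f occurs α_f times.
  module _ {m : ℕ} where

    words : ℕ → List (List (Fin m))
    words zero    = [ [] ]
    words (suc l) = concatMap (λ P → map (_∷ P) (allFin m)) (words l)

    multiplicity : List (Fin m) → Monomial m
    multiplicity P = tabulate λ f → length (filter (FinP._≟ f) P)

    series : {Q : List (Fin m) → Set} → Decidable Q → (List (Fin m) → Carrier) → Series m
    series Q? ε α =
      ∑ (filter (λ P → Q? P ×-dec multiplicity P ≟ₘ α) (words (Vec.sum α))) ε

  Point : Set c
  Point = Carrier × Carrier

  infix 4 _≈ₚ_
  infixl 6 _+ₚ_ _-ₚ_
  infixr 7 _·_

  _≈ₚ_ : Rel Point ℓ₁
  (x , y) ≈ₚ (x′ , y′) = x ≈ x′ × y ≈ y′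

  _+ₚ_ _-ₚ_ : Point → Point → Point
  (x , y) +ₚ (x′ , y′) = x + x′ , y + y′
  (x , y) -ₚ (x′ , y′) = x ∸ x′ , y ∸ y′

  _·_ : Carrier → Point → Point
  a · (x , y) = a * x , a * y

  cross : Point → Point → Carrier
  cross (x , y) (x′ , y′) = x * y′ ∸ y * x′

  -- +1 for a counterclockwise pair (u , v), the y-axis pointing up
  sgn : Point → Point → ℤ
  sgn u v with compare 0# (cross u v)
  ... | tri< _ _ _ = 1ℤ
  ... | tri≈ _ _ _ = 0ℤ
  ... | tri> _ _ _ = -1ℤ

  OnSegment : Point → Point → Point → Set (c ⊔ˡ ℓ₁ ⊔ˡ ℓ₂)
  OnSegment p q x = ∃[ a ] 0# ≤ a × a ≤ 1# × x ≈ₚ p +ₚ a · (q -ₚ p)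

  -- The segment from p to p + v crosses the ray from o in direction l, at a
  -- point other than o.  Parallel segments are left out; the gauge conditions
  -- below ensure that no edge is parallel to the ray direction.
  Crosses : Point → Point → Point → Point → Set (c ⊔ˡ ℓ₁ ⊔ˡ ℓ₂)
  Crosses p v o l = ¬ cross v l ≈ 0# ×
    ∃₂ λ a t → 0# ≤ a × a ≤ 1# × 0# < t × p +ₚ a · v ≈ₚ o +ₚ t · l

  private
    -- Cramer's rule, in subtraction-free form
    ∸-+ : ∀ x y → (x ∸ y) + y ≈ x
    ∸-+ x y = trans (+-assoc x (- y) y) (trans (+-congˡ (-‿inverseˡ y)) (+-identityʳ x))

    module Cramer (p₁ p₂ v₁ v₂ o₁ o₂ l₁ l₂ : Carrier) where
      open Solver using (solve; _:=_; _:+_; _:*_)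
      x y d A T : Carrier
      x = o₁ ∸ p₁
      y = o₂ ∸ p₂
      d = cross (v₁ , v₂) (l₁ , l₂)
      A = cross (x , y) (l₁ , l₂)
      T = cross (x , y) (v₁ , v₂)

      d+ : d + v₂ * l₁ ≈ v₁ * l₂
      d+ = ∸-+ _ _
      A+ : A + y * l₁ ≈ x * l₂
      A+ = ∸-+ _ _
      T+ : T + y * v₁ ≈ x * v₂
      T+ = ∸-+ _ _

      module Necessary {a t : Carrier} (e₁ : p₁ + a * v₁ ≈ o₁ + t * l₁) (e₂ : p₂ + a * v₂ ≈ o₂ + t * l₂) where
        shift : ∀ {p o av tl} → p + av ≈ o + tl → av ≈ (o ∸ p) + tl
        shift {p} {o} {av} {tl} e = +-cancelʳ p av ((o ∸ p) + tl) (begin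
          av + p              ≈⟨ +-comm av p ⟩
          p + av              ≈⟨ e ⟩
          o + tl              ≈⟨ +-congʳ (sym (∸-+ o p)) ⟩
          ((o ∸ p) + p) + tl  ≈⟨ solve 3 (λ x y z → (x :+ y) :+ z := (x :+ z) :+ y) ref (o ∸ p) p tl ⟩
          ((o ∸ p) + tl) + p  ∎)
        f₁ : a * v₁ ≈ x + t * l₁
        f₁ = shift e₁
        f₂ : a * v₂ ≈ y + t * l₂
        f₂ = shift e₂

        ad≈A : a * d ≈ A
        ad≈A = +-cancelʳ (a * v₂ * l₁ + y * l₁) _ _ (begin
          a * d + (a * v₂ * l₁ + y * l₁)
            ≈⟨ solve 5 (λ a d v₂ l₁ y → a :* d :+ (a :* v₂ :* l₁ :+ y :* l₁) := a :* (d :+ v₂ :* l₁) :+ y :* l₁) ref a d v₂ l₁ y ⟩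
          a * (d + v₂ * l₁) + y * l₁     ≈⟨ +-congʳ (*-congˡ d+) ⟩
          a * (v₁ * l₂) + y * l₁         ≈⟨ +-congʳ (sym (*-assoc a v₁ l₂)) ⟩
          a * v₁ * l₂ + y * l₁           ≈⟨ +-congʳ (*-congʳ f₁) ⟩
          (x + t * l₁) * l₂ + y * l₁
            ≈⟨ solve 5 (λ x t l₁ l₂ y → (x :+ t :* l₁) :* l₂ :+ y :* l₁ := (y :+ t :* l₂) :* l₁ :+ x :* l₂) ref x t l₁ l₂ y ⟩
          (y + t * l₂) * l₁ + x * l₂     ≈⟨ +-cong (*-congʳ (sym f₂)) (sym A+) ⟩
          a * v₂ * l₁ + (A + y * l₁)
            ≈⟨ solve 3 (λ u A w → u :+ (A :+ w) := A :+ (u :+ w)) ref (a * v₂ * l₁) A (y * l₁) ⟩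
          A + (a * v₂ * l₁ + y * l₁)     ∎)

        td≈T : t * d ≈ T
        td≈T = +-cancelʳ (t * v₂ * l₁ + y * v₁) _ _ (begin
          t * d + (t * v₂ * l₁ + y * v₁)
            ≈⟨ solve 6 (λ t d v₂ l₁ y v₁ → t :* d :+ (t :* v₂ :* l₁ :+ y :* v₁) := t :* (d :+ v₂ :* l₁) :+ y :* v₁) ref t d v₂ l₁ y v₁ ⟩
          t * (d + v₂ * l₁) + y * v₁     ≈⟨ +-congʳ (*-congˡ d+) ⟩
          t * (v₁ * l₂) + y * v₁
            ≈⟨ solve 4 (λ t v₁ l₂ y → t :* (v₁ :* l₂) :+ y :* v₁ := (y :+ t :* l₂) :* v₁) ref t v₁ l₂ y ⟩
          (y + t * l₂) * v₁              ≈⟨ *-congʳ (sym f₂) ⟩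
          a * v₂ * v₁                    ≈⟨ solve 3 (λ a v₂ v₁ → a :* v₂ :* v₁ := a :* v₁ :* v₂) ref a v₂ v₁ ⟩
          a * v₁ * v₂                    ≈⟨ *-congʳ f₁ ⟩
          (x + t * l₁) * v₂
            ≈⟨ solve 4 (λ x t l₁ v₂ → (x :+ t :* l₁) :* v₂ := x :* v₂ :+ t :* v₂ :* l₁) ref x t l₁ v₂ ⟩
          x * v₂ + t * v₂ * l₁           ≈⟨ +-congʳ (sym T+) ⟩
          (T + y * v₁) + t * v₂ * l₁     ≈⟨ solve 3 (λ T u w → (T :+ u) :+ w := T :+ (w :+ u)) ref T (y * v₁) (t * v₂ * l₁) ⟩
          T + (t * v₂ * l₁ + y * v₁)     ∎)

      Av₁ : A * v₁ ≈ d * x + T * l₁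
      Av₁ = +-cancelʳ (y * l₁ * v₁ + v₂ * l₁ * x) _ _ (begin
        A * v₁ + (y * l₁ * v₁ + v₂ * l₁ * x)
          ≈⟨ solve 6 (λ A v₁ y l₁ v₂ x → A :* v₁ :+ (y :* l₁ :* v₁ :+ v₂ :* l₁ :* x) := (A :+ y :* l₁) :* v₁ :+ v₂ :* l₁ :* x) ref A v₁ y l₁ v₂ x ⟩
        (A + y * l₁) * v₁ + v₂ * l₁ * x  ≈⟨ +-congʳ (*-congʳ A+) ⟩
        x * l₂ * v₁ + v₂ * l₁ * x
          ≈⟨ solve 5 (λ x l₂ v₁ v₂ l₁ → x :* l₂ :* v₁ :+ v₂ :* l₁ :* x := v₁ :* l₂ :* x :+ x :* v₂ :* l₁) ref x l₂ v₁ v₂ l₁ ⟩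
        v₁ * l₂ * x + x * v₂ * l₁        ≈⟨ +-cong (*-congʳ (sym d+)) (*-congʳ (sym T+)) ⟩
        (d + v₂ * l₁) * x + (T + y * v₁) * l₁
          ≈⟨ solve 7 (λ d v₂ l₁ x T y v₁ → (d :+ v₂ :* l₁) :* x :+ (T :+ y :* v₁) :* l₁ := (d :* x :+ T :* l₁) :+ (y :* l₁ :* v₁ :+ v₂ :* l₁ :* x)) ref d v₂ l₁ x T y v₁ ⟩
        (d * x + T * l₁) + (y * l₁ * v₁ + v₂ * l₁ * x) ∎)

      Av₂ : A * v₂ ≈ d * y + T * l₂
      Av₂ = +-cancelʳ (y * l₁ * v₂ + y * v₁ * l₂) _ _ (begin
        A * v₂ + (y * l₁ * v₂ + y * v₁ * l₂)
          ≈⟨ solve 6 (λ A v₂ y l₁ v₁ l₂ → A :* v₂ :+ (y :* l₁ :* v₂ :+ y :* v₁ :* l₂) := (A :+ y :* l₁) :* v₂ :+ y :* v₁ :* l₂) ref A v₂ y l₁ v₁ l₂ ⟩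
        (A + y * l₁) * v₂ + y * v₁ * l₂  ≈⟨ +-congʳ (*-congʳ A+) ⟩
        x * l₂ * v₂ + y * v₁ * l₂
          ≈⟨ solve 5 (λ x l₂ v₂ y v₁ → x :* l₂ :* v₂ :+ y :* v₁ :* l₂ := v₁ :* l₂ :* y :+ x :* v₂ :* l₂) ref x l₂ v₂ y v₁ ⟩
        v₁ * l₂ * y + x * v₂ * l₂        ≈⟨ +-cong (*-congʳ (sym d+)) (*-congʳ (sym T+)) ⟩
        (d + v₂ * l₁) * y + (T + y * v₁) * l₂
          ≈⟨ solve 7 (λ d v₂ l₁ y T v₁ l₂ → (d :+ v₂ :* l₁) :* y :+ (T :+ y :* v₁) :* l₂ := (d :* y :+ T :* l₂) :+ (y :* l₁ :* v₂ :+ y :* v₁ :* l₂)) ref d v₂ l₁ y T v₁ l₂ ⟩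
        (d * y + T * l₂) + (y * l₁ * v₂ + y * v₁ * l₂) ∎)

      module _ {d⁻¹ : Carrier} (inv : d * d⁻¹ ≈ 1#) where
        a₀ t₀ : Carrier
        a₀ = A * d⁻¹
        t₀ = T * d⁻¹

        solution : ∀ {p o v l} → A * v ≈ d * (o ∸ p) + T * l → p + a₀ * v ≈ o + t₀ * l
        solution {p} {o} {v} {l} e = begin
          p + A * d⁻¹ * v
            ≈⟨ solve 4 (λ p A d′ v → p :+ A :* d′ :* v := p :+ d′ :* (A :* v)) ref p A d⁻¹ v ⟩
          p + d⁻¹ * (A * v)                     ≈⟨ +-congˡ (*-congˡ e) ⟩
          p + d⁻¹ * (d * (o ∸ p) + T * l)
            ≈⟨ solve 6 (λ p d′ d x T l → p :+ d′ :* (d :* x :+ T :* l) := (d :* d′ :* x :+ p) :+ T :* d′ :* l) ref p d⁻¹ d (o ∸ p) T l ⟩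
          (d * d⁻¹ * (o ∸ p) + p) + T * d⁻¹ * l ≈⟨ +-congʳ (+-congʳ (trans (*-congʳ inv) (*-identityˡ _))) ⟩
          ((o ∸ p) + p) + T * d⁻¹ * l           ≈⟨ +-congʳ (∸-+ o p) ⟩
          o + T * d⁻¹ * l                       ∎

        quotient : ∀ {z Z} → z * d ≈ Z → z ≈ Z * d⁻¹
        quotient {z} {Z} e = begin
          z               ≈⟨ sym (*-identityʳ z) ⟩
          z * 1#          ≈⟨ *-congˡ (sym inv) ⟩
          z * (d * d⁻¹)   ≈⟨ sym (*-assoc z d d⁻¹) ⟩
          z * d * d⁻¹     ≈⟨ *-congʳ e ⟩
          Z * d⁻¹         ∎

    module ≤-Resp = StrictToNonStrict _≈_ _<_
    ≤-respˡ : ∀ {x y z} → y ≈ z → y ≤ x → z ≤ x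
    ≤-respˡ = ≤-Resp.≤-respˡ-≈ sym trans Order.<-respˡ-≈
    ≤-respʳ : ∀ {x y z} → y ≈ z → x ≤ y → x ≤ z
    ≤-respʳ = ≤-Resp.≤-respʳ-≈ trans Order.<-respʳ-≈

  crosses? : ∀ p v o l → Dec (Crosses p v o l)
  crosses? p v o l with cross v l ≟ 0#
  ... | yes d≈0 = no λ (d≉0 , _) → d≉0 d≈0
  ... | no  d≉0 = map′
    (λ (0≤a , a≤1 , 0<t) → d≉0 , a₀ inv , t₀ inv , 0≤a , a≤1 , 0<t , solution inv Av₁ , solution inv Av₂)
    (λ (_ , a , t , 0≤a , a≤1 , 0<t , e₁ , e₂) →
       let a≈a₀ = quotient inv (Necessary.ad≈A e₁ e₂)
           t≈t₀ = quotient inv (Necessary.td≈T e₁ e₂)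
       in ≤-respʳ a≈a₀ 0≤a , ≤-respˡ a≈a₀ a≤1 , Order.<-respʳ-≈ t≈t₀ 0<t)
    (0# ≤? a₀ inv ×-dec a₀ inv ≤? 1# ×-dec 0# <? t₀ inv)
    where
    open Cramer (proj₁ p) (proj₂ p) (proj₁ v) (proj₂ v) (proj₁ o) (proj₂ o) (proj₁ l) (proj₂ l)
    inv = proj₂ (invertible d≉0)

  -- The disk is the closed half-plane to the right of
  -- an oriented line (with a point at infinity added); the boundary is then
  -- traversed clockwise in the direction of the line.

  record Drawing {k n : ℕ} (G : PlabicGraph k n) : Set (c ⊔ˡ ℓ₁ ⊔ˡ ℓ₂) where
    open PlabicGraph G
    field
      origin direction : Point
      parameter        : Fin n → Carrier
      position         : Vertex → Point

    vec : Edge → Point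
    vec f = position (tgt f) -ₚ position (src f)

    field
      on-line     : ∀ i → position (b i) ≈ₚ origin +ₚ parameter i · direction
      clockwise   : ∀ {i j} → i Fin.< j → parameter i < parameter j
      inside-disk : ∀ v → sgn direction (position (internal v) -ₚ origin) ≡ -1ℤ
      injective   : ∀ {u v} → position u ≈ₚ position v → u ≡ v
      no-loops    : ∀ f → src f ≢ tgt f
      planar      : ∀ {f g} → f ≢ g → ∀ x →
                    OnSegment (position (src f)) (position (tgt f)) x →
                    OnSegment (position (src g)) (position (tgt g)) x →
                    ∃[ v ] (v ≡ src f ⊎ v ≡ tgt f) × (v ≡ src g ⊎ v ≡ tgt g) × position v ≈ₚ x

  record PlabicNetwork (k n : ℕ) : Set (c ⊔ˡ ℓ₁ ⊔ˡ ℓ₂) where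
    field
      graph   : PlabicGraph k n
      drawing : Drawing graph
    open PlabicGraph graph public
    open Drawing drawing public
    field
      weight     : Edge → Carrier
      weight-pos : ∀ f → 0# < weight f

    w : Subset #edges → Carrier
    w F = ∏ (filter (_∈? F) (allFin #edges)) weight

    record IsGaugeRay (𝔩 : Point) : Set (c ⊔ˡ ℓ₁ ⊔ˡ ℓ₂) where
      field
        points-inside : sgn direction 𝔩 ≡ -1ℤ
        not-parallel  : ∀ f → IsInternalEdge f → sgn (vec f) 𝔩 ≢ 0ℤ
        generic       : ∀ i v t → 0# ≤ t → ¬ position (internal v) ≈ₚ position (b i) +ₚ t · 𝔩

    module Gauge (𝔩 : Point) where

      -- Three equal signs 0 also give 0.
      windₑ : Edge → Edge → ℤ
      windₑ f g =
        if does (sgn (vec f) (vec g) ℤP.≟ sgn (vec f) 𝔩 ×-dec sgn (vec f) (vec g) ℤP.≟ sgn 𝔩 (vec g))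
        then sgn (vec f) (vec g) else 0ℤ

      intₑ : Edge → ℕ
      intₑ f = length (filter (λ r → crosses? (position (src f)) (vec f) (position (b (Columns.at I r))) 𝔩)
                              (allFin k))

      wind : List Edge → ℤ
      wind []           = 0ℤ
      wind (f ∷ [])     = 0ℤ
      wind (f ∷ g ∷ fs) = windₑ f g ℤ.+ wind (g ∷ fs)

      int : List Edge → ℕ
      int P = ℕL.sum (map intₑ P)

      -- The value of the component (E_e)_j of the edge vector at e, for the
      -- canonical boundary vectors.
      IsEdgeComponent : Edge → Fin n → Carrier → Set (c ⊔ˡ ℓ₁)
      IsEdgeComponent e j =
        SumsTo (series (isPathFrom? e j) (λ P → -1^ (wind P ℤ.+ ℤ.+ int P))) weight

    -- The parity of the topological winding index of a walk is that of the
    -- number of loops removed in its loop erasure.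
    IsBoundaryMeasurement : Fin n → Fin n → Carrier → Set (c ⊔ˡ ℓ₁)
    IsBoundaryMeasurement i j =
      SumsTo (series (λ P → isWalk? (b i) P (b j)) (λ P → -1^ (ℤ.+ loopsErased (b i) P))) weight

    IsBoundaryMeasurementMatrix : Matrix k n → Set (c ⊔ˡ ℓ₁)
    IsBoundaryMeasurementMatrix A =
      IdentityOn I A ×
      (∀ r j → j ∉ Columns.set I →
         ∃[ m ] IsBoundaryMeasurement (Columns.at I r) j m ×
                A r j ≈ -1^ (ℤ.+ sourcesBetween (Columns.at I r) j) * m)

    Represents : Matrix k n → Set (c ⊔ˡ ℓ₁ ⊔ˡ ℓ₂)
    Represents B = ∃[ A ] IsBoundaryMeasurementMatrix A × SameClass A B

    edgeFlowSum : Edge → Fin n → Carrier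
    edgeFlowSum e j = ∑ (edgeFlows e j) w

    conservativeFlowSum : Carrier
    conservativeFlowSum = ∑ conservativeFlows w

    private
      +-pos : ∀ {x y} → 0# < x → 0# < y → 0# < x + y
      +-pos {x} {y} 0<x 0<y =
        Order.trans 0<y (Order.<-respˡ-≈ (+-identityˡ y) (+-monoˡ-< y 0<x))

      ∏-pos : ∀ {a} {A : Set a} (xs : List A) {f : A → Carrier} → (∀ x → 0# < f x) → 0# < ∏ xs f
      ∏-pos []       pos = 0<1
      ∏-pos (x ∷ xs) pos = *-pos (pos x) (∏-pos xs pos)

      ∑-pos : ∀ {a} {A : Set a} {x : A} {xs : List A} {f : A → Carrier} →
              (∀ x → 0# < f x) → x ∈ₗ xs → 0# < ∑ xs f
      ∑-pos {xs = x ∷ []}     {f} pos _ = Order.<-respʳ-≈ (sym (+-identityʳ (f x))) (pos x)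
      ∑-pos {xs = x ∷ y ∷ xs} pos _ = +-pos (pos x) (∑-pos {xs = y ∷ xs} pos (here refl))

      ⊥∈subsets : ∀ m → ⊥ ∈ₗ subsets m
      ⊥∈subsets zero    = here refl
      ⊥∈subsets (suc m) = ∈-++⁺ˡ (∈-map⁺ (outside ∷_) (⊥∈subsets m))

      ⊥-conservative : IsConservativeFlow ⊥
      ⊥-conservative =
        (λ f f∈⊥ → ⊥-elim (∉⊥ f∈⊥)) ,
        (λ v → ≡.trans (none (λ f → tgt f ≟ᵥ internal v)) (≡.sym (none (λ f → src f ≟ᵥ internal v))))
        where
        none : ∀ {Q : Edge → Set} (Q? : Decidable Q) →
               length (filter (λ f → f ∈? ⊥ ×-dec Q? f) (allFin #edges)) ≡ 0
        none Q? = ≡.cong length (filter-none _ (universal (λ f (f∈⊥ , _) → ∉⊥ f∈⊥) (allFin #edges)))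

    conservativeFlowSum≉0 : ¬ conservativeFlowSum ≈ 0#
    conservativeFlowSum≉0 Z≈0 = Order.irrefl (sym Z≈0)
      (∑-pos (λ F → ∏-pos (filter (_∈? F) (allFin #edges)) weight-pos)
             (∈-filter⁺ isConservativeFlow? (⊥∈subsets #edges) ⊥-conservative))

-- The winding number counts the passages of the tangent through the gauge
-- direction.  For a simple polygonal curve it is found modulo 2 by Hopf's
-- argument: the secant vector does not vanish on the triangle of pairs of
-- points, so the tangents turn as often as the secants from the two ends do.
-- Hence a simple cycle has odd winding, and the winding of a simple path from
-- b i to b j tells whether the path starts and ends on different sides of the
-- ray from b i.  An edge crosses a ray when its ends lie on different sides of
-- it, so the crossings telescope along a walk.  At a vertex with a single
-- incoming or a single outgoing edge, the turns of a walk are those left after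
-- cutting out a loop together with those of the loop, so every loop removed
-- from a walk changes its sign.  The sum over pairs (conservative flow, walk)
-- then collapses by the involution that moves the first loop of the walk into
-- the flow, or the first cycle of the flow met by the walk into the walk; the
-- remaining pairs, a simple path and a flow avoiding it, are the edge flows.

module Submission where

open import Defs

open import Algebra.Bundles using (RawRing)
import Algebra.Properties.Monoid.Mult.TCOptimised
import Algebra.Properties.Ring
import Algebra.Properties.Semiring.Exp
import Algebra.Properties.Semiring.Mult.TCOptimised
import Algebra.Properties.Semiring.Sum
import Algebra.Solver.Ring
open import Algebra.Solver.Ring.AlmostCommutativeRing using (fromCommutativeRing; _-Raw-AlmostCommutative⟶_)
import Algebra.Solver.Ring.Simple
open import Data.Bool.Base using (if_then_else_)
open import Data.Empty using (⊥; ⊥-elim)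
open import Data.Fin.Base as Fin using (Fin; zero; suc)
open import Data.Fin.Properties as FinP using ()
open import Data.Fin.Subset as Subset using (Subset; inside; outside; _∈_; _∉_; _∪_; _─_; ⁅_⁆; ⋃)
open import Data.Fin.Subset.Properties using (∉⊥; _∈?_; x∈⁅x⁆; x∈p∪q⁺; x∈p∪q⁻; x∈p∧x∉q⇒x∈p─q; p─q⊆p; ⊆-antisym)
open import Data.Integer as ℤ using (ℤ; 0ℤ; 1ℤ; -1ℤ)
open import Data.Integer.Properties as ℤP using ()
open import Data.List.Base as List using (List; []; _∷_; [_]; length; map; filter; allFin; _++_; head; dropWhile; concatMap; deduplicate)
open import Data.List.Membership.DecPropositional using () renaming (_∈?_ to mem?)
open import Data.List.Membership.Propositional using () renaming (_∈_ to _∈ₗ_; _∉_ to _∉ₗ_)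
open import Data.List.Membership.Propositional.Properties using (∈-++⁺ˡ; ∈-++⁺ʳ; ∈-++⁻; ∈-map⁺; ∈-map⁻; ∈-tabulate⁺; ∈-filter⁺; ∈-filter⁻; ∈-allFin; ∈-∃++; ∈-deduplicate⁺)
open import Data.List.Membership.Propositional.Properties.WithK using (unique∧set⇒bag)
open import Data.List.Properties as ListP using (map-++; ++-assoc; ++-identityʳ; ∷-injective)
open import Data.List.Relation.Binary.BagAndSetEquality using (∼bag⇒↭)
open import Data.List.Relation.Binary.Disjoint.Propositional using (Disjoint)
open import Data.List.Relation.Binary.Permutation.Propositional.Properties using (↭-length)
open import Data.List.Relation.Unary.All as All using (All; []; _∷_)
open import Data.List.Relation.Unary.All.Properties as AllP using ()
open import Data.List.Relation.Unary.AllPairs using ([]; _∷_)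
open import Data.List.Relation.Unary.Any using (here; there)
open import Data.List.Relation.Unary.Unique.DecPropositional using (unique?)
import Data.List.Relation.Unary.Unique.DecPropositional.Properties as UniqueDec
open import Data.List.Relation.Unary.Unique.Propositional using (Unique)
open import Data.List.Relation.Unary.Unique.Propositional.Properties as UniqueP using (Unique[x∷xs]⇒x∉xs; allFin⁺)
open import Data.Maybe.Base as Maybe using (Maybe; just)
open import Data.Nat.Base as ℕ using (ℕ; zero; suc; z≤n; s≤s; parity)
open import Data.Nat.Properties as ℕP using ()
open import Data.Nat.Solver using (module +-*-Solver)
open import Data.Parity.Base as ℙ using (Parity; 0ℙ; 1ℙ; _⁻¹)
open import Data.Parity.Properties as ℙP using ()
open import Data.Product using (_×_; _,_; proj₁; proj₂; ∃-syntax; ∃₂; Σ-syntax)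
open import Data.Sum.Base as Sum using (_⊎_; inj₁; inj₂; [_,_]′)
open import Data.Unit.Base using (⊤; tt)
open import Data.Vec.Base as Vec using (Vec; []; _∷_; lookup; tabulate; zipWith; _[_]=_; here; there)
import Data.Vec.Functional as VF
import Data.Vec.Functional.Properties as VFP
open import Data.Vec.Properties as VecP using ()
open import Data.Vec.Relation.Binary.Pointwise.Inductive as Pointwise using (Pointwise; []; _∷_)
open import Function.Base using (_∘_; case_of_; id)
open import Function.Bundles using (_⇔_; mk⇔; Equivalence)
open import Level using (Level; Lift; lift) renaming (_⊔_ to _⊔ˡ_)
open import Relation.Binary.Consequences using (dec⇒weaklyDec)
open import Relation.Binary.Definitions using (Tri; tri<; tri≈; tri>)
open import Relation.Binary.PropositionalEquality as ≡ using (_≡_; _≢_; refl)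
open import Relation.Nullary using (¬_; Dec; yes; no; does; contradiction; ¬?)
open import Relation.Nullary.Decidable using (_×-dec_; dec-true; map′; decidable-stable)
open import Relation.Unary using (Decidable)

-- Angles cannot be lifted over an abstract ordered field, so Hopf's homotopy runs over a finite
-- grid. `turn` is defined for every pair of vectors and is additive on a triple whose convex hull
-- misses the origin (`turn-compose`); the triangle of pairs of points is cut into such triples. A
-- vanishing convex combination of secants between two edges is a common point of these edges, so
-- planarity supplies the hypothesis. Secants, unlike edges, may be parallel to the gauge ray, which
-- is why `Right` breaks a tie.
--
-- On a simple path from a boundary source, the winding and the crossings of that source's own ray
-- have equal parity and cancel; the other rays give the number of sources in between. The signs of
-- the edge vector and of the boundary measurement both flip with every loop removed, so a single
-- cancellation, carried out coefficient by coefficient in the weights, evaluates the two series as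
-- one quotient of flow polynomials up to a constant sign. Equality with `A` is then a matter of
-- uniqueness: of the value of a rational function presented by a series, and of the echelon form of
-- a class.

-- Ring identities with subtraction, normalised over integer coefficients.

module IntegerSolver {c ℓ₁ ℓ₂ : Level} (K : OrderedField c ℓ₁ ℓ₂) where
  open OrderedField K using (commutativeRing)
  open OrderedField K hiding (zero; commutativeRing; refl) renaming (_-_ to _∸_)
  open Algebra.Properties.Ring ring using (-‿distribˡ-*; -‿distribʳ-*; -‿+-comm; -‿involutive; -0#≈0#)
  open Algebra.Properties.Semiring.Mult.TCOptimised semiring using (×1-homo-*) renaming (_×_ to _×#_)
  open Algebra.Properties.Monoid.Mult.TCOptimised +-monoid using (×-homo-+; 1+×)
  open import Relation.Binary.Reasoning.Setoid setoid

  -- Integers have an equality test that computes, so opposite terms cancel in normal forms over the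
  -- abstract scalars. The optimised multiple makes `con 1ℤ` reduce to `1#`.
  ⟦_⟧ᶻ : ℤ → Carrier
  ⟦ ℤ.+ n ⟧ᶻ      = n ×# 1#
  ⟦ ℤ.-[1+ n ] ⟧ᶻ = - (suc n ×# 1#)

  private
    neg-homo : ∀ i → ⟦ ℤ.- i ⟧ᶻ ≈ - ⟦ i ⟧ᶻ
    neg-homo (ℤ.+ zero)   = sym -0#≈0#
    neg-homo (ℤ.+ suc n)  = OrderedField.refl K
    neg-homo ℤ.-[1+ n ]   = sym (-‿involutive _)

    ⊖-homo : ∀ m n → ⟦ m ℤ.⊖ n ⟧ᶻ ≈ m ×# 1# ∸ n ×# 1#
    ⊖-homo m zero = begin
      m ×# 1#       ≈⟨ sym (+-identityʳ _) ⟩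
      m ×# 1# + 0#  ≈⟨ +-congˡ (sym -0#≈0#) ⟩
      m ×# 1# ∸ 0#  ∎
    ⊖-homo zero (suc n) = sym (+-identityˡ _)
    ⊖-homo (suc m) (suc n) = begin
      ⟦ suc m ℤ.⊖ suc n ⟧ᶻ            ≡⟨ ≡.cong ⟦_⟧ᶻ (ℤP.[1+m]⊖[1+n]≡m⊖n m n) ⟩
      ⟦ m ℤ.⊖ n ⟧ᶻ                    ≈⟨ ⊖-homo m n ⟩
      x ∸ y                           ≈⟨ +-congˡ (sym (+-identityˡ (- y))) ⟩
      x + (0# ∸ y)                    ≈⟨ +-congˡ (+-congʳ (sym (-‿inverseʳ 1#))) ⟩
      x + ((1# ∸ 1#) ∸ y)             ≈⟨ +-congˡ (+-assoc _ _ _) ⟩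
      x + (1# + (- 1# ∸ y))           ≈⟨ sym (+-assoc _ _ _) ⟩
      (x + 1#) + (- 1# ∸ y)           ≈⟨ +-cong (+-comm x 1#) (-‿+-comm 1# y) ⟩
      (1# + x) ∸ (1# + y)             ≈⟨ +-cong (sym (1+× m 1#)) (-‿cong (sym (1+× n 1#))) ⟩
      suc m ×# 1# ∸ suc n ×# 1#       ∎
      where x = m ×# 1#
            y = n ×# 1#

    +-homo : ∀ i j → ⟦ i ℤ.+ j ⟧ᶻ ≈ ⟦ i ⟧ᶻ + ⟦ j ⟧ᶻ
    +-homo (ℤ.+ m)    (ℤ.+ n)    = ×-homo-+ 1# m n
    +-homo (ℤ.+ m)    ℤ.-[1+ n ] = ⊖-homo m (suc n)
    +-homo ℤ.-[1+ m ] (ℤ.+ n)    = trans (⊖-homo n (suc m)) (+-comm _ _)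
    +-homo ℤ.-[1+ m ] ℤ.-[1+ n ] = begin
      - (suc (suc (m ℕ.+ n)) ×# 1#)      ≡⟨ ≡.cong (λ l → - (suc l ×# 1#)) (≡.sym (ℕP.+-suc m n)) ⟩
      - ((suc m ℕ.+ suc n) ×# 1#)        ≈⟨ -‿cong (×-homo-+ 1# (suc m) (suc n)) ⟩
      - (suc m ×# 1# + suc n ×# 1#)      ≈⟨ sym (-‿+-comm _ _) ⟩
      - (suc m ×# 1#) ∸ suc n ×# 1#      ∎

    *-homo⁺ : ∀ m j → ⟦ ℤ.+ m ℤ.* j ⟧ᶻ ≈ m ×# 1# * ⟦ j ⟧ᶻ
    *-homo⁺ m (ℤ.+ n) = begin
      ⟦ ℤ.+ m ℤ.* ℤ.+ n ⟧ᶻ ≡⟨ ≡.cong ⟦_⟧ᶻ (≡.sym (ℤP.pos-* m n)) ⟩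
      (m ℕ.* n) ×# 1#      ≈⟨ ×1-homo-* m n ⟩
      m ×# 1# * n ×# 1#    ∎
    *-homo⁺ m ℤ.-[1+ n ] = begin
      ⟦ ℤ.+ m ℤ.* (ℤ.- (ℤ.+ suc n)) ⟧ᶻ  ≡⟨ ≡.cong ⟦_⟧ᶻ (≡.sym (ℤP.neg-distribʳ-* (ℤ.+ m) (ℤ.+ suc n))) ⟩
      ⟦ ℤ.- (ℤ.+ m ℤ.* ℤ.+ suc n) ⟧ᶻ    ≈⟨ neg-homo (ℤ.+ m ℤ.* ℤ.+ suc n) ⟩
      - ⟦ ℤ.+ m ℤ.* ℤ.+ suc n ⟧ᶻ        ≈⟨ -‿cong (*-homo⁺ m (ℤ.+ suc n)) ⟩
      - (m ×# 1# * suc n ×# 1#)         ≈⟨ -‿distribʳ-* _ _ ⟩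
      m ×# 1# * - (suc n ×# 1#)         ∎

    *-homo : ∀ i j → ⟦ i ℤ.* j ⟧ᶻ ≈ ⟦ i ⟧ᶻ * ⟦ j ⟧ᶻ
    *-homo (ℤ.+ m)    j = *-homo⁺ m j
    *-homo ℤ.-[1+ m ] j = begin
      ⟦ (ℤ.- (ℤ.+ suc m)) ℤ.* j ⟧ᶻ  ≡⟨ ≡.cong ⟦_⟧ᶻ (≡.sym (ℤP.neg-distribˡ-* (ℤ.+ suc m) j)) ⟩
      ⟦ ℤ.- (ℤ.+ suc m ℤ.* j) ⟧ᶻ    ≈⟨ neg-homo (ℤ.+ suc m ℤ.* j) ⟩
      - ⟦ ℤ.+ suc m ℤ.* j ⟧ᶻ        ≈⟨ -‿cong (*-homo⁺ (suc m) j) ⟩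
      - (suc m ×# 1# * ⟦ j ⟧ᶻ)      ≈⟨ -‿distribˡ-* _ _ ⟩
      - (suc m ×# 1#) * ⟦ j ⟧ᶻ      ∎

  ℤ-rawRing : RawRing _ _
  ℤ-rawRing = record
    { Carrier = ℤ ; _≈_ = _≡_ ; _+_ = ℤ._+_ ; _*_ = ℤ._*_ ; -_ = ℤ.-_ ; 0# = 0ℤ ; 1# = 1ℤ }

  morphism : ℤ-rawRing -Raw-AlmostCommutative⟶ fromCommutativeRing commutativeRing
  morphism = record
    { ⟦_⟧ = ⟦_⟧ᶻ ; +-homo = +-homo ; *-homo = *-homo ; -‿homo = neg-homo
    ; 0-homo = OrderedField.refl K ; 1-homo = OrderedField.refl K }

  equal? : ∀ i j → Maybe (⟦ i ⟧ᶻ ≈ ⟦ j ⟧ᶻ)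
  equal? i j = Maybe.map (λ e → reflexive (≡.cong ⟦_⟧ᶻ e)) (dec⇒weaklyDec ℤ._≟_ i j)

  open Algebra.Solver.Ring ℤ-rawRing (fromCommutativeRing commutativeRing) morphism equal? public
    using (solve; _:=_; _:+_; _:*_; _:-_; :-_; con)

module ParitySolver = Algebra.Solver.Ring.Simple (fromCommutativeRing ℙP.+-*-commutativeRing) ℙP._≟_
open ParitySolver using () renaming (solve to solveℙ; _:+_ to _⊞_; _:=_ to _⊜_)

telescope : ∀ x y z → (x ℙ.+ y) ℙ.+ (y ℙ.+ z) ≡ x ℙ.+ z
telescope = solveℙ 3 (λ x y z → (x ⊞ y) ⊞ (y ⊞ z) ⊜ x ⊞ z) refl

interchange : ∀ x y z t → (x ℙ.+ y) ℙ.+ (z ℙ.+ t) ≡ (x ℙ.+ z) ℙ.+ (y ℙ.+ t)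
interchange = solveℙ 4 (λ x y z t → (x ⊞ y) ⊞ (z ⊞ t) ⊜ (x ⊞ z) ⊞ (y ⊞ t)) refl

-- Order arithmetic in an ordered field.

module FieldOrder {c ℓ₁ ℓ₂ : Level} (K : OrderedField c ℓ₁ ℓ₂) where
  open OrderedField K hiding (zero; refl) renaming (_-_ to _∸_)
  open IntegerSolver K

  ref : ∀ {x} → x ≈ x
  ref = OrderedField.refl K

  -0≈0 : - 0# ≈ 0#
  -0≈0 = solve 0 (:- con 0ℤ := con 0ℤ) ref

  <-resp : ∀ {x y x′ y′} → x ≈ x′ → y ≈ y′ → x < y → x′ < y′
  <-resp p q = Order.<-respʳ-≈ q ∘ Order.<-respˡ-≈ p

  ≤-resp : ∀ {x y x′ y′} → x ≈ x′ → y ≈ y′ → x ≤ y → x′ ≤ y′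
  ≤-resp p q (inj₁ x<y) = inj₁ (<-resp p q x<y)
  ≤-resp p q (inj₂ x≈y) = inj₂ (trans (sym p) (trans x≈y q))

  +-pos : ∀ {x y} → 0# < x → 0# < y → 0# < x + y
  +-pos {x} {y} 0<x 0<y = Order.trans 0<y (<-resp (+-identityˡ y) ref (+-monoˡ-< y 0<x))

  +-pos-nonneg : ∀ {x y} → 0# < x → 0# ≤ y → 0# < x + y
  +-pos-nonneg 0<x (inj₁ 0<y) = +-pos 0<x 0<y
  +-pos-nonneg {x} 0<x (inj₂ 0≈y) = <-resp ref (trans (sym (+-identityʳ x)) (+-congˡ 0≈y)) 0<x

  +-nonneg : ∀ {x y} → 0# ≤ x → 0# ≤ y → 0# ≤ x + y
  +-nonneg (inj₁ 0<x) 0≤y = inj₁ (+-pos-nonneg 0<x 0≤y)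
  +-nonneg {x} {y} (inj₂ 0≈x) 0≤y = ≤-resp ref (trans (sym (+-identityˡ y)) (+-congʳ 0≈x)) 0≤y

  *-nonneg : ∀ {x y} → 0# ≤ x → 0# ≤ y → 0# ≤ x * y
  *-nonneg (inj₁ 0<x) (inj₁ 0<y) = inj₁ (*-pos 0<x 0<y)
  *-nonneg {x} {y} (inj₁ 0<x) (inj₂ 0≈y) = inj₂ (trans (sym (zeroʳ x)) (*-congˡ 0≈y))
  *-nonneg {x} {y} (inj₂ 0≈x) _ = inj₂ (trans (sym (zeroˡ y)) (*-congʳ 0≈x))

  <⇒0<∸ : ∀ {x y} → x < y → 0# < y ∸ x
  <⇒0<∸ {x} {y} x<y = <-resp (-‿inverseʳ x) ref (+-monoˡ-< (- x) x<y)

  0<∸⇒< : ∀ {x y} → 0# < y ∸ x → x < y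
  0<∸⇒< {x} {y} h = <-resp (+-identityˡ x) (solve 2 (λ x y → y :- x :+ x := y) ref x y) (+-monoˡ-< x h)

  ≤⇒0≤∸ : ∀ {x y} → x ≤ y → 0# ≤ y ∸ x
  ≤⇒0≤∸ (inj₁ x<y) = inj₁ (<⇒0<∸ x<y)
  ≤⇒0≤∸ {x} (inj₂ x≈y) = inj₂ (trans (sym (-‿inverseʳ x)) (+-congʳ x≈y))

  0≤∸⇒≤ : ∀ {x y} → 0# ≤ y ∸ x → x ≤ y
  0≤∸⇒≤ (inj₁ h) = inj₁ (0<∸⇒< h)
  0≤∸⇒≤ {x} {y} (inj₂ h) = inj₂ (trans (sym (+-identityˡ x)) (trans (+-congʳ h) (solve 2 (λ x y → y :- x :+ x := y) ref x y)))

  neg⇒0<- : ∀ {x} → x < 0# → 0# < - x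
  neg⇒0<- {x} h = <-resp ref (+-identityˡ (- x)) (<⇒0<∸ h)

  0<-⇒neg : ∀ {x} → 0# < - x → x < 0#
  0<-⇒neg {x} h = 0<∸⇒< (<-resp ref (sym (+-identityˡ (- x))) h)

  pos⇒-neg : ∀ {x} → 0# < x → - x < 0#
  pos⇒-neg {x} h = 0<-⇒neg (<-resp ref (solve 1 (λ x → x := :- (:- x)) ref x) h)

  *-cancel-pos : ∀ {a x} → 0# < a → 0# < a * x → 0# < x
  *-cancel-pos {a} {x} 0<a 0<ax with compare 0# x
  ... | tri< 0<x _ _ = 0<x
  ... | tri≈ _ 0≈x _ = contradiction 0<ax (Order.irrefl (sym (trans (*-congˡ (sym 0≈x)) (zeroʳ a))))
  ... | tri> _ _ x<0 = contradiction (+-pos 0<ax (*-pos 0<a (neg⇒0<- x<0)))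
    (Order.irrefl (solve 2 (λ a x → con 0ℤ := a :* x :+ a :* (:- x)) ref a x))

  <⇒≉0 : ∀ {x} → 0# < x → ¬ x ≈ 0#
  <⇒≉0 0<x x≈0 = Order.irrefl (sym x≈0) 0<x

  nonneg-sum≈0 : ∀ {x y} → 0# ≤ x → 0# ≤ y → x + y ≈ 0# → x ≈ 0#
  nonneg-sum≈0 (inj₁ 0<x) 0≤y e = contradiction e (<⇒≉0 (+-pos-nonneg 0<x 0≤y))
  nonneg-sum≈0 (inj₂ 0≈x) 0≤y e = sym 0≈x

  *-zero-cancel : ∀ {a x} → ¬ a ≈ 0# → a * x ≈ 0# → x ≈ 0#
  *-zero-cancel {a} {x} a≉0 e = let (a⁻¹ , inv) = invertible a≉0 in
    trans (sym (*-identityˡ x)) (trans (*-congʳ (sym inv))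
      (trans (solve 3 (λ a b x → a :* b :* x := b :* (a :* x)) ref a a⁻¹ x) (trans (*-congˡ e) (zeroʳ a⁻¹))))

  *-cancelˡ-≉0 : ∀ {a x y} → ¬ a ≈ 0# → a * x ≈ a * y → x ≈ y
  *-cancelˡ-≉0 {a} {x} {y} a≉0 e = trans (solve 2 (λ x y → x := (x :- y) :+ y) ref x y)
    (trans (+-congʳ (*-zero-cancel a≉0 (trans (solve 3 (λ a x y → a :* (x :- y) := a :* x :- a :* y) ref a x y)
      (trans (+-congʳ e) (-‿inverseʳ _))))) (+-identityˡ y))

  inverse-pos : ∀ {x y} → 0# < x → x * y ≈ 1# → 0# < y
  inverse-pos 0<x e = *-cancel-pos 0<x (<-resp ref (sym e) 0<1)

  ≰⇒> : ∀ {x} → ¬ 0# < x → x ≤ 0#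
  ≰⇒> {x} h with compare 0# x
  ... | tri< 0<x _ _ = contradiction 0<x h
  ... | tri≈ _ 0≈x _ = inj₂ (sym 0≈x)
  ... | tri> _ _ x<0 = inj₁ x<0

  ≤0⇒0≤- : ∀ {x} → x ≤ 0# → 0# ≤ - x
  ≤0⇒0≤- {x} h = ≤-resp ref (+-identityˡ (- x)) (≤⇒0≤∸ h)

-- Turns of plane vectors through the vertical, modulo 2.

module PlaneGeometry {c ℓ₁ ℓ₂ : Level} (K : OrderedField c ℓ₁ ℓ₂) where
  open OrderedField K hiding (zero; refl) renaming (_-_ to _∸_)
  open Plabic K
  open IntegerSolver K
  open FieldOrder K

  infix 8 -ₚ_
  -ₚ_ : Point → Point
  -ₚ (x , y) = - x , - y

  0ₚ : Point
  0ₚ = 0# , 0#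

  -- The half-open half-plane to the right of the upward vertical: breaking
  -- the tie on the vertical itself amounts to rotating it slightly to the left.
  Right : Point → Set (ℓ₁ ⊔ˡ ℓ₂)
  Right (x , y) = 0# < x ⊎ (x ≈ 0# × 0# < y)

  -- `0ℙ` is the half-plane `Right`; everything else, the zero vector included, gets `1ℙ`. Hence
  -- statements about the left half ask for a nonzero vector.
  side : Point → Parity
  side (x , y) with compare 0# x | compare 0# y
  ... | tri< _ _ _ | _          = 0ℙ
  ... | tri≈ _ _ _ | tri< _ _ _ = 0ℙ
  ... | tri≈ _ _ _ | _          = 1ℙ
  ... | tri> _ _ _ | _          = 1ℙ

  side-0 : ∀ {u} → side u ≡ 0ℙ → Right u
  side-0 {x , y} s with compare 0# x | compare 0# y
  ... | tri< 0<x _ _ | _            = inj₁ 0<x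
  ... | tri≈ _ 0≈x _ | tri< 0<y _ _ = inj₂ (sym 0≈x , 0<y)

  side-1 : ∀ {u} → ¬ u ≈ₚ 0ₚ → side u ≡ 1ℙ → Right (-ₚ u)
  side-1 {x , y} u≉0 s with compare 0# x | compare 0# y
  ... | tri≈ _ 0≈x _ | tri≈ _ 0≈y _ = contradiction (sym 0≈x , sym 0≈y) u≉0
  ... | tri≈ _ 0≈x _ | tri> _ _ y<0 = inj₂ (trans (-‿cong (sym 0≈x)) -0≈0 , neg⇒0<- y<0)
  ... | tri> _ _ x<0 | _            = inj₁ (neg⇒0<- x<0)

  Right⇒0 : ∀ {u} → Right u → side u ≡ 0ℙ
  Right⇒0 {x , y} r with compare 0# x | compare 0# y
  ... | tri< _ _ _     | _             = refl
  ... | tri≈ _ _ _     | tri< _ _ _    = refl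
  ... | tri≈ 0≮x _ _   | tri≈ 0≮y _ _  = ⊥-elim ([ 0≮x , 0≮y ∘ proj₂ ]′ r)
  ... | tri≈ 0≮x _ _   | tri> 0≮y _ _  = ⊥-elim ([ 0≮x , 0≮y ∘ proj₂ ]′ r)
  ... | tri> 0≮x 0≉x _ | _             = ⊥-elim ([ 0≮x , 0≉x ∘ sym ∘ proj₁ ]′ r)

  Right-resp : ∀ {u v} → u ≈ₚ v → Right u → Right v
  Right-resp (p , q) (inj₁ h) = inj₁ (<-resp ref p h)
  Right-resp (p , q) (inj₂ (e , h)) = inj₂ (trans (sym p) e , <-resp ref q h)

  Right-+ : ∀ {u v} → Right u → Right v → Right (u +ₚ v)
  Right-+ (inj₁ h) (inj₁ k) = inj₁ (+-pos h k)
  Right-+ (inj₁ h) (inj₂ (e , _)) = inj₁ (+-pos-nonneg h (inj₂ (sym e)))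
  Right-+ (inj₂ (e , _)) (inj₁ k) = inj₁ (<-resp ref (+-comm _ _) (+-pos-nonneg k (inj₂ (sym e))))
  Right-+ (inj₂ (e , h)) (inj₂ (f , k)) = inj₂ (trans (+-cong e f) (+-identityˡ 0#) , +-pos h k)

  Right-· : ∀ {a u} → 0# < a → Right u → Right (a · u)
  Right-· 0<a (inj₁ h) = inj₁ (*-pos 0<a h)
  Right-· {a} 0<a (inj₂ (e , h)) = inj₂ (trans (*-congˡ e) (zeroʳ a) , *-pos 0<a h)

  Right-≉0 : ∀ {u} → Right u → ¬ u ≈ₚ 0ₚ
  Right-≉0 (inj₁ h) (e , _) = <⇒≉0 h e
  Right-≉0 (inj₂ (_ , h)) (_ , e) = <⇒≉0 h e

  Right∌- : ∀ {u} → Right u → Right (-ₚ u) → ⊥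
  Right∌- r s = Right-≉0 (Right-+ r s) (-‿inverseʳ _ , -‿inverseʳ _)

  Right-⇒1 : ∀ {u} → Right (-ₚ u) → side u ≡ 1ℙ
  Right-⇒1 {u} r with side u in s
  ... | 0ℙ = ⊥-elim (Right∌- (side-0 {u} s) r)
  ... | 1ℙ = refl

  -ₚ-involutive : ∀ u → -ₚ (-ₚ u) ≈ₚ u
  -ₚ-involutive (x , y) = solve 1 (λ x → :- (:- x) := x) ref x , solve 1 (λ x → :- (:- x) := x) ref y

  side-neg : ∀ {u v} → ¬ u ≈ₚ 0ₚ → v ≈ₚ -ₚ u → side v ≡ side u ⁻¹
  side-neg {u} {v} u≉0 (p , q) with side u in s
  ... | 0ℙ = Right-⇒1 (Right-resp (trans (sym (proj₁ (-ₚ-involutive u))) (-‿cong (sym p)) ,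
                                   trans (sym (proj₂ (-ₚ-involutive u))) (-‿cong (sym q))) (side-0 {u} s))
  ... | 1ℙ = Right⇒0 (Right-resp (sym p , sym q) (side-1 u≉0 s))

  positive : Carrier → Parity
  positive x = if does (0# <? x) then 1ℙ else 0ℙ

  positive-1 : ∀ {x} → 0# < x → positive x ≡ 1ℙ
  positive-1 {x} h with 0# <? x
  ... | yes _ = refl
  ... | no n  = contradiction h n

  positive-0 : ∀ {x} → x ≤ 0# → positive x ≡ 0ℙ
  positive-0 {x} h with 0# <? x
  ... | no _  = refl
  ... | yes p = ⊥-elim ([ (λ x<0 → Order.asym p x<0) , (λ x≈0 → <⇒≉0 p x≈0) ]′ h)

  -- turn u v is 1ℙ when the short way from the direction u to the direction v
  -- passes through the upward vertical.
  turn : Point → Point → Parity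
  turn u v with side u | side v
  ... | 0ℙ | 0ℙ = 0ℙ
  ... | 1ℙ | 1ℙ = 0ℙ
  ... | 0ℙ | 1ℙ = positive (cross u v)
  ... | 1ℙ | 0ℙ = positive (cross v u)

  cross-cong : ∀ {u v u′ v′} → u ≈ₚ u′ → v ≈ₚ v′ → cross u v ≈ cross u′ v′
  cross-cong (p , q) (p′ , q′) = +-cong (*-cong p q′) (-‿cong (*-cong q p′))

  turn-comm : ∀ u v → turn u v ≡ turn v u
  turn-comm u v with side u | side v
  ... | 0ℙ | 0ℙ = refl
  ... | 1ℙ | 1ℙ = refl
  ... | 0ℙ | 1ℙ = refl
  ... | 1ℙ | 0ℙ = refl

  cross-flip : ∀ u v → - cross u v ≈ cross v u
  cross-flip (u₁ , u₂) (v₁ , v₂) =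
    solve 4 (λ u₁ u₂ v₁ v₂ → :- (u₁ :* v₂ :- u₂ :* v₁) := v₁ :* u₂ :- v₂ :* u₁) ref u₁ u₂ v₁ v₂

  -- The origin lies outside the convex hull of the three vectors. Weights of arbitrary positive sum
  -- spare a division each time the condition is checked.
  Avoids₀ : Point → Point → Point → Set _
  Avoids₀ u v w = ∀ a b d → 0# ≤ a → 0# ≤ b → 0# ≤ d → 0# < a + (b + d) →
                  ¬ a · u +ₚ (b · v +ₚ d · w) ≈ₚ 0ₚ

  private
    module _ {u v w : Point} where
      swap₁₂ : Avoids₀ u v w → Avoids₀ v u w
      swap₁₂ h a b d 0≤a 0≤b 0≤d 0<s (p , q) = h b a d 0≤b 0≤a 0≤d (<-resp ref (exch a b d) 0<s)
        (trans (sym (exch _ _ _)) p , trans (sym (exch _ _ _)) q)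
        where
        exch : ∀ x y z → x + (y + z) ≈ y + (x + z)
        exch = solve 3 (λ x y z → x :+ (y :+ z) := y :+ (x :+ z)) ref

      swap₂₃ : Avoids₀ u v w → Avoids₀ u w v
      swap₂₃ h a b d 0≤a 0≤b 0≤d 0<s (p , q) = h a d b 0≤a 0≤d 0≤b (<-resp ref (exch a b d) 0<s)
        (trans (sym (exch _ _ _)) p , trans (sym (exch _ _ _)) q)
        where
        exch : ∀ x y z → x + (y + z) ≈ x + (z + y)
        exch = solve 3 (λ x y z → x :+ (y :+ z) := x :+ (z :+ y)) ref

      -- The linear dependence of three plane vectors, with coefficients from Cramer's rule.
      -- Non-negative cross products, not all zero, exhibit the origin in the hull.
      cyclic-relation : cross v w · u +ₚ (cross w u · v +ₚ cross u v · w) ≈ₚ 0ₚ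
      cyclic-relation =
        solve 6 (λ u₁ u₂ v₁ v₂ w₁ w₂ →
          (v₁ :* w₂ :- v₂ :* w₁) :* u₁ :+ ((w₁ :* u₂ :- w₂ :* u₁) :* v₁ :+ (u₁ :* v₂ :- u₂ :* v₁) :* w₁) := con 0ℤ)
          ref (proj₁ u) (proj₂ u) (proj₁ v) (proj₂ v) (proj₁ w) (proj₂ w) ,
        solve 6 (λ u₁ u₂ v₁ v₂ w₁ w₂ →
          (v₁ :* w₂ :- v₂ :* w₁) :* u₂ :+ ((w₁ :* u₂ :- w₂ :* u₁) :* v₂ :+ (u₁ :* v₂ :- u₂ :* v₁) :* w₂) := con 0ℤ)
          ref (proj₁ u) (proj₂ u) (proj₁ v) (proj₂ v) (proj₁ w) (proj₂ w)

    flip-nonneg : ∀ u v → cross u v ≤ 0# → 0# ≤ cross v u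
    flip-nonneg u v h = ≤-resp ref (cross-flip u v) (≤0⇒0≤- h)

    -- A consequence of `u`, `v` and `-w` lying in one of the two half-open half-planes, phrased so
    -- that `not-between` serves both halves.
    Pointed : Point → Point → Point → Set _
    Pointed u v w = ∀ a b d → 0# ≤ a → 0# ≤ b → 0# < d → ¬ a · u +ₚ (b · v +ₚ d · (-ₚ w)) ≈ₚ 0ₚ

    Right-pointed : ∀ {u v w} → Right u → Right v → Right (-ₚ w) → Pointed u v w
    Right-pointed {u} {v} {w} ru rv rw a b d 0≤a 0≤b 0<d = Right-≉0 (add 0≤a ru (add 0≤b rv (Right-· 0<d rw)))
      where
      add : ∀ {a u x} → 0# ≤ a → Right u → Right x → Right (a · u +ₚ x)
      add (inj₁ 0<a) ru rx = Right-+ (Right-· 0<a ru) rx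
      add {a} {u} {x} (inj₂ 0≈a) ru rx = Right-resp (drop (proj₁ u) (proj₁ x) , drop (proj₂ u) (proj₂ x)) rx
        where
        drop : ∀ y z → z ≈ a * y + z
        drop y z = trans (sym (+-identityˡ z)) (+-congʳ (trans (sym (zeroˡ y)) (*-congʳ 0≈a)))

    Left-pointed : ∀ {u v w} → Right (-ₚ u) → Right (-ₚ v) → Right w → Pointed u v w
    Left-pointed {u} {v} {w} ru rv rw a b d 0≤a 0≤b 0<d (p , q) =
      Right-pointed {w = -ₚ w} ru rv (Right-resp (sym (proj₁ (-ₚ-involutive w)) , sym (proj₂ (-ₚ-involutive w))) rw)
        a b d 0≤a 0≤b 0<d (neg p , neg q)
      where
      neg : ∀ {x y z} → a * x + (b * y + d * (- z)) ≈ 0# → a * (- x) + (b * (- y) + d * (- - z)) ≈ 0#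
      neg {x} {y} {z} e = trans
        (solve 6 (λ a b d x y z → a :* (:- x) :+ (b :* (:- y) :+ d :* (:- (:- z))) := :- (a :* x :+ (b :* y :+ d :* (:- z)))) ref a b d x y z)
        (trans (-‿cong e) -0≈0)

    -- The cyclic relation is an excluded combination whatever the sign of `cross u v`: a negative
    -- one moves to `-w` and contradicts `Pointed`, any other puts the origin in the hull.
    not-between : ∀ {u v w} → Pointed u v w → Avoids₀ u v w →
                  0# ≤ cross v w → 0# ≤ cross w u → 0# < cross v w ⊎ 0# < cross w u → ⊥
    not-between {u} {v} {w} pointed hull 0≤A 0≤B 0<A⊎B with compare 0# (cross u v)
    ... | tri> _ _ D<0 = pointed _ _ (- cross u v) 0≤A 0≤B (neg⇒0<- D<0)
      ( trans (+-congˡ (+-congˡ (neg*neg _ _))) (proj₁ (cyclic-relation {u} {v} {w}))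
      , trans (+-congˡ (+-congˡ (neg*neg _ _))) (proj₂ (cyclic-relation {u} {v} {w})))
      where
      neg*neg : ∀ x y → - x * - y ≈ x * y
      neg*neg = solve 2 (λ x y → (:- x) :* (:- y) := x :* y) ref
    ... | tri< 0<D _ _ = hull _ _ _ 0≤A 0≤B (inj₁ 0<D)
      (<-resp ref (solve 3 (λ x y z → z :+ (x :+ y) := x :+ (y :+ z)) ref _ _ _) (+-pos-nonneg 0<D (+-nonneg 0≤A 0≤B)))
      (cyclic-relation {u} {v} {w})
    ... | tri≈ _ 0≈D _ = hull _ _ _ 0≤A 0≤B (inj₂ 0≈D) (sum-pos 0<A⊎B) (cyclic-relation {u} {v} {w})
      where
      sum-pos : 0# < cross v w ⊎ 0# < cross w u → 0# < cross v w + (cross w u + cross u v)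
      sum-pos (inj₁ h) = +-pos-nonneg h (+-nonneg 0≤B (inj₂ 0≈D))
      sum-pos (inj₂ h) = <-resp ref (solve 3 (λ x y z → y :+ (x :+ z) := x :+ (y :+ z)) ref _ _ _)
        (+-pos-nonneg h (+-nonneg 0≤A (inj₂ 0≈D)))

    positive-cases : ∀ x → (0# < x × positive x ≡ 1ℙ) ⊎ (x ≤ 0# × positive x ≡ 0ℙ)
    positive-cases x with 0# <? x
    ... | yes p = inj₁ (p , refl)
    ... | no n  = inj₂ (≰⇒> n , refl)

    vertex₁ : ∀ {u v w} → Avoids₀ u v w → ¬ u ≈ₚ 0ₚ
    vertex₁ {u} {v} {w} hull (p , q) = hull 1# 0# 0# (inj₁ 0<1) (inj₂ ref) (inj₂ ref)
      (<-resp ref (solve 0 (con 1ℤ := con 1ℤ :+ (con 0ℤ :+ con 0ℤ)) ref) 0<1)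
      (trans (one (proj₁ u) (proj₁ v) (proj₁ w)) p , trans (one (proj₂ u) (proj₂ v) (proj₂ w)) q)
      where
      one : ∀ x y z → 1# * x + (0# * y + 0# * z) ≈ x
      one = solve 3 (λ x y z → con 1ℤ :* x :+ (con 0ℤ :* y :+ con 0ℤ :* z) := x) ref

    module _ {u v w : Point} (hull : Avoids₀ u v w) where
      vertex₂ : ¬ v ≈ₚ 0ₚ
      vertex₂ = vertex₁ (swap₁₂ hull)
      vertex₃ : ¬ w ≈ₚ 0ₚ
      vertex₃ = vertex₁ (swap₁₂ (swap₂₃ hull))

    -- If the two turns differed, `-w` would lie in the sector between `u` and `v`, and the hull of
    -- the three vectors would contain the origin. The two mirror cases are `u`, `v` on the right
    -- and on the left.
    same-turn : ∀ {u v w} → Avoids₀ u v w → side u ≡ side v → side w ≡ side u ⁻¹ → turn u w ≡ turn v w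
    same-turn {u} {v} {w} hull e f with side u in su | side v in sv | side w in sw
    same-turn {u} {v} {w} hull refl refl | 0ℙ | 0ℙ | 1ℙ
      with positive-cases (cross u w) | positive-cases (cross v w)
         | Right-pointed {u} {v} {w} (side-0 {u} su) (side-0 {v} sv) (side-1 {w} (vertex₃ hull) sw)
         | Right-pointed {v} {u} {w} (side-0 {v} sv) (side-0 {u} su) (side-1 {w} (vertex₃ hull) sw)
    ... | inj₁ (_ , p) | inj₁ (_ , q) | _ | _ = ≡.trans p (≡.sym q)
    ... | inj₂ (_ , p) | inj₂ (_ , q) | _ | _ = ≡.trans p (≡.sym q)
    ... | inj₁ (h , _) | inj₂ (k , _) | _ | c = ⊥-elim (not-between c (swap₁₂ hull) (inj₁ h) (flip-nonneg v w k) (inj₁ h))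
    ... | inj₂ (h , _) | inj₁ (k , _) | c | _ = ⊥-elim (not-between c hull (inj₁ k) (flip-nonneg u w h) (inj₁ k))
    same-turn {u} {v} {w} hull refl refl | 1ℙ | 1ℙ | 0ℙ
      with positive-cases (cross w u) | positive-cases (cross w v)
         | Left-pointed {u} {v} {w} (side-1 {u} (vertex₁ hull) su) (side-1 {v} (vertex₂ hull) sv) (side-0 {w} sw)
         | Left-pointed {v} {u} {w} (side-1 {v} (vertex₂ hull) sv) (side-1 {u} (vertex₁ hull) su) (side-0 {w} sw)
    ... | inj₁ (_ , p) | inj₁ (_ , q) | _ | _ = ≡.trans p (≡.sym q)
    ... | inj₂ (_ , p) | inj₂ (_ , q) | _ | _ = ≡.trans p (≡.sym q)
    ... | inj₁ (h , _) | inj₂ (k , _) | c | _ = ⊥-elim (not-between c hull (flip-nonneg w v k) (inj₁ h) (inj₂ h))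
    ... | inj₂ (h , _) | inj₁ (k , _) | _ | c = ⊥-elim (not-between c (swap₁₂ hull) (flip-nonneg w u h) (inj₁ k) (inj₂ k))

    same-side : ∀ {u v} → side u ≡ side v → turn u v ≡ 0ℙ
    same-side {u} {v} e with side u | side v
    same-side refl | 0ℙ | 0ℙ = refl
    same-side refl | 1ℙ | 1ℙ = refl

    p+p≡0 : ∀ p → p ℙ.+ p ≡ 0ℙ
    p+p≡0 0ℙ = refl
    p+p≡0 1ℙ = refl

    ≢⇒⁻¹ : ∀ {p q} → p ≢ q → q ≡ p ⁻¹
    ≢⇒⁻¹ {0ℙ} {0ℙ} h = contradiction refl h
    ≢⇒⁻¹ {0ℙ} {1ℙ} h = refl
    ≢⇒⁻¹ {1ℙ} {0ℙ} h = refl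
    ≢⇒⁻¹ {1ℙ} {1ℙ} h = contradiction refl h

  -- Among three vectors two share a side. If the third shares it too, no turn is counted; otherwise
  -- the two turns involving the third are equal by `same-turn`, and the turn between the other two
  -- is zero.
  turn-compose : ∀ {u v w} → Avoids₀ u v w → turn u v ℙ.+ turn v w ≡ turn u w
  turn-compose {u} {v} {w} hull with side u ℙP.≟ side v | side v ℙP.≟ side w
  ... | yes p | yes q = ≡.trans (≡.cong₂ ℙ._+_ (same-side {u} {v} p) (same-side {v} {w} q))
    (≡.sym (same-side {u} {w} (≡.trans p q)))
  ... | yes p | no ¬q = ≡.trans (≡.cong (ℙ._+ turn v w) (same-side {u} {v} p))
    (≡.sym (same-turn hull p (≡.trans (≢⇒⁻¹ ¬q) (≡.cong _⁻¹ (≡.sym p)))))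
  ... | no ¬p | yes q = ≡.trans (≡.cong (turn u v ℙ.+_) (same-side {v} {w} q))
    (≡.trans (ℙP.+-identityʳ _) (≡.trans (turn-comm u v) (≡.trans
      (same-turn (swap₂₃ (swap₁₂ hull)) q (≢⇒⁻¹ (¬p ∘ ≡.sym))) (turn-comm w u))))
  ... | no ¬p | no ¬q = ≡.trans (≡.cong (ℙ._+ turn v w) (≡.trans (same-turn (swap₂₃ hull) u~w (≢⇒⁻¹ ¬p)) (turn-comm w v)))
    (≡.trans (p+p≡0 (turn v w)) (≡.sym (same-side {u} {w} u~w)))
    where
    u~w : side u ≡ side w
    u~w = ≡.trans (≡.trans (≡.sym (ℙP.⁻¹-involutive _)) (≡.cong _⁻¹ (≡.sym (≢⇒⁻¹ ¬p)))) (≡.sym (≢⇒⁻¹ ¬q))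

  upward : Point
  upward = 0# , 1#

  private
    cross-upward : ∀ u → cross u upward ≈ proj₁ u
    cross-upward (x , y) = solve 2 (λ x y → x :* con 1ℤ :- y :* con 0ℤ := x) ref x y

    side-upward : side upward ≡ 0ℙ
    side-upward = Right⇒0 {upward} (inj₂ (ref , 0<1))

    Right⇒0≤x : ∀ {u} → Right u → 0# ≤ proj₁ u
    Right⇒0≤x (inj₁ h) = inj₁ h
    Right⇒0≤x (inj₂ (e , _)) = inj₂ (sym e)

  -- Inserting the vertical splits the turn in two, and a turn to the vertical is just the side bit
  -- of the other vector.
  turn-through-upward : ∀ {u v} → Avoids₀ u upward v → turn u v ≡ side u ℙ.+ side v
  turn-through-upward {u} {v} hull = ≡.trans (≡.sym (turn-compose hull))
    (≡.cong₂ ℙ._+_ (to-upward hull) (≡.trans (turn-comm upward v) (to-upward (swap₁₂ (swap₂₃ (swap₁₂ hull))))))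
    where
    to-upward : ∀ {u v} → Avoids₀ u upward v → turn u upward ≡ side u
    to-upward {u} {v} h with side u in su | side upward | side-upward
    ... | 0ℙ | _ | refl = refl
    ... | 1ℙ | _ | refl = positive-1 (0<cross (side-1 {u} (vertex₁ h) su))
      where
      0<cross : Right (-ₚ u) → 0# < cross upward u
      0<cross (inj₁ k) = <-resp ref (trans (-‿cong (sym (cross-upward u))) (cross-flip u upward)) k
      -- A vector straight down is opposite to `upward`: with weights `1#` and `- proj₂ u` the two
      -- already cancel, which the hull condition forbids.
      0<cross (inj₂ (e , k)) = ⊥-elim (h 1# (- proj₂ u) 0# (inj₁ 0<1) (inj₁ k) (inj₂ ref)
        (+-pos-nonneg 0<1 (+-nonneg (inj₁ k) (inj₂ ref)))
        ( trans (solve 3 (λ x y z → con 1ℤ :* x :+ ((:- y) :* con 0ℤ :+ con 0ℤ :* z) := :- (:- x)) ref (proj₁ u) (proj₂ u) (proj₁ v))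
                (trans (-‿cong e) -0≈0)
        , solve 2 (λ y z → con 1ℤ :* y :+ ((:- y) :* con 1ℤ :+ con 0ℤ :* z) := con 0ℤ) ref (proj₂ u) (proj₂ v)))

  -- Only passages through the upward vertical are counted, and a turn to the downward one makes
  -- none from any starting vector.
  turn-through-downward : ∀ {u v} → Avoids₀ u (-ₚ upward) v → turn u v ≡ 0ℙ
  turn-through-downward {u} {v} hull = ≡.trans (≡.sym (turn-compose hull))
    (≡.cong₂ ℙ._+_ (to-downward u) (≡.trans (turn-comm (-ₚ upward) v) (to-downward v)))
    where
    side-downward : side (-ₚ upward) ≡ 1ℙ
    side-downward = side-neg {upward} {(-ₚ upward)} (vertex₁ (swap₁₂ hull′)) (ref , ref) ∙ ≡.cong _⁻¹ side-upward
      where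
      _∙_ = ≡.trans
      hull′ : Avoids₀ upward upward upward
      hull′ a b d _ _ _ 0<s (_ , e) = <⇒≉0 0<s (trans
        (solve 3 (λ a b d → a :+ (b :+ d) := a :* con 1ℤ :+ (b :* con 1ℤ :+ d :* con 1ℤ)) ref a b d) e)
    to-downward : ∀ u → turn u (-ₚ upward) ≡ 0ℙ
    to-downward u with side u in su | side (-ₚ upward) | side-downward
    ... | 1ℙ | _ | refl = refl
    ... | 0ℙ | _ | refl = positive-0 (≤-resp
      (sym (trans (solve 2 (λ x y → x :* (:- con 1ℤ) :- y :* (:- con 0ℤ) := :- x) ref (proj₁ u) (proj₂ u)) ref)) ref
      (nonneg⇒-≤0 (Right⇒0≤x (side-0 {u} su))))
      where
      nonneg⇒-≤0 : ∀ {x} → 0# ≤ x → - x ≤ 0#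
      nonneg⇒-≤0 (inj₁ h) = inj₁ (pos⇒-neg h)
      nonneg⇒-≤0 (inj₂ e) = inj₂ (trans (-‿cong (sym e)) -0≈0)

  private
    turn-01 : ∀ {u v} → side u ≡ 0ℙ → side v ≡ 1ℙ → turn u v ≡ positive (cross u v)
    turn-01 {u} {v} p q with side u | side v
    turn-01 refl refl | 0ℙ | 1ℙ = refl

    positive-opposite : ∀ {x y} → ¬ x ≈ 0# → y ≈ - x → positive x ℙ.+ positive y ≡ 1ℙ
    positive-opposite {x} {y} x≉0 e with compare 0# x
    ... | tri< h _ _ = ≡.cong (1ℙ ℙ.+_) (positive-0 (≤-resp (sym e) ref (inj₁ (pos⇒-neg h))))
    ... | tri≈ _ h _ = contradiction (sym h) x≉0
    ... | tri> _ _ h = positive-1 (<-resp ref (sym e) (neg⇒0<- h))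

    cross-neg : ∀ u v → cross (-ₚ u) (-ₚ v) ≈ cross u v
    cross-neg (u₁ , u₂) (v₁ , v₂) = solve 4 (λ u₁ u₂ v₁ v₂ →
      (:- u₁) :* (:- v₂) :- (:- u₂) :* (:- v₁) := u₁ :* v₂ :- u₂ :* v₁) ref u₁ u₂ v₁ v₂

    -- Parallel vectors on different sides point in opposite directions. Weighting each with a
    -- coordinate of the other makes their sum vanish, `w` getting weight zero.
    opposite-sides : ∀ {u v w} → Avoids₀ u v w → Right u → Right (-ₚ v) → ¬ cross u v ≈ 0#
    opposite-sides {u₁ , u₂} {v₁ , v₂} {w₁ , w₂} hull (inj₁ 0<u₁) r e =
      hull (- v₁) u₁ 0# (Right⇒0≤x r) (inj₁ 0<u₁) (inj₂ ref)
        (<-resp ref (solve 2 (λ a b → a :+ b := b :+ (a :+ con 0ℤ)) ref _ _) (+-pos-nonneg 0<u₁ (Right⇒0≤x r)))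
        ( solve 3 (λ u v w → (:- v) :* u :+ (u :* v :+ con 0ℤ :* w) := con 0ℤ) ref u₁ v₁ w₁
        , trans (solve 5 (λ u₁ u₂ v₁ v₂ w → (:- v₁) :* u₂ :+ (u₁ :* v₂ :+ con 0ℤ :* w) := u₁ :* v₂ :- u₂ :* v₁) ref u₁ u₂ v₁ v₂ w₂) e)
    opposite-sides {u₁ , u₂} {v₁ , v₂} {w₁ , w₂} hull (inj₂ (u₁≈0 , 0<u₂)) (inj₂ (_ , 0<-v₂)) e =
      hull (- v₂) u₂ 0# (inj₁ 0<-v₂) (inj₁ 0<u₂) (inj₂ ref)
        (<-resp ref (solve 2 (λ a b → a :+ b := a :+ (b :+ con 0ℤ)) ref _ _) (+-pos 0<-v₂ 0<u₂))
        ( trans (solve 5 (λ u₁ u₂ v₁ v₂ w → (:- v₂) :* u₁ :+ (u₂ :* v₁ :+ con 0ℤ :* w) := :- (u₁ :* v₂ :- u₂ :* v₁)) ref u₁ u₂ v₁ v₂ w₁)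
                (trans (-‿cong e) -0≈0)
        , solve 3 (λ u v w → (:- v) :* u :+ (u :* v :+ con 0ℤ :* w) := con 0ℤ) ref u₂ v₂ w₂)
    opposite-sides {u₁ , u₂} {v₁ , v₂} hull (inj₂ (u₁≈0 , 0<u₂)) (inj₁ 0<-v₁) e =
      <⇒≉0 (*-pos 0<u₂ 0<-v₁) (trans
        (trans (sym (trans (+-congʳ (*-congʳ (-‿cong u₁≈0)))
          (solve 3 (λ u₂ v₁ v₂ → (:- con 0ℤ) :* v₂ :+ u₂ :* (:- v₁) := u₂ :* (:- v₁)) ref u₂ v₁ v₂)))
          (solve 4 (λ u₁ u₂ v₁ v₂ → (:- u₁) :* v₂ :+ u₂ :* (:- v₁) := (u₁ :* v₂ :- u₂ :* v₁) :+ (:- (u₁ :* v₂) :- u₁ :* v₂)) ref u₁ u₂ v₁ v₂))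
        (trans (+-cong e (+-cong (-‿cong u₁v₂≈0) (-‿cong u₁v₂≈0)))
          (solve 0 (con 0ℤ :+ ((:- con 0ℤ) :- con 0ℤ) := con 0ℤ) ref)))
      where
      u₁v₂≈0 : u₁ * v₂ ≈ 0#
      u₁v₂≈0 = trans (*-congʳ u₁≈0) (zeroˡ v₂)

    turn-opposite₀₁ : ∀ {u v w u′ v′} → Avoids₀ u v w → side u ≡ 0ℙ → side v ≡ 1ℙ →
                      u′ ≈ₚ -ₚ u → v′ ≈ₚ -ₚ v → turn u v ℙ.+ turn u′ v′ ≡ 1ℙ
    turn-opposite₀₁ {u} {v} {w} {u′} {v′} hull su sv p q = ≡.trans
      (≡.cong₂ ℙ._+_ (turn-01 {u} {v} su sv) (≡.trans (turn-comm u′ v′)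
        (turn-01 {v′} {u′} (≡.trans (side-neg {v} {v′} (vertex₂ hull) q) (≡.cong _⁻¹ sv))
                           (≡.trans (side-neg {u} {u′} (vertex₁ hull) p) (≡.cong _⁻¹ su)))))
      (positive-opposite (opposite-sides hull (side-0 {u} su) (side-1 {v} (vertex₂ hull) sv))
        (trans (cross-cong q p) (trans (cross-neg v u) (sym (cross-flip u v)))))

  -- The sectors from `u` to `v` and from `-u` to `-v` are opposite. When `u` and `v` are on
  -- different sides, one of them contains the upward vertical and the other the downward one, so
  -- exactly one is counted; on the same side neither is.
  turn-opposite : ∀ {u v w u′ v′} → Avoids₀ u v w → u′ ≈ₚ -ₚ u → v′ ≈ₚ -ₚ v →
                  turn u v ℙ.+ turn u′ v′ ≡ side u ℙ.+ side v
  turn-opposite {u} {v} {w} {u′} {v′} hull p q = go (side u) (side v) refl refl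
    where
    su′ = side-neg {u} {u′} (vertex₁ hull) p
    sv′ = side-neg {v} {v′} (vertex₂ hull) q
    same : side u ≡ side v → turn u v ℙ.+ turn u′ v′ ≡ 0ℙ
    same e = ≡.cong₂ ℙ._+_ (same-side {u} {v} e)
      (same-side {u′} {v′} (≡.trans su′ (≡.trans (≡.cong _⁻¹ e) (≡.sym sv′))))
    go : ∀ s t → side u ≡ s → side v ≡ t → turn u v ℙ.+ turn u′ v′ ≡ s ℙ.+ t
    go 0ℙ 0ℙ e f = same (≡.trans e (≡.sym f))
    go 1ℙ 1ℙ e f = same (≡.trans e (≡.sym f))
    go 0ℙ 1ℙ e f = turn-opposite₀₁ hull e f p q
    go 1ℙ 0ℙ e f = ≡.trans (≡.cong₂ ℙ._+_ (turn-comm u v) (turn-comm u′ v′)) (turn-opposite₀₁ (swap₁₂ hull) f e q p)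

  -- The turns along the hypotenuse and the two legs of Hopf's triangle.

  tangentTurns : List Point → Parity
  tangentTurns (p ∷ q ∷ r ∷ ps) = turn (q -ₚ p) (r -ₚ q) ℙ.+ tangentTurns (q ∷ r ∷ ps)
  tangentTurns _ = 0ℙ

  secantTurns : Point → List Point → Parity
  secantTurns o (p ∷ q ∷ ps) = turn (p -ₚ o) (q -ₚ o) ℙ.+ secantTurns o (q ∷ ps)
  secantTurns o _ = 0ℙ

  endpoint : Point → List Point → Point
  endpoint p []       = p
  endpoint p (q ∷ ps) = endpoint q ps

  -- The last point is left out of the sum.
  finalTurns : Point → List Point → Parity
  finalTurns z (p ∷ q ∷ r ∷ ps) = turn (z -ₚ p) (z -ₚ q) ℙ.+ finalTurns z (q ∷ r ∷ ps)
  finalTurns z _ = 0ℙ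

  -- A triangular cell on the hypotenuse: two successive tangents and the secant that skips the
  -- point between them.
  Corner : Point → Point → Point → Set _
  Corner p q r = Avoids₀ (q -ₚ p) (r -ₚ p) (r -ₚ q)

  -- The row of square cells spanned by the segment from `p` to `p′` and each later segment. A
  -- diagonal cuts each square into two triangles, hence two hull conditions.
  Apart : Point → Point → List Point → Set (c ⊔ˡ ℓ₁ ⊔ˡ ℓ₂)
  Apart p p′ (q ∷ q′ ∷ qs) =
    Avoids₀ (q -ₚ p) (q′ -ₚ p) (q′ -ₚ p′) × Avoids₀ (q -ₚ p) (q -ₚ p′) (q′ -ₚ p′) × Apart p p′ (q′ ∷ qs)
  Apart p p′ _ = Lift _ ⊤

  SimplePolyline : List Point → Set (c ⊔ˡ ℓ₁ ⊔ˡ ℓ₂)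
  SimplePolyline (p ∷ q ∷ r ∷ ps) = Corner p q r × Apart p q (r ∷ ps) × SimplePolyline (q ∷ r ∷ ps)
  SimplePolyline _ = Lift _ ⊤

  open ≡.≡-Reasoning

  private

    -- In each square both ways round equal the diagonal, so the turns along one side of the strip
    -- can be moved to the other side at the price of its two ends.
    strip : ∀ p p′ q qs → Apart p p′ (q ∷ qs) →
            turn (q -ₚ p) (q -ₚ p′) ℙ.+ secantTurns p′ (q ∷ qs) ≡
            secantTurns p (q ∷ qs) ℙ.+ turn (endpoint q qs -ₚ p) (endpoint q qs -ₚ p′)
    strip p p′ q [] _ = ℙP.+-identityʳ _
    strip p p′ q (q′ ∷ qs) (h , k , rest) = begin
      t q q p p′ ℙ.+ (t q q′ p′ p′ ℙ.+ secantTurns p′ (q′ ∷ qs))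
        ≡⟨ ℙP.+-assoc (t q q p p′) _ _ ⟨
      (t q q p p′ ℙ.+ t q q′ p′ p′) ℙ.+ secantTurns p′ (q′ ∷ qs)
        ≡⟨ ≡.cong (ℙ._+ secantTurns p′ (q′ ∷ qs)) (≡.trans (turn-compose k) (≡.sym (turn-compose h))) ⟩
      (t q q′ p p ℙ.+ t q′ q′ p p′) ℙ.+ secantTurns p′ (q′ ∷ qs)
        ≡⟨ ℙP.+-assoc (t q q′ p p) _ _ ⟩
      t q q′ p p ℙ.+ (t q′ q′ p p′ ℙ.+ secantTurns p′ (q′ ∷ qs))
        ≡⟨ ≡.cong (t q q′ p p ℙ.+_) (strip p p′ q′ qs rest) ⟩
      t q q′ p p ℙ.+ (secantTurns p (q′ ∷ qs) ℙ.+ _)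
        ≡⟨ ℙP.+-assoc (t q q′ p p) _ _ ⟨
      (t q q′ p p ℙ.+ secantTurns p (q′ ∷ qs)) ℙ.+ _ ∎
      where
      t : Point → Point → Point → Point → Parity
      t a b p p′ = turn (a -ₚ p) (b -ₚ p′)

    first-strip : ∀ p q r ps → Corner p q r → Apart p q (r ∷ ps) →
                  turn (q -ₚ p) (r -ₚ q) ℙ.+ secantTurns q (r ∷ ps) ≡
                  secantTurns p (q ∷ r ∷ ps) ℙ.+ turn (endpoint r ps -ₚ p) (endpoint r ps -ₚ q)
    first-strip p q r ps h k = begin
      turn (q -ₚ p) (r -ₚ q) ℙ.+ secantTurns q (r ∷ ps)
        ≡⟨ ≡.cong (ℙ._+ secantTurns q (r ∷ ps)) (turn-compose h) ⟨
      (turn (q -ₚ p) (r -ₚ p) ℙ.+ turn (r -ₚ p) (r -ₚ q)) ℙ.+ secantTurns q (r ∷ ps)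
        ≡⟨ ℙP.+-assoc (turn (q -ₚ p) (r -ₚ p)) _ _ ⟩
      turn (q -ₚ p) (r -ₚ p) ℙ.+ (turn (r -ₚ p) (r -ₚ q) ℙ.+ secantTurns q (r ∷ ps))
        ≡⟨ ≡.cong (turn (q -ₚ p) (r -ₚ p) ℙ.+_) (strip p q r ps k) ⟩
      turn (q -ₚ p) (r -ₚ p) ℙ.+ (secantTurns p (r ∷ ps) ℙ.+ _)
        ≡⟨ ℙP.+-assoc (turn (q -ₚ p) (r -ₚ p)) _ _ ⟨
      secantTurns p (q ∷ r ∷ ps) ℙ.+ _ ∎

  -- Removing the strip of the first point leaves the triangle of the remaining polyline. The far
  -- end of each strip is one more term of `finalTurns`.
  tangents≡secants : ∀ p q ps → SimplePolyline (p ∷ q ∷ ps) →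
    tangentTurns (p ∷ q ∷ ps) ≡ secantTurns p (q ∷ ps) ℙ.+ finalTurns (endpoint q ps) (p ∷ q ∷ ps)
  tangents≡secants p q [] _ = refl
  tangents≡secants p q (r ∷ ps) (h , k , rest) = begin
    turn (q -ₚ p) (r -ₚ q) ℙ.+ tangentTurns (q ∷ r ∷ ps)
      ≡⟨ ≡.cong (turn (q -ₚ p) (r -ₚ q) ℙ.+_) (tangents≡secants q r ps rest) ⟩
    turn (q -ₚ p) (r -ₚ q) ℙ.+ (secantTurns q (r ∷ ps) ℙ.+ F)
      ≡⟨ ℙP.+-assoc (turn (q -ₚ p) (r -ₚ q)) _ _ ⟨
    (turn (q -ₚ p) (r -ₚ q) ℙ.+ secantTurns q (r ∷ ps)) ℙ.+ F
      ≡⟨ ≡.cong (ℙ._+ F) (first-strip p q r ps h k) ⟩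
    (secantTurns p (q ∷ r ∷ ps) ℙ.+ T) ℙ.+ F
      ≡⟨ ℙP.+-assoc (secantTurns p (q ∷ r ∷ ps)) _ _ ⟩
    secantTurns p (q ∷ r ∷ ps) ℙ.+ (T ℙ.+ F) ∎
    where
    z = endpoint r ps
    F = finalTurns z (q ∷ r ∷ ps)
    T = turn (z -ₚ p) (z -ₚ q)

  -- Turning of an arch and of a closed polygon.

  -- Heights add with non-negative weights, so the weights at `u` and `upward` vanish and `v` alone
  -- would have to be zero. The weak bound on `v` admits the last secant of an arch, which is
  -- horizontal.
  upper-avoids : ∀ {u v} → 0# < proj₂ u → 0# ≤ proj₂ v → ¬ v ≈ₚ 0ₚ → Avoids₀ u upward v
  upper-avoids {u₁ , u₂} {v₁ , v₂} 0<u₂ 0≤v₂ v≉0 a b d 0≤a 0≤b 0≤d 0<s (e₁ , e₂) = v≉0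
    (cancel e₁ , cancel e₂)
    where
    au≈0 : a * u₂ ≈ 0#
    au≈0 = nonneg-sum≈0 (*-nonneg 0≤a (inj₁ 0<u₂)) (+-nonneg (*-nonneg 0≤b (inj₁ 0<1)) (*-nonneg 0≤d 0≤v₂)) e₂
    a≈0 : a ≈ 0#
    a≈0 = *-zero-cancel (<⇒≉0 0<u₂) (trans (*-comm u₂ a) au≈0)
    b≈0 : b ≈ 0#
    b≈0 = trans (sym (*-identityʳ b)) (nonneg-sum≈0 (*-nonneg 0≤b (inj₁ 0<1)) (*-nonneg 0≤d 0≤v₂)
      (trans (sym (trans (+-congʳ au≈0) (+-identityˡ _))) e₂))
    d≉0 : ¬ d ≈ 0#
    d≉0 d≈0 = <⇒≉0 0<s (trans (+-cong a≈0 (+-cong b≈0 d≈0)) (trans (+-identityˡ _) (+-identityˡ _)))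
    cancel : ∀ {x y z} → a * x + (b * y + d * z) ≈ 0# → z ≈ 0#
    cancel {x} {y} {z} e = *-zero-cancel d≉0 (trans
      (sym (trans (+-cong (trans (*-congʳ a≈0) (zeroˡ x)) (+-congʳ (trans (*-congʳ b≈0) (zeroˡ y))))
                  (trans (+-identityˡ _) (+-identityˡ _)))) e)

  Avoids₀-neg : ∀ {u v w u′ v′ w′} → u′ ≈ₚ -ₚ u → v′ ≈ₚ -ₚ v → w′ ≈ₚ -ₚ w → Avoids₀ u v w → Avoids₀ u′ v′ w′
  Avoids₀-neg (p , p′) (q , q′) (r , r′) hull a b d 0≤a 0≤b 0≤d 0<s (e , e′) =
    hull a b d 0≤a 0≤b 0≤d 0<s (neg p q r e , neg p′ q′ r′ e′)
    where
    neg : ∀ {x y z x′ y′ z′} → x′ ≈ - x → y′ ≈ - y → z′ ≈ - z → a * x′ + (b * y′ + d * z′) ≈ 0# → a * x + (b * y + d * z) ≈ 0#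
    neg {x} {y} {z} p q r e = trans
      (solve 6 (λ a b d x y z → a :* x :+ (b :* y :+ d :* z) := :- (a :* (:- x) :+ (b :* (:- y) :+ d :* (:- z)))) ref a b d x y z)
      (trans (-‿cong (trans (sym (+-cong (*-congˡ p) (+-cong (*-congˡ q) (*-congˡ r)))) e)) -0≈0)

  ∸-anti : ∀ p q → p -ₚ q ≈ₚ -ₚ (q -ₚ p)
  ∸-anti (x , y) (x′ , y′) = anti x x′ , anti y y′
    where
    anti : ∀ x y → x ∸ y ≈ - (y ∸ x)
    anti = solve 2 (λ x y → x :- y := :- (y :- x)) ref

  Above : Point → List Point → Set (ℓ₁ ⊔ˡ ℓ₂)
  Above o []           = Lift _ ⊤
  Above o (z ∷ [])     = Lift ℓ₂ (proj₂ z ≈ proj₂ o)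
  Above o (q ∷ r ∷ ps) = Lift ℓ₁ (proj₂ o < proj₂ q) × Above o (r ∷ ps)

  private
    Above-end : ∀ o q ps → Above o (q ∷ ps) → proj₂ (endpoint q ps) ≈ proj₂ o
    Above-end o q [] (lift e) = e
    Above-end o q (r ∷ ps) (_ , h) = Above-end o r ps h

    ∸-nonzero : ∀ p q → ¬ p -ₚ q ≈ₚ 0ₚ → ¬ q -ₚ p ≈ₚ 0ₚ
    ∸-nonzero p q h (e , f) = h (trans (proj₁ (∸-anti p q)) (trans (-‿cong e) -0≈0) ,
                                 trans (proj₂ (∸-anti p q)) (trans (-‿cong f) -0≈0))

    high-nonzero : ∀ {o r} → proj₂ o < proj₂ r → ¬ r -ₚ o ≈ₚ 0ₚ
    high-nonzero h (_ , e) = <⇒≉0 (<⇒0<∸ h) e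

    -- Seen from one foot of the arch every point is upward or level, so `upward` can be inserted at
    -- each step and the side bits telescope.
    arch-secants : ∀ o q ps → Above o (q ∷ ps) → ¬ endpoint q ps -ₚ o ≈ₚ 0ₚ →
                   secantTurns o (q ∷ ps) ≡ side (q -ₚ o) ℙ.+ side (endpoint q ps -ₚ o)
    arch-secants o q [] _ _ = ≡.sym (p+p≡0 (side (q -ₚ o)))
    arch-secants o q (r ∷ ps) (lift h , k) z≉o = ≡.trans
      (≡.cong₂ ℙ._+_ (turn-through-upward {q -ₚ o} {r -ₚ o} (upper-avoids (<⇒0<∸ h) (proj₁ (next ps k z≉o)) (proj₂ (next ps k z≉o))))
                     (arch-secants o r ps k z≉o))
      (telescope (side (q -ₚ o)) (side (r -ₚ o)) (side (endpoint r ps -ₚ o)))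
      where
      next : ∀ ps → Above o (r ∷ ps) → ¬ endpoint r ps -ₚ o ≈ₚ 0ₚ → 0# ≤ proj₂ (r -ₚ o) × ¬ r -ₚ o ≈ₚ 0ₚ
      next [] (lift e) h = inj₂ (sym (trans (+-congʳ e) (-‿inverseʳ _))) , h
      next (_ ∷ _) (lift h , _) _ = inj₁ (<⇒0<∸ h) , high-nonzero h

    below-turn : ∀ {z p q} → proj₂ z ≤ proj₂ p → proj₂ z < proj₂ q → ¬ z -ₚ p ≈ₚ 0ₚ → turn (z -ₚ p) (z -ₚ q) ≡ 0ℙ
    below-turn {z} {p} {q} h k z≉p = ≡.trans (turn-comm (z -ₚ p) (z -ₚ q))
      (turn-through-downward {z -ₚ q} {z -ₚ p} (Avoids₀-neg {q -ₚ z} {upward} {p -ₚ z} (∸-anti z q) (ref , ref) (∸-anti z p)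
        (upper-avoids (<⇒0<∸ k) (≤⇒0≤∸ h) (∸-nonzero z p z≉p))))

    -- The secants to the other foot point downward or are level, so the downward vertical can be
    -- inserted and nothing is counted.
    arch-finals : ∀ o p q ps → proj₂ o ≤ proj₂ p → ¬ endpoint q ps -ₚ p ≈ₚ 0ₚ → Above o (q ∷ ps) →
                  finalTurns (endpoint q ps) (p ∷ q ∷ ps) ≡ 0ℙ
    arch-finals o p q [] _ _ _ = refl
    arch-finals o p q (r ∷ ps) o≤p z≉p (lift h , k) = ≡.cong₂ ℙ._+_
      (below-turn {endpoint r ps} {p} {q} (≤-resp (sym z≈o) ref o≤p) (<-resp (sym z≈o) ref h) z≉p)
      (arch-finals o q r ps (inj₁ h) (∸-nonzero q (endpoint r ps) (high-nonzero (<-resp (sym z≈o) ref h))) k)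
      where
      z≈o = Above-end o r ps k

  arch-turning : ∀ p q ps → SimplePolyline (p ∷ q ∷ ps) → Above p (q ∷ ps) → ¬ endpoint q ps -ₚ p ≈ₚ 0ₚ →
                 tangentTurns (p ∷ q ∷ ps) ≡ side (q -ₚ p) ℙ.+ side (endpoint q ps -ₚ p)
  arch-turning p q ps simple above z≉p = begin
    tangentTurns (p ∷ q ∷ ps)  ≡⟨ tangents≡secants p q ps simple ⟩
    secantTurns p (q ∷ ps) ℙ.+ finalTurns (endpoint q ps) (p ∷ q ∷ ps)
      ≡⟨ ≡.cong₂ ℙ._+_ (arch-secants p q ps above z≉p) (arch-finals p p q ps (inj₂ ref) z≉p above) ⟩
    (side (q -ₚ p) ℙ.+ side (endpoint q ps -ₚ p)) ℙ.+ 0ℙ ≡⟨ ℙP.+-identityʳ _ ⟩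
    side (q -ₚ p) ℙ.+ side (endpoint q ps -ₚ p) ∎

  private
    endpoint-snoc : ∀ r ps {p} → endpoint r (ps ++ p ∷ []) ≡ p
    endpoint-snoc r []       = refl
    endpoint-snoc r (q ∷ ps) = endpoint-snoc q ps

    secants-snoc : ∀ o r ps p → secantTurns o (r ∷ ps ++ p ∷ []) ≡
                   secantTurns o (r ∷ ps) ℙ.+ turn (endpoint r ps -ₚ o) (p -ₚ o)
    secants-snoc o r [] p = ℙP.+-identityʳ _
    secants-snoc o r (q ∷ ps) p = ≡.trans (≡.cong (turn (r -ₚ o) (q -ₚ o) ℙ.+_) (secants-snoc o q ps p))
      (≡.sym (ℙP.+-assoc (turn (r -ₚ o) (q -ₚ o)) _ _))

    -- In a closed polygon the two legs run through opposite secants, which `turn-opposite` pairs.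
    -- The point `x` is arbitrary because `finalTurns` leaves out the last point.
    opposite-secants : ∀ p p′ q ps → Apart p p′ (q ∷ ps) → ∀ x →
      secantTurns p (q ∷ ps) ℙ.+ finalTurns p (q ∷ ps ++ x ∷ []) ≡ side (q -ₚ p) ℙ.+ side (endpoint q ps -ₚ p)
    opposite-secants p p′ q [] _ x = ≡.sym (p+p≡0 (side (q -ₚ p)))
    opposite-secants p p′ q (r ∷ ps) (h , _ , k) x = begin
      (A ℙ.+ B) ℙ.+ finalTurns p (q ∷ r ∷ ps ++ x ∷ [])  ≡⟨ ≡.cong ((A ℙ.+ B) ℙ.+_) (step ps) ⟩
      (A ℙ.+ B) ℙ.+ (A′ ℙ.+ B′)
        ≡⟨ interchange A B A′ B′ ⟩
      (A ℙ.+ A′) ℙ.+ (B ℙ.+ B′)  ≡⟨ ≡.cong₂ ℙ._+_ (turn-opposite h (∸-anti p q) (∸-anti p r)) (opposite-secants p p′ r ps k x) ⟩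
      (side (q -ₚ p) ℙ.+ side (r -ₚ p)) ℙ.+ (side (r -ₚ p) ℙ.+ side (endpoint r ps -ₚ p))
        ≡⟨ telescope (side (q -ₚ p)) (side (r -ₚ p)) (side (endpoint r ps -ₚ p)) ⟩
      side (q -ₚ p) ℙ.+ side (endpoint r ps -ₚ p) ∎
      where
      A = turn (q -ₚ p) (r -ₚ p)
      B = secantTurns p (r ∷ ps)
      A′ = turn (p -ₚ q) (p -ₚ r)
      B′ = finalTurns p (r ∷ ps ++ x ∷ [])
      step : ∀ ps → finalTurns p (q ∷ r ∷ ps ++ x ∷ []) ≡ turn (p -ₚ q) (p -ₚ r) ℙ.+ finalTurns p (r ∷ ps ++ x ∷ [])
      step []      = refl
      step (_ ∷ _) = refl

  -- The Umlaufsatz modulo 2. There is no secant between the two copies of `p`, so that vertex of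
  -- Hopf's triangle is cut off: the legs are computed for the open polyline from `q`, the first
  -- strip stops at the endpoint `z` before the return, and the turn `T` at `p` closes the polygon.
  -- What survives compares a vector with its opposite, which lies on the other side.
  closed-turning : ∀ p q r ps → SimplePolyline (q ∷ r ∷ ps ++ p ∷ []) → Corner p q r → Apart p q (r ∷ ps) →
    Corner (endpoint r ps) p q →
    tangentTurns (p ∷ q ∷ r ∷ ps ++ p ∷ []) ℙ.+ turn (p -ₚ endpoint r ps) (q -ₚ p) ≡ 1ℙ
  closed-turning p q r ps simple corner apart corner′ = begin
    (A ℙ.+ tangentTurns (q ∷ r ∷ ps ++ p ∷ [])) ℙ.+ T
      ≡⟨ ≡.cong (λ x → (A ℙ.+ x) ℙ.+ T) (≡.trans (tangents≡secants q r (ps ++ p ∷ []) simple)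
           (≡.cong₂ ℙ._+_ (secants-snoc q r ps p) (≡.cong (λ x → finalTurns x (q ∷ r ∷ ps ++ p ∷ [])) (endpoint-snoc r ps)))) ⟩
    (A ℙ.+ ((B ℙ.+ C) ℙ.+ F)) ℙ.+ T
      ≡⟨ solveℙ 5 (λ a b c f t → (a ⊞ ((b ⊞ c) ⊞ f)) ⊞ t
           ⊜ ((a ⊞ b) ⊞ c) ⊞ (f ⊞ t)) refl A B C F T ⟩
    ((A ℙ.+ B) ℙ.+ C) ℙ.+ (F ℙ.+ T)
      ≡⟨ ≡.cong (λ x → (x ℙ.+ C) ℙ.+ (F ℙ.+ T)) (first-strip p q r ps corner apart) ⟩
    ((X ℙ.+ Y) ℙ.+ C) ℙ.+ (F ℙ.+ T)
      ≡⟨ solveℙ 5 (λ x y c f t → ((x ⊞ y) ⊞ c) ⊞ (f ⊞ t)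
           ⊜ (x ⊞ f) ⊞ ((y ⊞ c) ⊞ t)) refl X Y C F T ⟩
    (X ℙ.+ F) ℙ.+ ((Y ℙ.+ C) ℙ.+ T)
      -- The corner at `p` replaces the cell that was cut off.
      ≡⟨ ≡.cong₂ (λ x y → x ℙ.+ (y ℙ.+ T)) secants (turn-compose cornerᶻ) ⟩
    (side (q -ₚ p) ℙ.+ side (z -ₚ p)) ℙ.+ (turn (z -ₚ p) (p -ₚ q) ℙ.+ T)
      ≡⟨ ≡.cong ((side (q -ₚ p) ℙ.+ side (z -ₚ p)) ℙ.+_) (turn-opposite (swap₂₃ cornerᶻ) (∸-anti p z) (∸-anti q p)) ⟩
    (side (q -ₚ p) ℙ.+ side (z -ₚ p)) ℙ.+ (side (z -ₚ p) ℙ.+ side (p -ₚ q))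
      ≡⟨ telescope (side (q -ₚ p)) (side (z -ₚ p)) (side (p -ₚ q)) ⟩
    side (q -ₚ p) ℙ.+ side (p -ₚ q)
      ≡⟨ ≡.cong (side (q -ₚ p) ℙ.+_) (side-neg {q -ₚ p} {p -ₚ q} (vertex₁ corner) (∸-anti p q)) ⟩
    side (q -ₚ p) ℙ.+ side (q -ₚ p) ⁻¹  ≡⟨ ℙP.p+p⁻¹≡1ℙ (side (q -ₚ p)) ⟩
    1ℙ ∎
    where
    z = endpoint r ps
    A = turn (q -ₚ p) (r -ₚ q)
    B = secantTurns q (r ∷ ps)
    C = turn (z -ₚ q) (p -ₚ q)
    F = finalTurns p (q ∷ r ∷ ps ++ p ∷ [])
    T = turn (p -ₚ z) (q -ₚ p)
    X = secantTurns p (q ∷ r ∷ ps)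
    Y = turn (z -ₚ p) (z -ₚ q)
    cornerᶻ : Avoids₀ (z -ₚ p) (z -ₚ q) (p -ₚ q)
    cornerᶻ = Avoids₀-neg {p -ₚ z} {q -ₚ z} {q -ₚ p} (∸-anti z p) (∸-anti z q) (∸-anti p q) corner′
    secants : X ℙ.+ F ≡ side (q -ₚ p) ℙ.+ side (z -ₚ p)
    secants = begin
      (turn (q -ₚ p) (r -ₚ p) ℙ.+ secantTurns p (r ∷ ps)) ℙ.+ F  ≡⟨ ≡.cong (X ℙ.+_) (step ps) ⟩
      X ℙ.+ (A′ ℙ.+ B′)
        ≡⟨ interchange (turn (q -ₚ p) (r -ₚ p)) (secantTurns p (r ∷ ps)) A′ B′ ⟩
      (turn (q -ₚ p) (r -ₚ p) ℙ.+ A′) ℙ.+ (secantTurns p (r ∷ ps) ℙ.+ B′)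
        ≡⟨ ≡.cong₂ ℙ._+_ (turn-opposite corner (∸-anti p q) (∸-anti p r)) (opposite-secants p q r ps apart p) ⟩
      (side (q -ₚ p) ℙ.+ side (r -ₚ p)) ℙ.+ (side (r -ₚ p) ℙ.+ side (z -ₚ p))
        ≡⟨ telescope (side (q -ₚ p)) (side (r -ₚ p)) (side (z -ₚ p)) ⟩
      side (q -ₚ p) ℙ.+ side (z -ₚ p) ∎
      where
      A′ = turn (p -ₚ q) (p -ₚ r)
      B′ = finalTurns p (r ∷ ps ++ p ∷ [])
      step : ∀ ps → finalTurns p (q ∷ r ∷ ps ++ p ∷ []) ≡ A′ ℙ.+ finalTurns p (r ∷ ps ++ p ∷ [])
      step []      = refl
      step (_ ∷ _) = refl

-- Lists, counting and finite subsets.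

module _ {a} {A : Set a} where

  Unique-++⁻ : ∀ (xs : List A) {ys} → Unique (xs ++ ys) → Unique xs × Unique ys × Disjoint xs ys
  Unique-++⁻ []       u = [] , u , λ ()
  Unique-++⁻ (x ∷ xs) {ys} (x∉ ∷ u) =
    let (uxs , uys , dis) = Unique-++⁻ xs u in
    AllP.++⁻ˡ xs x∉ ∷ uxs , uys , λ
      { (here refl , v∈ys) → All.lookup (AllP.++⁻ʳ xs x∉) v∈ys refl
      ; (there v∈xs , v∈ys) → dis (v∈xs , v∈ys) }

  ++-compare : ∀ (xs xs′ : List A) {ys ys′} → xs ++ ys ≡ xs′ ++ ys′ →
    (xs ≡ xs′ × ys ≡ ys′) ⊎
    (∃₂ λ z zs → xs′ ≡ xs ++ z ∷ zs × ys ≡ z ∷ zs ++ ys′) ⊎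
    (∃₂ λ z zs → xs ≡ xs′ ++ z ∷ zs × ys′ ≡ z ∷ zs ++ ys)
  ++-compare []       []         e = inj₁ (refl , e)
  ++-compare []       (x ∷ xs′)  e = inj₂ (inj₁ (x , xs′ , refl , e))
  ++-compare (x ∷ xs) []         e = inj₂ (inj₂ (x , xs , refl , ≡.sym e))
  ++-compare (x ∷ xs) (x′ ∷ xs′) e with refl , e′ ← ∷-injective e with ++-compare xs xs′ e′
  ... | inj₁ (refl , f)                  = inj₁ (refl , f)
  ... | inj₂ (inj₁ (z , zs , refl , f)) = inj₂ (inj₁ (z , zs , refl , f))
  ... | inj₂ (inj₂ (z , zs , refl , f)) = inj₂ (inj₂ (z , zs , refl , f))

unique-map-injective : ∀ {a b} {A : Set a} {B : Set b} {h : A → B} {xs} → Unique (map h xs) →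
  ∀ {x y} → x ∈ₗ xs → y ∈ₗ xs → h x ≡ h y → x ≡ y
unique-map-injective {xs = _ ∷ _} u       (here refl) (here refl) e = refl
unique-map-injective {h = h} {xs = _ ∷ xs} u (here refl) (there y∈) e =
  contradiction (≡.subst (_∈ₗ map h xs) (≡.sym e) (∈-map⁺ h y∈)) (Unique[x∷xs]⇒x∉xs u)
unique-map-injective {h = h} {xs = _ ∷ xs} u (there x∈) (here refl) e =
  contradiction (≡.subst (_∈ₗ map h xs) e (∈-map⁺ h x∈)) (Unique[x∷xs]⇒x∉xs u)
unique-map-injective {xs = _ ∷ _} (_ ∷ u) (there x∈)  (there y∈)  e = unique-map-injective u x∈ y∈ e

module _ {m : ℕ} where

  count : {Q : Fin m → Set} → Decidable Q → ℕ
  count Q? = length (filter Q? (allFin m))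

  module _ {Q : Fin m → Set} (Q? : Decidable Q) where

    count-positive : ∀ {f} → Q f → 1 ℕ.≤ count Q?
    count-positive {f} q with filter Q? (allFin m) | ∈-filter⁺ Q? (∈-allFin f) q
    ... | _ ∷ _ | _ = s≤s z≤n

    count-witness : 1 ℕ.≤ count Q? → ∃[ f ] Q f
    count-witness h with filter Q? (allFin m) in e
    ... | f ∷ fs = f , proj₂ (∈-filter⁻ Q? {xs = allFin m} (≡.subst (f ∈ₗ_) (≡.sym e) (here refl)))

    count-unique : count Q? ℕ.≤ 1 → ∀ {f g} → Q f → Q g → f ≡ g
    count-unique h {f} {g} p q with filter Q? (allFin m) | ∈-filter⁺ Q? (∈-allFin f) p | ∈-filter⁺ Q? (∈-allFin g) q
    count-unique _        p q | _ ∷ []    | here refl | here refl = refl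
    count-unique (s≤s ()) p q | _ ∷ _ ∷ _ | _ | _

    count≤1 : (∀ {f g} → Q f → Q g → f ≡ g) → count Q? ℕ.≤ 1
    count≤1 inj with filter Q? (allFin m) in e
    ... | []        = z≤n
    ... | _ ∷ []    = s≤s z≤n
    ... | x ∷ y ∷ _ with ≡.subst Unique e (UniqueP.filter⁺ Q? (allFin⁺ m))
    ...   | (x≢y ∷ _) ∷ _ = contradiction (inj (holds (here refl)) (holds (there (here refl)))) x≢y
      where
      holds : ∀ {z} → z ∈ₗ x ∷ y ∷ _ → Q z
      holds z∈ = proj₂ (∈-filter⁻ Q? {xs = allFin m} (≡.subst (_ ∈ₗ_) (≡.sym e) z∈))

    count≡0 : (∀ {f} → ¬ Q f) → count Q? ≡ 0
    count≡0 none with count Q? in e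
    ... | zero  = refl
    ... | suc _ = ⊥-elim (none (proj₂ (count-witness (≡.subst (1 ℕ.≤_) (≡.sym e) (s≤s z≤n)))))

  -- Both counts are at most one, so they agree as soon as each is positive when the other is.
  count-balance : {P Q : Fin m → Set} (P? : Decidable P) (Q? : Decidable Q) →
    (∀ {f g} → P f → P g → f ≡ g) → (∀ {f g} → Q f → Q g → f ≡ g) →
    (∀ {f} → P f → ∃[ g ] Q g) → (∀ {f} → Q f → ∃[ g ] P g) → count P? ≡ count Q?
  count-balance P? Q? uP uQ P⇒Q Q⇒P = ℕP.≤-antisym
    (le P? Q? (count≤1 P? uP) P⇒Q) (le Q? P? (count≤1 Q? uQ) Q⇒P)
    where
    le : {P Q : Fin m → Set} (P? : Decidable P) (Q? : Decidable Q) → count P? ℕ.≤ 1 → (∀ {f} → P f → ∃[ g ] Q g) → count P? ℕ.≤ count Q?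
    le P? Q? P≤1 P⇒Q with count P? in e
    ... | zero = z≤n
    ... | suc zero = count-positive Q? (proj₂ (P⇒Q (proj₂ (count-witness P? (≡.subst (1 ℕ.≤_) (≡.sym e) (s≤s z≤n))))))
    le P? Q? (s≤s ()) P⇒Q | suc (suc _)

  -- The pigeonhole bound that stops the backward tracing in `trace-back`.
  unique-length : ∀ (xs : List (Fin m)) → Unique xs → length xs ℕ.≤ m
  unique-length xs u = FinP.injective⇒≤ (lookup-injective u)
    where
    lookup-injective : ∀ {xs : List (Fin m)} → Unique xs → ∀ {i j} → List.lookup xs i ≡ List.lookup xs j → i ≡ j
    lookup-injective (_ ∷ _)  {zero}  {zero}  _ = refl
    lookup-injective (x∉ ∷ _) {zero}  {suc j} e = contradiction e (All.lookup x∉ (Any-lookup j))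
      where
      Any-lookup : ∀ {xs : List (Fin m)} (j : Fin (length xs)) → List.lookup xs j ∈ₗ xs
      Any-lookup {_ ∷ _} zero    = here refl
      Any-lookup {_ ∷ _} (suc j) = there (Any-lookup j)
    lookup-injective (x∉ ∷ u) {suc i} {zero}  e = ≡.sym (lookup-injective (x∉ ∷ u) {zero} {suc i} (≡.sym e))
    lookup-injective (_ ∷ u)  {suc i} {suc j} e = ≡.cong suc (lookup-injective u e)

  infix 4 _∈ₗ?_
  _∈ₗ?_ : ∀ (f : Fin m) P → Dec (f ∈ₗ P)
  _∈ₗ?_ = mem? FinP._≟_

  support : List (Fin m) → Subset m
  support P = tabulate λ f → does (f ∈ₗ? P)

  ∈-support⁺ : ∀ {f P} → f ∈ₗ P → f ∈ support P
  ∈-support⁺ {f} {P} h = VecP.lookup⇒[]= f _ (≡.trans (VecP.lookup∘tabulate _ f) (dec-true (f ∈ₗ? P) h))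

  ∈-support⁻ : ∀ {f P} → f ∈ support P → f ∈ₗ P
  ∈-support⁻ {f} {P} h with f ∈ₗ? P | ≡.trans (≡.sym (VecP.lookup∘tabulate (λ f → does (f ∈ₗ? P)) f)) (VecP.[]=⇒lookup h)
  ... | yes p | _ = p

  ∈-─⁻ : ∀ {f} (C D : Subset m) → f ∈ C ─ D → f ∈ C × f ∉ D
  ∈-─⁻ C D f∈ = p─q⊆p C D f∈ , go C D f∈
    where
    go : ∀ {m} {f : Fin m} (C D : Subset m) → f ∈ C ─ D → f ∉ D
    go (inside ∷ C) (inside ∷ D) () here
    go (_ ∷ C) (inside ∷ D) (there h) (there k) = go C D h k
    go (_ ∷ C) (outside ∷ D) (there h) (there k) = go C D h k

  subset-ext : ∀ {C D : Subset m} → (∀ {f} → f ∈ C → f ∈ D) → (∀ {f} → f ∈ D → f ∈ C) → C ≡ D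
  subset-ext h k = ⊆-antisym h k

-- Walks in a digraph, loop erasure and first events.

module Walks {n} (D : Digraph n) where
  open Digraph D

  sources : List Edge → List Vertex
  sources = map src

  walk-++ : ∀ {u v w} P {Q} → IsWalk u P v → IsWalk v Q w → IsWalk u (P ++ Q) w
  walk-++ []      refl    q = q
  walk-++ (f ∷ P) (e , p) q = e , walk-++ P p q

  walk-split : ∀ {u w} P {Q} → IsWalk u (P ++ Q) w → ∃[ v ] IsWalk u P v × IsWalk v Q w
  walk-split []      q       = _ , refl , q
  walk-split (f ∷ P) (e , p) = let (v , q , r) = walk-split P p in v , (e , q) , r

  walk-end : ∀ {u v w} P → IsWalk u P v → IsWalk u P w → v ≡ w
  walk-end []      refl    refl    = refl
  walk-end (f ∷ P) (_ , p) (_ , q) = walk-end P p q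

  walk-next₁ : ∀ {f w} P → IsWalk (tgt f) P w → ∀ {g} → g ∈ₗ f ∷ P → tgt g ∈ₗ sources P ⊎ tgt g ≡ w
  walk-next₁ []      e       (here refl) = inj₂ e
  walk-next₁ (h ∷ P) (e , p) (here refl) = inj₁ (here (≡.sym e))
  walk-next₁ (h ∷ P) (e , p) (there g∈)  = Sum.map₁ there (walk-next₁ P p g∈)

  walk-next : ∀ {u w} P → IsWalk u P w → ∀ {f} → f ∈ₗ P → tgt f ∈ₗ sources P ⊎ tgt f ≡ w
  walk-next (f ∷ P) (_ , p) h = Sum.map₁ there (walk-next₁ P p h)

  walk-prev : ∀ {u w} P → IsWalk u P w → ∀ {f} → f ∈ₗ P → src f ≡ u ⊎ ∃[ g ] g ∈ₗ P × tgt g ≡ src f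
  walk-prev (f ∷ P) (e , p) (here refl) = inj₁ e
  walk-prev (g ∷ P) (e , p) (there h) with walk-prev P p h
  ... | inj₁ e′             = inj₂ (g , here refl , ≡.sym e′)
  ... | inj₂ (g′ , g′∈ , e′) = inj₂ (g′ , there g′∈ , e′)

  walk-last : ∀ {u w} P → IsWalk u P w → P ≢ [] → ∃[ f ] f ∈ₗ P × tgt f ≡ w
  walk-last []          _             P≢[] = contradiction refl P≢[]
  walk-last (f ∷ [])    (_ , e)       _    = f , here refl , e
  walk-last (f ∷ g ∷ P) (_ , p)       _    = let (h , h∈ , e) = walk-last (g ∷ P) p (λ ()) in h , there h∈ , e

  walk-targets : ∀ {u w} f Q → IsWalk u (f ∷ Q) w → map tgt (f ∷ Q) ≡ sources Q ++ w ∷ []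
  walk-targets f []      (_ , refl)    = refl
  walk-targets f (g ∷ Q) (_ , (e , q)) = ≡.cong₂ _∷_ (≡.sym e) (walk-targets g Q (e , q))

  -- The targets are the sources of `Q` followed by `w`. The source of `f` does not enter, so a
  -- cycle with `src f` equal to `w` is covered.
  walk-tgt-injective : ∀ {u w} f Q → IsWalk u (f ∷ Q) w → Unique (sources Q) → w ∉ₗ sources Q →
    ∀ {g h} → g ∈ₗ f ∷ Q → h ∈ₗ f ∷ Q → tgt g ≡ tgt h → g ≡ h
  walk-tgt-injective f Q p uq w∉ = unique-map-injective
    (≡.subst Unique (≡.sym (walk-targets f Q p)) (UniqueP.++⁺ uq ([] ∷ []) (λ { (h , here refl) → w∉ h })))

  source⁻ : ∀ {v} P → v ∈ₗ sources P → ∃[ f ] f ∈ₗ P × src f ≡ v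
  source⁻ P h = let (f , f∈ , e) = ∈-map⁻ src h in f , f∈ , ≡.sym e

  source⁺ : ∀ {f v P} → f ∈ₗ P → src f ≡ v → v ∈ₗ sources P
  source⁺ h refl = ∈-map⁺ src h

  source-split : ∀ {u v w} P → IsWalk u P w → v ∈ₗ sources P →
                 ∃₂ λ Q f → ∃[ R ] P ≡ Q ++ f ∷ R × IsWalk u Q v × IsWalk v (f ∷ R) w
  source-split (f ∷ P) (e , p) (here refl) = [] , f , P , refl , ≡.sym e , (refl , p)
  source-split (f ∷ P) (e , p) (there h) with source-split P p h
  ... | Q , g , R , refl , q , r = f ∷ Q , g , R , refl , (e , q) , r

  OutUnique InUnique : Subset #edges → Set
  OutUnique F = ∀ {f g} → f ∈ F → g ∈ F → src f ≡ src g → f ≡ g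
  InUnique  F = ∀ {f g} → f ∈ F → g ∈ F → tgt f ≡ tgt g → f ≡ g

  -- With one edge of `F` out of each vertex the start forces every step; the last two conditions
  -- force both walks to stop at the same time.
  walk-deterministic : ∀ {F} → OutUnique F → ∀ {u w w′} P Q →
    (∀ {f} → f ∈ₗ P → f ∈ F) → (∀ {f} → f ∈ₗ Q → f ∈ F) → IsWalk u P w → IsWalk u Q w′ →
    w ∉ₗ sources Q → w′ ∉ₗ sources P → P ≡ Q
  walk-deterministic out []      []      _ _ _ _ _ _ = refl
  walk-deterministic out []      (g ∷ Q) _ _ refl (e , q) w∉ _ = contradiction (here (≡.sym e)) w∉
  walk-deterministic out (f ∷ P) []      _ _ (e , p) refl _ w′∉ = contradiction (here (≡.sym e)) w′∉
  walk-deterministic out (f ∷ P) (g ∷ Q) P⊆ Q⊆ (e , p) (e′ , q) w∉ w′∉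
    with refl ← out (P⊆ (here refl)) (Q⊆ (here refl)) (≡.trans e (≡.sym e′)) =
    ≡.cong (f ∷_) (walk-deterministic out P Q (P⊆ ∘ there) (Q⊆ ∘ there) p q (w∉ ∘ there) (w′∉ ∘ there))

  -- What is found by following `F` backwards from `f₀` to the first vertex in `Stop`. Stopping at
  -- `w` itself yields a cycle, stopping at a boundary source yields a path.
  record Trace (F : Subset #edges) (Stop : Vertex → Set) (f₀ : Edge) (w : Vertex) : Set where
    field
      first    : Edge
      rest     : List Edge
      walk     : IsWalk (src first) (first ∷ rest) w
      ⊆F       : ∀ {f} → f ∈ₗ first ∷ rest → f ∈ F
      f₀∈      : f₀ ∈ₗ first ∷ rest
      stops    : Stop (src first)
      moves    : ∀ {f} → f ∈ₗ rest → ¬ Stop (src f)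
      unique   : Unique (sources (first ∷ rest))

  module _ {F : Subset #edges} {Stop : Vertex → Set} (stop? : Decidable Stop) {w : Vertex} {f₀ : Edge}
           (out : OutUnique F) (prev : ∀ {f} → f ∈ F → ¬ Stop (src f) → ∃[ g ] g ∈ F × tgt g ≡ src f)
           (end : ∀ {f} → f ∈ F → src f ≡ w → Stop (src f)) where

    private
      extend : ∀ fuel f P → IsWalk (src f) (f ∷ P) w → (∀ {g} → g ∈ₗ f ∷ P → g ∈ F) → f₀ ∈ₗ f ∷ P →
               (∀ {g} → g ∈ₗ P → ¬ Stop (src g)) → Unique (sources (f ∷ P)) →
               #edges ℕ.< fuel ℕ.+ length (f ∷ P) → Trace F Stop f₀ w
      extend zero f P _ _ _ _ u long = contradiction (unique-length (f ∷ P) (UniqueP.map⁻ u)) (ℕP.<⇒≱ long)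
      extend (suc fuel) f P p P⊆ f₀∈ moves u long with stop? (src f)
      ... | yes s = record { first = f ; rest = P ; walk = p ; ⊆F = P⊆ ; f₀∈ = f₀∈ ; stops = s ; moves = moves ; unique = u }
      ... | no ¬s with prev (P⊆ (here refl)) ¬s
      ...   | g , g∈F , e = extend fuel g (f ∷ P) (refl , ≡.subst (λ v → IsWalk v (f ∷ P) w) (≡.sym e) p)
        (λ { (here refl) → g∈F ; (there h) → P⊆ h }) (there f₀∈)
        (λ { (here refl) → ¬s ; (there h) → moves h })
        (AllP.¬Any⇒All¬ _ fresh ∷ u)
        (≡.subst (#edges ℕ.<_) (≡.sym (ℕP.+-suc fuel _)) long)
        where
        -- A repeated source would mean the same edge `g` by `out`; then its target `src f` would
        -- recur as a later source, or be the end `w`, where the tracing has to stop.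
        fresh : src g ∉ₗ sources (f ∷ P)
        fresh h with source⁻ (f ∷ P) h
        ... | g′ , g′∈ , e′ with refl ← out (P⊆ g′∈) g∈F e′ with walk-next₁ P (proj₂ p) g′∈
        ...   | inj₂ e″ = ¬s (end (P⊆ (here refl)) (≡.trans (≡.sym e) e″))
        ...   | inj₁ k  = Unique[x∷xs]⇒x∉xs u (≡.subst (_∈ₗ sources P) e k)

    trace-back : f₀ ∈ F → tgt f₀ ≡ w → Trace F Stop f₀ w
    trace-back f₀∈F e = extend #edges f₀ [] (refl , e) (λ { (here refl) → f₀∈F }) (here refl) (λ ()) ([] ∷ [])
      (≡.subst (#edges ℕ.<_) (ℕP.+-comm 1 #edges) ℕP.≤-refl)

  private
    erase-return : ∀ v pre S fs {f} → tgt f ≡ v → v ∉ₗ pre →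
                   erase (pre ++ v ∷ S) (f ∷ fs) ≡ suc (erase (v ∷ S) fs)
    erase-return v pre S fs {f} refl v∉pre with mem? _≟ᵥ_ (tgt f) (pre ++ v ∷ S)
    ... | no v∉  = contradiction (∈-++⁺ʳ pre (here refl)) v∉
    ... | yes _ = ≡.cong (λ T → suc (erase T fs)) (unwind pre v∉pre)
      where
      unwind : ∀ pre → v ∉ₗ pre → dropWhile (λ x → ¬? (x ≟ᵥ v)) (pre ++ v ∷ S) ≡ v ∷ S
      unwind [] _ with v ≟ᵥ v
      ... | yes _ = refl
      ... | no v≢v = contradiction refl v≢v
      unwind (x ∷ pre) v∉ with x ≟ᵥ v
      ... | yes refl = contradiction (here refl) v∉
      ... | no _     = unwind pre (v∉ ∘ there)

    erase-step : ∀ S f fs → tgt f ∉ₗ S → erase S (f ∷ fs) ≡ erase (tgt f ∷ S) fs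
    erase-step S f fs h with mem? _≟ᵥ_ (tgt f) S
    ... | yes k = contradiction k h
    ... | no _  = refl

    push : List Vertex → List Edge → List Vertex
    push S []      = S
    push S (f ∷ Q) = push (src f ∷ S) Q

    erase-simple : ∀ {u v} S Q {R} → IsWalk u Q v → Unique (sources Q) → v ∉ₗ sources Q →
      Disjoint (sources Q) S → v ∉ₗ S → erase (u ∷ S) (Q ++ R) ≡ erase (v ∷ push S Q) R
    erase-simple S []      refl _ _ _ _ = refl
    erase-simple {v = v} S (f ∷ Q) {R} (refl , q) u@(_ ∷ uQ) v∉ dis v∉S = ≡.trans
      (erase-step (src f ∷ S) f (Q ++ R) fresh)
      (erase-simple (src f ∷ S) Q q uQ (v∉ ∘ there)
        (λ { (h , here refl) → Unique[x∷xs]⇒x∉xs u h ; (h , there k) → dis (there h , k) })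
        (λ { (here refl) → v∉ (here refl) ; (there k) → v∉S k }))
      where
      fresh : tgt f ∉ₗ src f ∷ S
      fresh h with walk-next (f ∷ Q) (refl , q) (here refl) | walk-next₁ Q q (here refl)
      fresh (here e)  | _ | inj₁ k = Unique[x∷xs]⇒x∉xs u (≡.subst (_∈ₗ sources Q) e k)
      fresh (here e)  | _ | inj₂ k = v∉ (here (≡.trans (≡.sym k) e))
      fresh (there h) | _ | inj₁ k = dis (there k , h)
      fresh (there h) | _ | inj₂ k = v∉S (≡.subst (_∈ₗ S) k h)

    -- `pre` holds the vertices visited since leaving `v`. Only the last edge returns to the stack,
    -- and the unwinding then drops exactly `pre`.
    erase-cycle : ∀ {u v} T pre S f Q {R} → IsWalk u (f ∷ Q) v → u ∷ T ≡ pre ++ v ∷ S → v ∉ₗ pre →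
      Unique (sources (f ∷ Q)) → Disjoint (sources (f ∷ Q)) T →
      erase (u ∷ T) ((f ∷ Q) ++ R) ≡ suc (erase (v ∷ S) R)
    erase-cycle {u} {v} T pre S f [] {R} (_ , e) eq v∉ _ _ =
      ≡.trans (≡.cong (λ T → erase T (f ∷ R)) eq) (erase-return v pre S R e v∉)
    erase-cycle {v = v} T pre S f (g ∷ Q) {R} (refl , (e , q)) eq v∉ u@(_ ∷ uQ) dis = ≡.trans
      (erase-step (src f ∷ T) f (g ∷ Q ++ R) fresh)
      (erase-cycle (src f ∷ T) (tgt f ∷ pre) S g Q (e , q) (≡.cong (tgt f ∷_) eq)
        (λ { (here e′) → return (≡.trans e (≡.sym e′)) ; (there h) → v∉ h }) uQ
        (λ { (h , here refl) → Unique[x∷xs]⇒x∉xs u h ; (h , there k) → dis (there h , k) }))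
      where
      fresh : tgt f ∉ₗ src f ∷ T
      fresh (here e′) = Unique[x∷xs]⇒x∉xs u (here (≡.trans (≡.sym e′) (≡.sym e)))
      fresh (there h) = dis (there (here (≡.sym e)) , h)
      return : src g ≢ v
      return e′ with ≡.subst (v ∈ₗ_) (≡.sym eq) (∈-++⁺ʳ pre (here refl))
      ... | here e″  = Unique[x∷xs]⇒x∉xs u (here (≡.sym (≡.trans e′ e″)))
      ... | there h  = dis (there (here refl) , ≡.subst (_∈ₗ T) (≡.sym e′) h)

  -- Once the first loop closes, the stack is what it was on first reaching `v`, so the rest of the
  -- walk is erased as if the loop had not been there.
  loopsErased-cycle : ∀ {u v} P₀ f Q R → IsWalk u P₀ v → IsWalk v (f ∷ Q) v → Unique (sources (P₀ ++ f ∷ Q)) →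
    loopsErased u (P₀ ++ (f ∷ Q) ++ R) ≡ suc (loopsErased u (P₀ ++ R))
  loopsErased-cycle {u} {v} P₀ f Q R p c uq = ≡.trans
    (erase-simple [] P₀ p u₀ v∉ (λ ()) (λ ()))
    (≡.trans (erase-cycle (push [] P₀) [] (push [] P₀) f Q c refl (λ ()) u₁
               (λ { (h , k) → [ (λ ()) , (λ k′ → dis (k′ , h)) ]′ (∈-push [] P₀ k) }))
             (≡.cong suc (≡.sym (erase-simple [] P₀ p u₀ v∉ (λ ()) (λ ())))))
    where
    split = Unique-++⁻ (sources P₀) (≡.subst Unique (map-++ src P₀ (f ∷ Q)) uq)
    u₀ = proj₁ split
    u₁ = proj₁ (proj₂ split)
    dis = proj₂ (proj₂ split)
    v∉ : v ∉ₗ sources P₀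
    v∉ h = dis (h , here (≡.sym (proj₁ c)))
    ∈-push : ∀ {x} S P → x ∈ₗ push S P → x ∈ₗ S ⊎ x ∈ₗ sources P
    ∈-push S []      h = inj₁ h
    ∈-push S (g ∷ P) h with ∈-push (src g ∷ S) P h
    ... | inj₁ (here e)  = inj₂ (here e)
    ... | inj₁ (there k) = inj₁ k
    ... | inj₂ k         = inj₂ (there k)

  loopsErased-simple : ∀ {u w} P → IsWalk u P w → Unique (sources P) → w ∉ₗ sources P → loopsErased u P ≡ 0
  loopsErased-simple P p uq w∉ = ≡.trans (≡.cong (erase [ _ ]) (≡.sym (++-identityʳ P)))
    (erase-simple [] P p uq w∉ (λ ()) (λ ()))

  module Events (T : Vertex → Set) where

    Clear : List Edge → Set
    Clear Q = Unique (sources Q) × (∀ {v} → v ∈ₗ sources Q → ¬ T v)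

    Free : List Edge → Vertex → Set
    Free P w = Clear P × w ∉ₗ sources P × ¬ T w

    -- The first moment at which the walk meets its own past or the set `T`, which will be the
    -- vertices of a flow.
    record Event (u : Vertex) (P : List Edge) (w : Vertex) : Set where
      constructor event
      field
        {before after} : List Edge
        {place}        : Vertex
        splits         : P ≡ before ++ after
        arrives        : IsWalk u before place
        continues      : IsWalk place after w
        clear          : Clear before
        hits           : place ∈ₗ sources before ⊎ T place

    find-event : Decidable T → ∀ {u w} P → IsWalk u P w → Free P w ⊎ Event u P w
    find-event T? {u} {w} P p = go [] P refl refl p ([] , λ ())
      where
      go : ∀ Q R {v} → P ≡ Q ++ R → IsWalk u Q v → IsWalk v R w → Clear Q → Free P w ⊎ Event u P w
      go Q R {v} eq q r cl with mem? _≟ᵥ_ v (sources Q) | T? v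
      ... | yes h | _     = inj₂ (event eq q r cl (inj₁ h))
      ... | no _  | yes t = inj₂ (event eq q r cl (inj₂ t))
      go Q [] eq q refl cl | no v∉ | no ¬t with refl ← ≡.trans eq (++-identityʳ Q) = inj₁ (cl , v∉ , ¬t)
      go Q (f ∷ R) eq q (refl , r) (uq , nt) | no v∉ | no ¬t =
        go (Q ++ f ∷ []) R (≡.trans eq (≡.sym (++-assoc Q (f ∷ []) R))) (walk-++ Q q (refl , refl)) r
          ( ≡.subst Unique (≡.sym (map-++ src Q (f ∷ []))) (UniqueP.++⁺ uq ([] ∷ []) (λ { (h , here refl) → v∉ h }))
          , λ h k → case ∈-++⁻ (sources Q) (≡.subst (_ ∈ₗ_) (map-++ src Q (f ∷ [])) h) of λ
              { (inj₁ h′) → nt h′ k ; (inj₂ (here refl)) → ¬t k })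

    private
      not-earlier : ∀ {u v w} Q f S → IsWalk u Q v → IsWalk u (Q ++ f ∷ S) w → Clear (Q ++ f ∷ S) →
                    v ∈ₗ sources Q ⊎ T v → ⊥
      not-earlier Q f S q q′ (uq , nt) hit with walk-split Q q′
      ... | _ , q″ , (e , _) with refl ← walk-end Q q q″ = [ (λ h → dis (h , here (≡.sym e))) , nt v∈ ]′ hit
        where
        dis = proj₂ (proj₂ (Unique-++⁻ (sources Q) (≡.subst Unique (map-++ src Q (f ∷ S)) uq)))
        v∈ = ≡.subst (_ ∈ₗ_) (≡.sym (map-++ src Q (f ∷ S))) (∈-++⁺ʳ (sources Q) (here (≡.sym e)))

    -- Of two splittings at different places the earlier one would have its event inside the clear
    -- prefix of the later one.
    event-unique : ∀ {u P w} (E E′ : Event u P w) →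
      Event.before E ≡ Event.before E′ × Event.after E ≡ Event.after E′
    event-unique (event {Q} {R} e q r cl hit) (event {Q′} {R′} e′ q′ r′ cl′ hit′)
      with ++-compare Q Q′ (≡.trans (≡.sym e) e′)
    ... | inj₁ p                             = p
    ... | inj₂ (inj₁ (f , S , refl , _)) = ⊥-elim (not-earlier Q f S q q′ cl′ hit)
    ... | inj₂ (inj₂ (f , S , refl , _)) = ⊥-elim (not-earlier Q′ f S q′ q cl hit′)

    free-no-event : ∀ {u P w} → Free P w → ¬ Event u P w
    free-no-event ((uq , nt) , w∉ , ¬t) (event {Q} {[]} refl q refl cl hit) =
      [ (λ h → w∉ (≡.subst (_ ∈ₗ_) (≡.sym (map-++ src Q [])) (∈-++⁺ˡ h))) , ¬t ]′ hit
    free-no-event (cl , _) (event {Q} {f ∷ R} refl q r _ hit) = not-earlier Q f R q (walk-++ Q q r) cl hit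

-- Conservative flows as disjoint cycles.

module Flows {k n} (G : PlabicGraph k n) where
  open PlabicGraph G
  open Walks digraph

  in-degree₁-unique : ∀ {v} → indegree v ℕ.≤ 1 → ∀ {f g} → tgt f ≡ v → tgt g ≡ v → f ≡ g
  in-degree₁-unique {v} = count-unique (λ f → tgt f ≟ᵥ v)

  out-degree₁-unique : ∀ {v} → outdegree v ℕ.≤ 1 → ∀ {f g} → src f ≡ v → src g ≡ v → f ≡ g
  out-degree₁-unique {v} = count-unique (λ f → src f ≟ᵥ v)

  boundary-in≤1 : ∀ i → indegree (b i) ℕ.≤ 1
  boundary-in≤1 i = ≡.subst (indegree (b i) ℕ.≤_) (boundary-degree i) (ℕP.m≤m+n _ _)

  boundary-out≤1 : ∀ i → outdegree (b i) ℕ.≤ 1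
  boundary-out≤1 i = ≡.subst (outdegree (b i) ℕ.≤_) (boundary-degree i) (ℕP.m≤n+m _ _)

  no-transit : ∀ {i f g} → tgt f ≡ b i → src g ≡ b i → ⊥
  no-transit {i} {f} {g} e e′ = ℕP.<⇒≱ (≡.subst (1 ℕ.<_) (boundary-degree i)
    (ℕP.+-mono-≤ (count-positive (λ f → tgt f ≟ᵥ b i) e) (count-positive (λ f → src f ≟ᵥ b i) e′))) ℕP.≤-refl

  b-injective : ∀ {i j} → b i ≡ b j → i ≡ j
  b-injective refl = refl

  source-no-in : ∀ {i f} → i ∈ Columns.set I → tgt f ≢ b i
  source-no-in {i} i∈I e = no-transit e (proj₂ (count-witness (λ f → src f ≟ᵥ b i)
    (ℕP.≤-reflexive (≡.sym (Equivalence.to (boundary-source i) i∈I)))))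

  -- The way the colours enter. It makes balanced flows vertex-disjoint and allows turns to be
  -- exchanged where a loop is cut out of a walk. A boundary vertex behaves like a white one because
  -- its degree is one.
  fork : ∀ v → (∀ {f g} → tgt f ≡ v → tgt g ≡ v → f ≡ g) ⊎ (∀ {f g} → src f ≡ v → src g ≡ v → f ≡ g)
  fork (inj₁ i) = inj₁ (in-degree₁-unique (boundary-in≤1 i))
  fork (inj₂ v) with colour v in e
  ... | white = inj₁ (in-degree₁-unique (ℕP.≤-reflexive (white-vertex v e)))
  ... | black = inj₂ (out-degree₁-unique (ℕP.≤-reflexive (black-vertex v e)))

  arrives? : ∀ F v → Decidable (λ f → f ∈ F × tgt f ≡ v)
  arrives? F v f = f ∈? F ×-dec tgt f ≟ᵥ v

  leaves? : ∀ F v → Decidable (λ f → f ∈ F × src f ≡ v)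
  leaves? F v f = f ∈? F ×-dec src f ≟ᵥ v

  module _ {F : Subset #edges} {v : Vertex} (balance : inflow F v ≡ outflow F v) where

    private
      -- `fork` bounds one of the two counts, and the balance carries the bound to the other.
      both≤1 : inflow F v ℕ.≤ 1 × outflow F v ℕ.≤ 1
      both≤1 with fork v
      ... | inj₁ uin = let h = count≤1 (arrives? F v) (λ p q → uin (proj₂ p) (proj₂ q)) in h , ≡.subst (ℕ._≤ 1) balance h
      ... | inj₂ uout = let h = count≤1 (leaves? F v) (λ p q → uout (proj₂ p) (proj₂ q)) in ≡.subst (ℕ._≤ 1) (≡.sym balance) h , h

    balanced-in : ∀ {f g} → f ∈ F → g ∈ F → tgt f ≡ v → tgt g ≡ v → f ≡ g
    balanced-in f∈ g∈ e e′ = count-unique (arrives? F v) (proj₁ both≤1) (f∈ , e) (g∈ , e′)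

    balanced-out : ∀ {f g} → f ∈ F → g ∈ F → src f ≡ v → src g ≡ v → f ≡ g
    balanced-out f∈ g∈ e e′ = count-unique (leaves? F v) (proj₂ both≤1) (f∈ , e) (g∈ , e′)

    balanced-next : ∀ {f} → f ∈ F → tgt f ≡ v → ∃[ g ] g ∈ F × src g ≡ v
    balanced-next f∈ e = count-witness (leaves? F v) (≡.subst (1 ℕ.≤_) balance (count-positive (arrives? F v) (f∈ , e)))

    balanced-prev : ∀ {f} → f ∈ F → src f ≡ v → ∃[ g ] g ∈ F × tgt g ≡ v
    balanced-prev f∈ e = count-witness (arrives? F v) (≡.subst (1 ℕ.≤_) (≡.sym balance) (count-positive (leaves? F v) (f∈ , e)))

  -- A conservative flow as a union of vertex-disjoint cycles: one successor and one predecessor for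
  -- every edge. Its edges avoid the boundary because no boundary vertex can be passed through.
  record Circulation (C : Subset #edges) : Set where
    field
      out  : OutUnique C
      inn  : InUnique C
      next : ∀ {f} → f ∈ C → ∃[ g ] g ∈ C × src g ≡ tgt f
      prev : ∀ {f} → f ∈ C → ∃[ g ] g ∈ C × tgt g ≡ src f

    src-internal : ∀ {f i} → f ∈ C → src f ≢ b i
    src-internal f∈ e = let (g , _ , e′) = prev f∈ in no-transit (≡.trans e′ e) e

    tgt-internal : ∀ {f i} → f ∈ C → tgt f ≢ b i
    tgt-internal f∈ e = let (g , _ , e′) = next f∈ in no-transit e (≡.trans e′ e)

  conservative⇒circulation : ∀ {C} → IsConservativeFlow C → Circulation C
  conservative⇒circulation {C} (inner , balance) = record
    { out  = λ {f} f∈ g∈ e → case src-of f∈ of λ (v , p) → balanced-out (balance v) f∈ g∈ p (≡.trans (≡.sym e) p)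
    ; inn  = λ {f} f∈ g∈ e → case tgt-of f∈ of λ (v , p) → balanced-in (balance v) f∈ g∈ p (≡.trans (≡.sym e) p)
    ; next = λ {f} f∈ → case tgt-of f∈ of λ (v , p) → let (g , g∈ , e) = balanced-next (balance v) f∈ p in g , g∈ , ≡.trans e (≡.sym p)
    ; prev = λ {f} f∈ → case src-of f∈ of λ (v , p) → let (g , g∈ , e) = balanced-prev (balance v) f∈ p in g , g∈ , ≡.trans e (≡.sym p)
    }
    where
    src-of : ∀ {f} → f ∈ C → ∃[ v ] src f ≡ internal v
    src-of {f} f∈ with src f in e
    ... | inj₁ i = contradiction e (proj₁ (inner f f∈ i))
    ... | inj₂ v = v , refl
    tgt-of : ∀ {f} → f ∈ C → ∃[ v ] tgt f ≡ internal v
    tgt-of {f} f∈ with tgt f in e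
    ... | inj₁ i = contradiction e (proj₂ (inner f f∈ i))
    ... | inj₂ v = v , refl

  circulation⇒conservative : ∀ {C} → Circulation C → IsConservativeFlow C
  circulation⇒conservative {C} c =
    (λ f f∈ i → Circulation.src-internal c f∈ , Circulation.tgt-internal c f∈) ,
    (λ v → count-balance (arrives? C (internal v)) (leaves? C (internal v))
      (λ (f∈ , e) (g∈ , e′) → inn f∈ g∈ (≡.trans e (≡.sym e′)))
      (λ (f∈ , e) (g∈ , e′) → out f∈ g∈ (≡.trans e (≡.sym e′)))
      (λ (f∈ , e) → let (g , g∈ , e′) = next f∈ in g , g∈ , ≡.trans e′ e)
      (λ (f∈ , e) → let (g , g∈ , e′) = prev f∈ in g , g∈ , ≡.trans e′ e))
    where open Circulation c

  Touches : Subset #edges → Vertex → Set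
  Touches C v = ∃[ f ] f ∈ C × src f ≡ v

  touches? : ∀ C → Decidable (Touches C)
  touches? C v = FinP.any? (λ f → f ∈? C ×-dec src f ≟ᵥ v)

  -- The last component rules out the empty walk.
  IsCycle : Vertex → List Edge → Set
  IsCycle v γ = IsWalk v γ v × Unique (sources γ) × v ∈ₗ sources γ

  module _ {v γ} (cyc : IsCycle v γ) where
    private
      p = proj₁ cyc
      u = proj₁ (proj₂ cyc)

    cycle-next : ∀ {f} → f ∈ₗ γ → ∃[ g ] g ∈ₗ γ × src g ≡ tgt f
    cycle-next f∈ with walk-next γ p f∈
    ... | inj₁ h = source⁻ γ h
    ... | inj₂ refl = source⁻ γ (proj₂ (proj₂ cyc))

    cycle-prev : ∀ {f} → f ∈ₗ γ → ∃[ g ] g ∈ₗ γ × tgt g ≡ src f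
    cycle-prev f∈ with walk-prev γ p f∈
    ... | inj₂ h = h
    ... | inj₁ refl = walk-last γ p (λ { refl → case f∈ of λ () })

    cycle-out : ∀ {f g} → f ∈ₗ γ → g ∈ₗ γ → src f ≡ src g → f ≡ g
    cycle-out = unique-map-injective u

  cycle-in : ∀ {v γ} → IsCycle v γ → ∀ {f g} → f ∈ₗ γ → g ∈ₗ γ → tgt f ≡ tgt g → f ≡ g
  cycle-in {γ = f ∷ Q} (p@(e , _) , u@(_ ∷ uq) , _) =
    walk-tgt-injective f Q p uq (≡.subst (_∉ₗ sources Q) e (Unique[x∷xs]⇒x∉xs u))

  Avoids : Subset #edges → List Edge → Set
  Avoids C P = ∀ {v} → v ∈ₗ sources P → ¬ Touches C v

  disjoint-cycle : ∀ {C γ} → Avoids C γ → ∀ {f} → f ∈ₗ γ → f ∉ C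
  disjoint-cycle avoid f∈γ f∈C = avoid (∈-map⁺ src f∈γ) (_ , f∈C , refl)

  add-cycle : ∀ {C v γ} → Circulation C → IsCycle v γ → Avoids C γ → Circulation (C ∪ support γ)
  add-cycle {C} {v} {γ} c cyc avoid = record
    { out = λ f∈ g∈ e → case mem f∈ , mem g∈ of λ
        { (inj₁ h , inj₁ k) → Circulation.out c h k e
        ; (inj₁ h , inj₂ k) → ⊥-elim (avoid (source⁺ k (≡.sym e)) (_ , h , refl))
        ; (inj₂ h , inj₁ k) → ⊥-elim (avoid (source⁺ h e) (_ , k , refl))
        ; (inj₂ h , inj₂ k) → cycle-out cyc h k e }
    ; inn = λ f∈ g∈ e → case mem f∈ , mem g∈ of λ
        { (inj₁ h , inj₁ k) → Circulation.inn c h k e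
        ; (inj₁ h , inj₂ k) → ⊥-elim (meet h k e)
        ; (inj₂ h , inj₁ k) → ⊥-elim (meet k h (≡.sym e))
        ; (inj₂ h , inj₂ k) → cycle-in cyc h k e }
    ; next = λ f∈ → case mem f∈ of λ
        { (inj₁ h) → let (g , g∈ , e) = Circulation.next c h in g , x∈p∪q⁺ (inj₁ g∈) , e
        ; (inj₂ h) → let (g , g∈ , e) = cycle-next cyc h in g , x∈p∪q⁺ (inj₂ (∈-support⁺ g∈)) , e }
    ; prev = λ f∈ → case mem f∈ of λ
        { (inj₁ h) → let (g , g∈ , e) = Circulation.prev c h in g , x∈p∪q⁺ (inj₁ g∈) , e
        ; (inj₂ h) → let (g , g∈ , e) = cycle-prev cyc h in g , x∈p∪q⁺ (inj₂ (∈-support⁺ g∈)) , e }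
    }
    where
    mem : ∀ {f} → f ∈ C ∪ support γ → f ∈ C ⊎ f ∈ₗ γ
    mem h = Sum.map₂ ∈-support⁻ (x∈p∪q⁻ C (support γ) h)
    meet : ∀ {f g} → f ∈ C → g ∈ₗ γ → tgt f ≡ tgt g → ⊥
    meet h k e = let (f′ , f′∈ , e′) = Circulation.next c h
                     (g′ , g′∈ , e″) = cycle-next cyc k
                 in avoid (source⁺ g′∈ (≡.trans e″ (≡.trans (≡.sym e) (≡.sym e′)))) (f′ , f′∈ , refl)

  remove-cycle : ∀ {C v γ} → Circulation C → IsCycle v γ → (∀ {f} → f ∈ₗ γ → f ∈ C) → Circulation (C ─ support γ)
  remove-cycle {C} {v} {γ} c cyc γ⊆C = record
    { out = λ f∈ g∈ → Circulation.out c (proj₁ (mem f∈)) (proj₁ (mem g∈))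
    ; inn = λ f∈ g∈ → Circulation.inn c (proj₁ (mem f∈)) (proj₁ (mem g∈))
    ; next = λ f∈ → let (g , g∈ , e) = Circulation.next c (proj₁ (mem f∈)) in g , x∈p∧x∉q⇒x∈p─q g∈ (λ h →
        let (g′ , g′∈ , e′) = cycle-prev cyc (∈-support⁻ h) in
        proj₂ (mem f∈) (≡.subst (_∈ₗ γ) (Circulation.inn c (γ⊆C g′∈) (proj₁ (mem f∈)) (≡.trans e′ e)) g′∈)) , e
    ; prev = λ f∈ → let (g , g∈ , e) = Circulation.prev c (proj₁ (mem f∈)) in g , x∈p∧x∉q⇒x∈p─q g∈ (λ h →
        let (g′ , g′∈ , e′) = cycle-next cyc (∈-support⁻ h) in
        proj₂ (mem f∈) (≡.subst (_∈ₗ γ) (Circulation.out c (γ⊆C g′∈) (proj₁ (mem f∈)) (≡.trans e′ e)) g′∈)) , e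
    }
    where
    mem : ∀ {f} → f ∈ C ─ support γ → f ∈ C × f ∉ₗ γ
    mem h = let (p , q) = ∈-─⁻ C (support γ) h in p , (λ k → q (∈-support⁺ k))

  -- Tracing back from the edge that enters `v` until `v` is reached again.
  cycle-through : ∀ {C v} → Circulation C → Touches C v → ∃[ γ ] IsCycle v γ × (∀ {f} → f ∈ₗ γ → f ∈ C)
  cycle-through {C} {v} c (f , f∈C , e) with Circulation.prev c f∈C
  ... | g , g∈C , e′ = first ∷ rest ,
      (≡.subst (λ x → IsWalk x (first ∷ rest) v) stops walk , unique , here (≡.sym stops)) , ⊆F
    where
    open Trace (trace-back (_≟ᵥ v) (Circulation.out c) (λ h _ → Circulation.prev c h) (λ _ h → h) g∈C (≡.trans e′ e))

  cycle-determined : ∀ {C v γ γ′} → OutUnique C → IsCycle v γ → IsCycle v γ′ →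
    (∀ {f} → f ∈ₗ γ → f ∈ C) → (∀ {f} → f ∈ₗ γ′ → f ∈ C) → γ ≡ γ′
  cycle-determined {γ = f ∷ Q} {g ∷ R} out ((e , q) , u , _) ((e′ , r) , u′ , _) γ⊆ γ′⊆
    with refl ← out (γ⊆ (here refl)) (γ′⊆ (here refl)) (≡.trans e (≡.sym e′)) =
    ≡.cong (f ∷_) (walk-deterministic out Q R (γ⊆ ∘ there) (γ′⊆ ∘ there) q r
      (≡.subst (_∉ₗ sources R) e′ (Unique[x∷xs]⇒x∉xs u′)) (≡.subst (_∉ₗ sources Q) e (Unique[x∷xs]⇒x∉xs u)))

  -- Moving loops between a walk and a flow.

  Configuration : Set
  Configuration = Subset #edges × List Edge

  -- From x to y, the first loop of the walk is moved into the flow.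
  record Transfer (u w : Vertex) (x y : Configuration) : Set where
    constructor transfer
    field
      {P₀ γ R}  : List Edge
      {v}       : Vertex
      walk      : proj₂ x ≡ (P₀ ++ γ) ++ R
      shortened : proj₂ y ≡ P₀ ++ R
      start     : IsWalk u P₀ v
      cycle     : IsCycle v γ
      finish    : IsWalk v R w
      unique    : Unique (sources (P₀ ++ γ))
      avoids    : Avoids (proj₁ x) (P₀ ++ γ)
      flow      : proj₁ y ≡ proj₁ x ∪ support γ

  sources-++⁻ : ∀ {v} P Q → v ∈ₗ sources (P ++ Q) → v ∈ₗ sources P ⊎ v ∈ₗ sources Q
  sources-++⁻ P Q h = ∈-++⁻ (sources P) (≡.subst (_ ∈ₗ_) (map-++ src P Q) h)

  sources-++⁺ˡ : ∀ {v} P Q → v ∈ₗ sources P → v ∈ₗ sources (P ++ Q)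
  sources-++⁺ˡ P Q h = ≡.subst (_ ∈ₗ_) (≡.sym (map-++ src P Q)) (∈-++⁺ˡ h)

  sources-++⁺ʳ : ∀ {v} P Q → v ∈ₗ sources Q → v ∈ₗ sources (P ++ Q)
  sources-++⁺ʳ P Q h = ≡.subst (_ ∈ₗ_) (≡.sym (map-++ src P Q)) (∈-++⁺ʳ (sources P) h)

  module _ {u w : Vertex} {x y : Configuration} (t : Transfer u w x y) where
    open Transfer t
    private
      module Eˣ = Events (Touches (proj₁ x))
      module Eʸ = Events (Touches (proj₁ y))
      split = Unique-++⁻ (sources P₀) (≡.subst Unique (map-++ src P₀ γ) unique)

    P₀-avoids : ∀ {z} → z ∈ₗ sources P₀ → z ∉ₗ sources γ
    P₀-avoids h k = proj₂ (proj₂ split) (h , k)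

    -- In `x` the transfer takes place at the first event, a return of the walk; `touch-event` finds
    -- the same place in `y`, as the first meeting with the flow. Uniqueness of events then makes
    -- transfers functional, injective and acyclic.
    return-event : Eˣ.Event u (proj₂ x) w
    return-event = Eˣ.event walk (walk-++ P₀ start (proj₁ cycle)) finish (unique , avoids)
      (inj₁ (sources-++⁺ʳ P₀ γ (proj₂ (proj₂ cycle))))

    flow⁻ : ∀ {f} → f ∈ proj₁ y → f ∈ proj₁ x ⊎ f ∈ₗ γ
    flow⁻ {f} h = Sum.map₂ ∈-support⁻ (x∈p∪q⁻ (proj₁ x) (support γ) (≡.subst (f ∈_) flow h))

    flow⁺ˡ : ∀ {f} → f ∈ proj₁ x → f ∈ proj₁ y
    flow⁺ˡ {f} h = ≡.subst (f ∈_) (≡.sym flow) (x∈p∪q⁺ (inj₁ h))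

    flow⁺ʳ : ∀ {f} → f ∈ₗ γ → f ∈ proj₁ y
    flow⁺ʳ {f} h = ≡.subst (f ∈_) (≡.sym flow) (x∈p∪q⁺ (inj₂ (∈-support⁺ h)))

    cycle-avoids : Avoids (proj₁ x) γ
    cycle-avoids h = avoids (sources-++⁺ʳ P₀ γ h)

    flow-minus : proj₁ x ≡ proj₁ y ─ support γ
    flow-minus = subset-ext
      (λ h → x∈p∧x∉q⇒x∈p─q (flow⁺ˡ h) (λ k → disjoint-cycle cycle-avoids (∈-support⁻ k) h))
      (λ h → let (p , q) = ∈-─⁻ (proj₁ y) (support γ) h in [ id , (λ k → ⊥-elim (q (∈-support⁺ k))) ]′ (flow⁻ p))

    touch-event : Eʸ.Event u (proj₂ y) w
    touch-event = Eʸ.event shortened start finish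
      ( proj₁ split
      , λ h (f , f∈ , e) → case flow⁻ f∈ of λ
          { (inj₁ k) → avoids (sources-++⁺ˡ P₀ γ h) (f , k , e)
          ; (inj₂ k) → P₀-avoids h (source⁺ k e) })
      (inj₂ (let (f , f∈ , e) = source⁻ γ (proj₂ (proj₂ cycle)) in f , flow⁺ʳ f∈ , e))

  module _ {u w : Vertex} where

    private
      -- Both loops end at the place of the event and hence start there too. If one started later
      -- than the other, that vertex would lie on its initial part as well as on its loop.
      transfer-clash : ∀ {x y z} (s : Transfer u w x y) (t : Transfer u w x z) →
        Transfer.P₀ s ++ Transfer.γ s ≡ Transfer.P₀ t ++ Transfer.γ t →
        ∀ f S → Transfer.P₀ t ≡ Transfer.P₀ s ++ f ∷ S → Transfer.γ s ≡ f ∷ S ++ Transfer.γ t → ⊥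
      transfer-clash s t e f S refl refl = P₀-avoids t (sources-++⁺ʳ (Transfer.P₀ s) (f ∷ S) (here refl))
        (≡.subst (_∈ₗ sources (Transfer.γ t)) same (proj₂ (proj₂ (Transfer.cycle t))))
        where
        same : Transfer.v t ≡ src f
        same = ≡.trans (walk-end (Transfer.P₀ t ++ Transfer.γ t)
                 (walk-++ (Transfer.P₀ t) (Transfer.start t) (proj₁ (Transfer.cycle t)))
                 (≡.subst (λ Q → IsWalk u Q (Transfer.v s)) e (walk-++ (Transfer.P₀ s) (Transfer.start s) (proj₁ (Transfer.cycle s)))))
               (≡.sym (proj₁ (proj₁ (Transfer.cycle s))))

    transfer-functional : ∀ {x y z} → Transfer u w x y → Transfer u w x z → y ≡ z
    transfer-functional {x} s t
      with Events.event-unique (Touches (proj₁ x)) (return-event s) (return-event t)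
    ... | e , refl with ++-compare (Transfer.P₀ s) (Transfer.P₀ t) e
    ...   | inj₁ (refl , refl) = ≡.cong₂ _,_ (≡.trans (Transfer.flow s) (≡.sym (Transfer.flow t)))
                                             (≡.trans (Transfer.shortened s) (≡.sym (Transfer.shortened t)))
    ...   | inj₂ (inj₁ (f , S , e₁ , e₂)) = ⊥-elim (transfer-clash s t e f S e₁ e₂)
    ...   | inj₂ (inj₂ (f , S , e₁ , e₂)) = ⊥-elim (transfer-clash t s (≡.sym e) f S e₁ e₂)

    transfer-injective : ∀ {x y z} → Circulation (proj₁ z) → Transfer u w x z → Transfer u w y z → x ≡ y
    transfer-injective {C , P} {C′ , P′} {z} c s t
      with Events.event-unique (Touches (proj₁ z)) (touch-event s) (touch-event t)
    ... | refl , refl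
      with refl ← walk-end (Transfer.P₀ s) (Transfer.start s) (Transfer.start t)
      with cycle-determined (Circulation.out c) (Transfer.cycle s) (Transfer.cycle t) (flow⁺ʳ s) (flow⁺ʳ t)
    ... | refl = ≡.cong₂ _,_ (≡.trans (flow-minus s) (≡.sym (flow-minus t)))
                             (≡.trans (Transfer.walk s) (≡.sym (Transfer.walk t)))

    -- Both transfers happen at the first event of `x`. For `s` the place has been visited by the
    -- prefix; for `t` it lies on the loop already in the flow, which the prefix avoids.
    transfer-acyclic : ∀ {x y z} → Transfer u w x y → Transfer u w z x → ⊥
    transfer-acyclic {x} s t with Events.event-unique (Touches (proj₁ x)) (return-event s) (touch-event t)
    ... | e , _ = P₀-avoids t (≡.subst (λ Q → Transfer.v s ∈ₗ sources Q) e
                    (sources-++⁺ʳ (Transfer.P₀ s) (Transfer.γ s) (proj₂ (proj₂ (Transfer.cycle s)))))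
                  (≡.subst (_∈ₗ sources (Transfer.γ t)) same (proj₂ (proj₂ (Transfer.cycle t))))
      where
      same : Transfer.v t ≡ Transfer.v s
      same = walk-end (Transfer.P₀ t) (Transfer.start t)
        (≡.subst (λ Q → IsWalk u Q (Transfer.v s)) e (walk-++ (Transfer.P₀ s) (Transfer.start s) (proj₁ (Transfer.cycle s))))

    Reduced : Configuration → Set
    Reduced (C , P) = Events.Free (Touches C) P w

    -- The kind of the first event decides the direction: a return moves a loop out of the walk, a
    -- meeting with the flow moves a cycle into it. A vertex returned to is known to be off the
    -- flow, so the kinds exclude each other.
    transfer-total : ∀ {C P} → Circulation C → IsWalk u P w →
      Reduced (C , P) ⊎ (∃[ y ] Transfer u w (C , P) y) ⊎ (∃[ y ] Transfer u w y (C , P))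
    transfer-total {C} {P} c p with Events.find-event (Touches C) (touches? C) P p
    ... | inj₁ free = inj₁ free
    ... | inj₂ (Events.event {Q} {R} {v} refl q r (uq , av) (inj₁ h)) with source-split Q q h
    ...   | P₀ , f , S , refl , p₀ , cyc = inj₂ (inj₁ ((C ∪ support (f ∷ S) , P₀ ++ R) ,
      transfer refl refl p₀ (cyc , proj₁ (proj₂ (Unique-++⁻ (sources P₀) (≡.subst Unique (map-++ src P₀ (f ∷ S)) uq))) , here (≡.sym (proj₁ cyc)))
        r uq av refl))
    transfer-total {C} {P} c p | inj₂ (Events.event {Q} {R} {v} refl q r (uq , av) (inj₂ touch)) with cycle-through c touch
    ...   | γ , cyc , γ⊆C = inj₂ (inj₂ ((C ─ support γ , (Q ++ γ) ++ R) ,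
      transfer refl refl q cyc r
        (≡.subst Unique (≡.sym (map-++ src Q γ)) (UniqueP.++⁺ uq (proj₁ (proj₂ cyc))
          (λ (h , k) → let (f , f∈ , e) = source⁻ γ k in av h (f , γ⊆C f∈ , e))))
        (λ h (f , f∈ , e) → let (f∈C , f∉γ) = ∈-─⁻ C (support γ) f∈ in case sources-++⁻ Q γ h of λ
          { (inj₁ k) → av k (f , f∈C , e)
          ; (inj₂ k) → let (g , g∈ , e′) = source⁻ γ k in
              f∉γ (∈-support⁺ (≡.subst (_∈ₗ γ) (Circulation.out c (γ⊆C g∈) f∈C (≡.trans e′ (≡.sym e))) g∈)) })
        (subset-ext (λ {f} h → case f ∈ₗ? γ of λ
            { (yes k) → x∈p∪q⁺ (inj₂ (∈-support⁺ k))
            ; (no ¬k) → x∈p∪q⁺ (inj₁ (x∈p∧x∉q⇒x∈p─q h (¬k ∘ ∈-support⁻))) })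
          (λ h → [ (λ k → proj₁ (∈-─⁻ C (support γ) k)) , (λ k → γ⊆C (∈-support⁻ k)) ]′ (x∈p∪q⁻ (C ─ support γ) (support γ) h)))))

    reduced-no-transfer : ∀ {x y} → Reduced x → ¬ (Transfer u w x y ⊎ Transfer u w y x)
    reduced-no-transfer {x} free (inj₁ t) = Events.free-no-event (Touches (proj₁ x)) free (return-event t)
    reduced-no-transfer {x} free (inj₂ t) = Events.free-no-event (Touches (proj₁ x)) free (touch-event t)

    transfer-walk : ∀ {x y} → Transfer u w x y → IsWalk u (proj₂ x) w × IsWalk u (proj₂ y) w
    transfer-walk (transfer {P₀} {γ} {R} refl refl p c r _ _ _) =
      walk-++ (P₀ ++ γ) (walk-++ P₀ p (proj₁ c)) r , walk-++ P₀ p r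

    transfer-circulation⁺ : ∀ {x y} → Transfer u w x y → Circulation (proj₁ x) → Circulation (proj₁ y)
    transfer-circulation⁺ t c = ≡.subst Circulation (≡.sym (Transfer.flow t)) (add-cycle c (Transfer.cycle t) (cycle-avoids t))

    transfer-circulation⁻ : ∀ {x y} → Transfer u w x y → Circulation (proj₁ y) → Circulation (proj₁ x)
    transfer-circulation⁻ t c = ≡.subst Circulation (≡.sym (flow-minus t)) (remove-cycle c (Transfer.cycle t) (flow⁺ʳ t))

    transfer-loops : ∀ {x y} → Transfer u w x y → loopsErased u (proj₂ x) ≡ suc (loopsErased u (proj₂ y))
    transfer-loops (transfer {γ = []} _ _ _ (_ , _ , ()) _ _ _ _)
    transfer-loops (transfer {P₀} {f ∷ Q} {R} refl refl p (c , _ , _) _ uq _ _) = ≡.trans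
      (≡.cong (loopsErased u) (++-assoc P₀ (f ∷ Q) R)) (loopsErased-cycle P₀ f Q R p c uq)

  -- Edge flows at a boundary source and their decomposition.

  module SourceFlows {i j : Fin n} (i≢j : i ≢ j) {e : Edge} (e-src : src e ≡ b i) where

    leaving-source : ∀ {f} → src f ≡ b i → f ≡ e
    leaving-source h = out-degree₁-unique (boundary-out≤1 i) h e-src

    walk-nonempty : ∀ P → IsWalk (b i) P (b j) → P ≢ []
    walk-nonempty [] refl refl = i≢j refl

    walk-from-source : ∀ P → IsWalk (b i) P (b j) → head P ≡ just e
    walk-from-source []      refl    = contradiction refl i≢j
    walk-from-source (f ∷ P) (h , _) = ≡.cong just (leaving-source h)

    walk⇔path : ∀ P → IsWalk (b i) P (b j) ⇔ IsPathFrom e j P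
    walk⇔path P = mk⇔ (λ p → walk-from-source P p , ≡.subst (λ v → IsWalk v P (b j)) (≡.sym e-src) p)
                      (λ (_ , p) → ≡.subst (λ v → IsWalk v P (b j)) e-src p)

    e∈walk : ∀ P → IsWalk (b i) P (b j) → e ∈ₗ P
    e∈walk P p with P | walk-from-source P p
    ... | _ ∷ _ | refl = here refl

    sink-fresh : ∀ P → IsWalk (b i) P (b j) → b j ∉ₗ sources P
    sink-fresh P p h = let (f , _ , e₁) = source⁻ P h
                           (g , _ , e₂) = walk-last P p (walk-nonempty P p)
                       in no-transit e₂ e₁

    walk-source-inner : ∀ P → IsWalk (b i) P (b j) → ∀ {f l} → f ∈ₗ P → src f ≡ b l → f ≡ e
    walk-source-inner P p f∈ h with walk-prev P p f∈
    ... | inj₁ h′           = leaving-source h′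
    ... | inj₂ (g , _ , h′) = ⊥-elim (no-transit (≡.trans h′ h) h)

    module _ {F} (flow : IsEdgeFlow e F) where
      private
        e∈F = proj₁ flow
        boundary-only = proj₂ (proj₂ (proj₂ flow))

        balanced : ∀ v → inflow F (internal v) ≡ outflow F (internal v)
        balanced v = proj₁ (proj₂ flow) v (λ h → case ≡.trans h e-src of λ ())

      flow-out : OutUnique F
      flow-out {f} {g} f∈ g∈ h with src f in h′
      ... | inj₂ v = balanced-out (balanced v) f∈ g∈ h′ (≡.sym h)
      ... | inj₁ l = ≡.trans (boundary-only f f∈ l h′) (≡.sym (boundary-only g g∈ l (≡.sym h)))

      flow-in : InUnique F
      flow-in {f} {g} f∈ g∈ h with tgt f in h′
      ... | inj₂ v = balanced-in (balanced v) f∈ g∈ h′ (≡.sym h)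
      ... | inj₁ l = in-degree₁-unique (boundary-in≤1 l) h′ (≡.sym h)

      flow-next : ∀ {f} → f ∈ F → (∀ l → tgt f ≢ b l) → ∃[ g ] g ∈ F × src g ≡ tgt f
      flow-next {f} f∈ inner with tgt f in h
      ... | inj₂ v = balanced-next (balanced v) f∈ h
      ... | inj₁ l = contradiction refl (inner l)

      flow-prev : ∀ {f} → f ∈ F → src f ≢ b i → ∃[ g ] g ∈ F × tgt g ≡ src f
      flow-prev {f} f∈ h with src f in h′
      ... | inj₂ v = balanced-prev (balanced v) f∈ h′
      ... | inj₁ l = contradiction (≡.trans (≡.sym h′) (≡.trans (≡.cong src (boundary-only f f∈ l h′)) e-src)) h

      private
        path-to : ∀ {f l} → f ∈ F → tgt f ≡ b l →
                  ∃[ P ] IsWalk (b i) P (b l) × (∀ {g} → g ∈ₗ P → g ∈ F) × f ∈ₗ P × Unique (sources P)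
        path-to {f} {l} f∈ h = first ∷ rest , ≡.subst (λ v → IsWalk v (first ∷ rest) (b l)) stops walk , ⊆F , f₀∈ , unique
          where
          open Trace (trace-back {Stop = _≡ b i} (_≟ᵥ b i) flow-out flow-prev
                       (λ _ h′ → ⊥-elim (no-transit h h′)) f∈ h)

      -- The flow is followed backwards from its edge at the sink; it can only stop at `b i`. What
      -- remains has a successor and a predecessor for each edge.
      flow-path : (∃[ f ] f ∈ F × tgt f ≡ b j) →
        ∃[ P ] IsWalk (b i) P (b j) × (∀ {f} → f ∈ₗ P → f ∈ F) × Unique (sources P) × Circulation (F ─ support P)
      flow-path (f₀ , f₀∈F , f₀-tgt) with path-to f₀∈F f₀-tgt
      ... | P , p , P⊆ , f₀∈P , uq = P , p , P⊆ , uq , record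
        { out  = λ f∈ g∈ → flow-out (proj₁ (mem f∈)) (proj₁ (mem g∈))
        ; inn  = λ f∈ g∈ → flow-in (proj₁ (mem f∈)) (proj₁ (mem g∈))
        ; next = λ {f} f∈ → let (g , g∈ , h) = flow-next (proj₁ (mem f∈)) (inner f∈) in
            g , x∈p∧x∉q⇒x∈p─q g∈ (λ k → case walk-prev P p (∈-support⁻ k) of λ
              { (inj₁ h′) → inner f∈ i (≡.trans (≡.sym h) h′)
              ; (inj₂ (g′ , g′∈ , h′)) → proj₂ (mem f∈) (≡.subst (_∈ₗ P) (flow-in (P⊆ g′∈) (proj₁ (mem f∈)) (≡.trans h′ h)) g′∈) }) , h
        ; prev = λ {f} f∈ →
            let (g , g∈ , h) = flow-prev (proj₁ (mem f∈)) (λ h → proj₂ (mem f∈) (≡.subst (_∈ₗ P) (≡.sym (leaving-source h)) (e∈walk P p))) in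
            g , x∈p∧x∉q⇒x∈p─q g∈ (λ k → case walk-next P p (∈-support⁻ k) of λ
              { (inj₂ h′) → no-transit h′ (≡.trans (≡.sym h) h′)
              ; (inj₁ h′) → let (g′ , g′∈ , h″) = source⁻ P h′ in
                  proj₂ (mem f∈) (≡.subst (_∈ₗ P) (flow-out (P⊆ g′∈) (proj₁ (mem f∈)) (≡.trans h″ h)) g′∈) }) , h
        }
        where
        mem : ∀ {f} → f ∈ F ─ support P → f ∈ F × f ∉ₗ P
        mem h = let (p , q) = ∈-─⁻ F (support P) h in p , (λ k → q (∈-support⁺ k))
        -- An edge of the remainder entering a sink would also trace back to `b i`. Only one walk in
        -- the flow leaves `b i`, so the edge would lie on `P`.
        inner : ∀ {f} → f ∈ F ─ support P → ∀ l → tgt f ≢ b l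
        inner f∈ l h with path-to (proj₁ (mem f∈)) h
        ... | Q , q , Q⊆ , f∈Q , _ with walk-last P p (walk-nonempty P p)
        ...   | g , _ , g-tgt with walk-deterministic flow-out P Q P⊆ Q⊆ p q
                  (λ k → no-transit g-tgt (proj₂ (proj₂ (source⁻ Q k))))
                  (λ k → no-transit h (proj₂ (proj₂ (source⁻ P k))))
        ...     | refl = proj₂ (mem f∈) f∈Q

    path-flow : ∀ {C P} → Circulation C → IsWalk (b i) P (b j) → Reduced {u = b i} {w = b j} (C , P) → ℱ e j (C ∪ support P)
    path-flow {C} {P} c p ((uq , av) , w∉ , ¬tw) =
      ( x∈p∪q⁺ (inj₂ (∈-support⁺ (e∈walk P p)))
      , (λ v _ → balance v)
      , ≡.trans (≡.cong suc no-in) (≡.sym one-out)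
      , λ f f∈ l h → case mem f∈ of λ
          { (inj₁ k) → ⊥-elim (Circulation.src-internal c k h)
          ; (inj₂ k) → walk-source-inner P p k h })
      , (let (f , f∈ , h) = walk-last P p (walk-nonempty P p) in f , x∈p∪q⁺ (inj₂ (∈-support⁺ f∈)) , h)
      where
      F = C ∪ support P
      mem : ∀ {f} → f ∈ F → f ∈ C ⊎ f ∈ₗ P
      mem h = Sum.map₂ ∈-support⁻ (x∈p∪q⁻ C (support P) h)
      no-in : inflow F (src e) ≡ 0
      no-in = count≡0 (arrives? F (src e)) (λ (_ , h) → no-transit (≡.trans h e-src) e-src)
      one-out : outflow F (src e) ≡ 1
      one-out = ℕP.≤-antisym
        (count≤1 (leaves? F (src e)) (λ (_ , h) (_ , h′) → ≡.trans (leaving-source (≡.trans h e-src)) (≡.sym (leaving-source (≡.trans h′ e-src)))))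
        (count-positive (leaves? F (src e)) (x∈p∪q⁺ (inj₂ (∈-support⁺ (e∈walk P p))) , refl))
      no-meet : ∀ {f g} → f ∈ C → g ∈ₗ P → tgt f ≢ tgt g
      no-meet {f} {g} f∈ g∈ h with Circulation.next c f∈ | walk-next P p g∈
      ... | f′ , f′∈ , h′ | inj₁ k = av k (f′ , f′∈ , ≡.trans h′ h)
      ... | f′ , f′∈ , h′ | inj₂ k = ¬tw (f′ , f′∈ , ≡.trans h′ (≡.trans h k))
      tgt-injective : ∀ P → IsWalk (b i) P (b j) → Unique (sources P) → b j ∉ₗ sources P →
                      ∀ {f g} → f ∈ₗ P → g ∈ₗ P → tgt f ≡ tgt g → f ≡ g
      tgt-injective (f ∷ Q) p (_ ∷ uq) w∉ = walk-tgt-injective f Q p uq (w∉ ∘ there)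
      balance : ∀ v → inflow F (internal v) ≡ outflow F (internal v)
      balance v = count-balance (arrives? F (internal v)) (leaves? F (internal v))
        (λ (f∈ , h) (g∈ , h′) → case mem f∈ , mem g∈ of λ
          { (inj₁ k , inj₁ l) → Circulation.inn c k l (≡.trans h (≡.sym h′))
          ; (inj₁ k , inj₂ l) → contradiction (≡.trans h (≡.sym h′)) (no-meet k l)
          ; (inj₂ k , inj₁ l) → contradiction (≡.trans h′ (≡.sym h)) (no-meet l k)
          ; (inj₂ k , inj₂ l) → tgt-injective P p uq w∉ k l (≡.trans h (≡.sym h′)) })
        (λ (f∈ , h) (g∈ , h′) → case mem f∈ , mem g∈ of λ
          { (inj₁ k , inj₁ l) → Circulation.out c k l (≡.trans h (≡.sym h′))
          ; (inj₁ k , inj₂ l) → ⊥-elim (av (source⁺ l h′) (_ , k , h))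
          ; (inj₂ k , inj₁ l) → ⊥-elim (av (source⁺ k h) (_ , l , h′))
          ; (inj₂ k , inj₂ l) → unique-map-injective uq k l (≡.trans h (≡.sym h′)) })
        (λ (f∈ , h) → case mem f∈ of λ
          { (inj₁ k) → let (g , g∈ , h′) = Circulation.next c k in g , (x∈p∪q⁺ (inj₁ g∈) , ≡.trans h′ h)
          ; (inj₂ k) → case walk-next P p k of λ
              { (inj₁ l) → let (g , g∈ , h′) = source⁻ P l in g , (x∈p∪q⁺ (inj₂ (∈-support⁺ g∈)) , ≡.trans h′ h)
              ; (inj₂ l) → case ≡.trans (≡.sym h) l of λ () } })
        (λ (f∈ , h) → case mem f∈ of λ
          { (inj₁ k) → let (g , g∈ , h′) = Circulation.prev c k in g , (x∈p∪q⁺ (inj₁ g∈) , ≡.trans h′ h)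
          ; (inj₂ k) → case walk-prev P p k of λ
              { (inj₂ (g , g∈ , h′)) → g , (x∈p∪q⁺ (inj₂ (∈-support⁺ g∈)) , ≡.trans h′ h)
              ; (inj₁ l) → case ≡.trans (≡.sym l) h of λ () } })

    record Decomposition (F : Subset #edges) : Set where
      field
        C           : Subset #edges
        P           : List Edge
        circulation : Circulation C
        walk        : IsWalk (b i) P (b j)
        reduced     : Reduced {u = b i} {w = b j} (C , P)
        union       : F ≡ C ∪ support P

      disjoint : ∀ {f} → f ∈ₗ P → f ∉ C
      disjoint = disjoint-cycle (proj₂ (proj₁ reduced))

      C⊆F : ∀ {f} → f ∈ C → f ∈ F
      C⊆F {f} h = ≡.subst (f ∈_) (≡.sym union) (x∈p∪q⁺ (inj₁ h))

      P⊆F : ∀ {f} → f ∈ₗ P → f ∈ F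
      P⊆F {f} h = ≡.subst (f ∈_) (≡.sym union) (x∈p∪q⁺ (inj₂ (∈-support⁺ h)))

      F⁻ : ∀ {f} → f ∈ F → f ∈ C ⊎ f ∈ₗ P
      F⁻ {f} h = Sum.map₂ ∈-support⁻ (x∈p∪q⁻ C (support P) (≡.subst (f ∈_) union h))

      difference : C ≡ F ─ support P
      difference = subset-ext
        (λ h → x∈p∧x∉q⇒x∈p─q (C⊆F h) (λ k → disjoint (∈-support⁻ k) h))
        (λ h → let (p , q) = ∈-─⁻ F (support P) h in [ id , (λ k → ⊥-elim (q (∈-support⁺ k))) ]′ (F⁻ p))

      isFlow : ℱ e j F
      isFlow = ≡.subst (ℱ e j) (≡.sym union) (path-flow circulation walk reduced)

      isPathOf : IsPathOf e j F P
      isPathOf = Equivalence.to (walk⇔path P) walk , UniqueP.map⁻ (proj₁ (proj₁ reduced)) ,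
        C , circulation⇒conservative circulation ,
        (λ f → mk⇔ (λ h → Sum.swap (F⁻ h)) [ P⊆F , C⊆F ]′) ,
        (λ f (h , k) → disjoint h k)

    split-flow : ∀ {F P} → IsEdgeFlow e F → IsWalk (b i) P (b j) → (∀ {f} → f ∈ₗ P → f ∈ F) → Unique (sources P) →
                 Circulation (F ─ support P) → Decomposition F
    split-flow {F} {P} flow p P⊆ uq c = record
      { C = F ─ support P ; P = P ; circulation = c ; walk = p
      ; reduced = (uq , avoids) , sink-fresh P p , no-touch
      ; union = subset-ext into from }
      where
      avoids : Avoids (F ─ support P) P
      avoids h (f , f∈ , k) with source⁻ P h | ∈-─⁻ F (support P) f∈
      ... | g , g∈ , k′ | f∈F , f∉P =
        f∉P (∈-support⁺ (≡.subst (_∈ₗ P) (flow-out flow (P⊆ g∈) f∈F (≡.trans k′ (≡.sym k))) g∈))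
      no-touch : ¬ Touches (F ─ support P) (b j)
      no-touch (f , f∈ , k) = Circulation.src-internal c f∈ k
      into : ∀ {f} → f ∈ F → f ∈ (F ─ support P) ∪ support P
      into {f} h with f ∈ₗ? P
      ... | yes k = x∈p∪q⁺ (inj₂ (∈-support⁺ k))
      ... | no ¬k = x∈p∪q⁺ (inj₁ (x∈p∧x∉q⇒x∈p─q h (¬k ∘ ∈-support⁻)))
      from : ∀ {f} → f ∈ (F ─ support P) ∪ support P → f ∈ F
      from h = [ (λ k → proj₁ (∈-─⁻ F (support P) k)) , (λ k → P⊆ (∈-support⁻ k)) ]′ (x∈p∪q⁻ (F ─ support P) (support P) h)

    decompose : ∀ {F} → ℱ e j F → Decomposition F
    decompose (flow , sink) = let (P , p , P⊆ , uq , c) = flow-path flow sink in split-flow flow p P⊆ uq c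

    -- One edge of the flow leaves each vertex, so the start determines the path, and the
    -- conservative part is its complement.
    decomposition-unique : ∀ {F} (D D′ : Decomposition F) →
      Decomposition.C D ≡ Decomposition.C D′ × Decomposition.P D ≡ Decomposition.P D′
    decomposition-unique {F} D D′ = ≡.trans D.difference (≡.trans (≡.cong (λ P → F ─ support P) P≡P′) (≡.sym D′.difference)) , P≡P′
      where
      module D = Decomposition D
      module D′ = Decomposition D′
      P≡P′ : D.P ≡ D′.P
      P≡P′ = walk-deterministic (flow-out (proj₁ D.isFlow)) D.P D′.P D.P⊆F D′.P⊆F D.walk D′.walk
        (sink-fresh D′.P D′.walk) (sink-fresh D.P D.walk)

    -- `IsPathOf` asks for distinct edges only; inside a flow, with one edge out of each vertex,
    -- distinct edges have distinct sources.
    pathOf-simple : ∀ {F P} → ℱ e j F → IsPathOf e j F P → IsWalk (b i) P (b j) × Unique (sources P) × b j ∉ₗ sources P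
    pathOf-simple {F} {P} (flow , _) (path , uq , C , _ , mem , _) =
      p , unique-sources uq (λ {f} h → Equivalence.from (mem f) (inj₁ h)) , sink-fresh P p
      where
      p = Equivalence.from (walk⇔path P) path
      unique-sources : ∀ {P} → Unique P → (∀ {f} → f ∈ₗ P → f ∈ F) → Unique (sources P)
      unique-sources []       _  = []
      unique-sources {f ∷ P} u@(_ ∷ uq) P⊆ = AllP.¬Any⇒All¬ _ (λ h → let (g , g∈ , k) = source⁻ P h in
        Unique[x∷xs]⇒x∉xs u (≡.subst (_∈ₗ P) (flow-out flow (P⊆ (there g∈)) (P⊆ (here refl)) k) g∈))
        ∷ unique-sources uq (P⊆ ∘ there)

-- The drawing in coordinates adapted to the gauge.

module NetworkGeometry {c ℓ₁ ℓ₂ : Level} (K : OrderedField c ℓ₁ ℓ₂) {k n : ℕ} (N : Plabic.PlabicNetwork K k n)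
  (𝔩 : Plabic.Point K) (gauge : Plabic.PlabicNetwork.IsGaugeRay N 𝔩) where
  open OrderedField K hiding (zero; refl) renaming (_-_ to _∸_)
  open Plabic K hiding (PlabicNetwork)
  open Plabic.PlabicNetwork N
  open IsGaugeRay gauge
  open Gauge 𝔩
  open IntegerSolver K
  open FieldOrder K
  open PlaneGeometry K
  open Walks digraph
  open Flows graph

  sgn-neg : ∀ u v → sgn u v ≡ -1ℤ → cross u v < 0#
  sgn-neg u v e with compare 0# (cross u v)
  ... | tri> _ _ h = h

  sgn-zero : ∀ u v → cross u v ≈ 0# → sgn u v ≡ 0ℤ
  sgn-zero u v e with compare 0# (cross u v)
  ... | tri< h _ _ = contradiction e (<⇒≉0 h)
  ... | tri≈ _ _ _ = refl
  ... | tri> _ h _ = contradiction (sym e) h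

  -- Components along the boundary and along the gauge direction, up to the factor `scale` and a
  -- sign in `X`. Passing to them multiplies `cross` by `scale`, which is positive, so orientations
  -- persist. The boundary becomes a horizontal line, run through from right to left, with the
  -- network above it.
  X Y : Point → Carrier
  X u = cross u 𝔩
  Y u = cross u direction

  -- In these coordinates the gauge ray points upwards.
  coordinates : Point → Point
  coordinates u = X u , Y u

  scale : Carrier
  scale = Y 𝔩

  scale-pos : 0# < scale
  scale-pos = <-resp ref (cross-flip direction 𝔩) (neg⇒0<- (sgn-neg direction 𝔩 points-inside))

  scale≉0 : ¬ scale ≈ 0#
  scale≉0 = <⇒≉0 scale-pos

  cramer : ∀ u → X u ≈ 0# → scale · u ≈ₚ Y u · 𝔩
  cramer (u₁ , u₂) e = step u₁ (proj₁ 𝔩) (proj₁ direction)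
      (solve 6 (λ u₁ u₂ l₁ l₂ d₁ d₂ → (l₁ :* d₂ :- l₂ :* d₁) :* u₁ := (u₁ :* d₂ :- u₂ :* d₁) :* l₁ :- (u₁ :* l₂ :- u₂ :* l₁) :* d₁) ref u₁ u₂ _ _ _ _)
    , step u₂ (proj₂ 𝔩) (proj₂ direction)
      (solve 6 (λ u₁ u₂ l₁ l₂ d₁ d₂ → (l₁ :* d₂ :- l₂ :* d₁) :* u₂ := (u₁ :* d₂ :- u₂ :* d₁) :* l₂ :- (u₁ :* l₂ :- u₂ :* l₁) :* d₂) ref u₁ u₂ _ _ _ _)
    where
    u = u₁ , u₂
    step : ∀ a l d → scale * a ≈ Y u * l ∸ X u * d → scale * a ≈ Y u * l
    step a l d h = trans h (trans (+-congˡ (-‿cong (trans (*-congʳ e) (zeroˡ d))))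
      (solve 1 (λ x → x :- con 0ℤ := x) ref (Y u * l)))

  coordinates-zero : ∀ u → X u ≈ 0# → Y u ≈ 0# → u ≈ₚ 0ₚ
  coordinates-zero u e f = let (p , q) = cramer u e in
    *-zero-cancel scale≉0 (trans p (trans (*-congʳ f) (zeroˡ _))) , *-zero-cancel scale≉0 (trans q (trans (*-congʳ f) (zeroˡ _)))

  cross-cong₁ : ∀ {u v w} → u ≈ₚ v → cross u w ≈ cross v w
  cross-cong₁ (p , q) = +-cong (*-congʳ p) (-‿cong (*-congʳ q))

  cross-∸ : ∀ u v w → cross (u -ₚ v) w ≈ cross u w ∸ cross v w
  cross-∸ (u₁ , u₂) (v₁ , v₂) (w₁ , w₂) = solve 6 (λ u₁ u₂ v₁ v₂ w₁ w₂ →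
    (u₁ :- v₁) :* w₂ :- (u₂ :- v₂) :* w₁ := (u₁ :* w₂ :- u₂ :* w₁) :- (v₁ :* w₂ :- v₂ :* w₁)) ref u₁ u₂ v₁ v₂ w₁ w₂

  cross-+ : ∀ u v w → cross (u +ₚ v) w ≈ cross u w + cross v w
  cross-+ (u₁ , u₂) (v₁ , v₂) (w₁ , w₂) = solve 6 (λ u₁ u₂ v₁ v₂ w₁ w₂ →
    (u₁ :+ v₁) :* w₂ :- (u₂ :+ v₂) :* w₁ := (u₁ :* w₂ :- u₂ :* w₁) :+ (v₁ :* w₂ :- v₂ :* w₁)) ref u₁ u₂ v₁ v₂ w₁ w₂

  cross-· : ∀ a v w → cross (a · v) w ≈ a * cross v w
  cross-· a (v₁ , v₂) (w₁ , w₂) = solve 5 (λ a v₁ v₂ w₁ w₂ →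
    (a :* v₁) :* w₂ :- (a :* v₂) :* w₁ := a :* (v₁ :* w₂ :- v₂ :* w₁)) ref a v₁ v₂ w₁ w₂

  cross-self : ∀ u → cross u u ≈ 0#
  cross-self (u₁ , u₂) = solve 2 (λ u₁ u₂ → u₁ :* u₂ :- u₂ :* u₁ := con 0ℤ) ref u₁ u₂

  pt : Vertex → Point
  pt v = coordinates (position v)

  Yₗ : Carrier
  Yₗ = Y origin

  Y-boundary : ∀ i → Y (position (b i)) ≈ Yₗ
  Y-boundary i = trans (cross-cong₁ (on-line i)) (trans (cross-+ _ _ _)
    (trans (+-congˡ (trans (cross-· _ _ _) (trans (*-congˡ (cross-self direction)) (zeroʳ _)))) (+-identityʳ _)))

  Y-internal : ∀ v → Yₗ < Y (position (internal v))
  Y-internal v = 0<∸⇒< (<-resp ref (trans (cross-flip direction _) (cross-∸ _ origin direction)) (neg⇒0<- (sgn-neg _ _ (inside-disk v))))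

  Y-above : ∀ v → Yₗ ≤ Y (position v)
  Y-above (inj₁ i) = inj₂ (sym (Y-boundary i))
  Y-above (inj₂ v) = inj₁ (Y-internal v)

  X-boundary : ∀ i → X (position (b i)) ≈ X origin + parameter i * X direction
  X-boundary i = trans (cross-cong₁ (on-line i)) (trans (cross-+ _ _ _) (+-congˡ (cross-· _ _ _)))

  X-decreasing : ∀ {i j} → i Fin.< j → X (position (b j)) < X (position (b i))
  X-decreasing {i} {j} i<j = 0<∸⇒< (<-resp ref
    (trans (solve 4 (λ o p q x → (q :- p) :* (:- x) := (o :+ p :* x) :- (o :+ q :* x)) ref (X origin) (parameter i) (parameter j) (X direction))
      (+-cong (sym (X-boundary i)) (-‿cong (sym (X-boundary j)))))
    (*-pos (<⇒0<∸ (clockwise i<j)) (neg⇒0<- (sgn-neg direction 𝔩 points-inside))))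

  -- Boundary vertices have distinct parameters. An internal vertex on the vertical through `b i`
  -- lies above the boundary, hence on the ray itself, against genericity.
  X-distinct : ∀ {u} i → u ≢ b i → ¬ X (position u) ∸ X (position (b i)) ≈ 0#
  X-distinct {inj₁ j} i j≢i e with FinP.<-cmp i j
  ... | tri< i<j _ _ = <⇒≉0 (<⇒0<∸ (X-decreasing i<j)) (trans (solve 2 (λ x y → x :- y := :- (y :- x)) ref _ _) (trans (-‿cong e) -0≈0))
  ... | tri≈ _ i≡j _ = j≢i (≡.cong b (≡.sym i≡j))
  ... | tri> _ _ j<i = <⇒≉0 (<⇒0<∸ (X-decreasing j<i)) e
  X-distinct {inj₂ v} i _ e = generic i v t (inj₁ (*-pos Y-pos inv-pos)) (at (proj₁ h) , at (proj₂ h))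
    where
    p = position (internal v)
    o = position (b i)
    u = p -ₚ o
    D⁻¹ = proj₁ (invertible scale≉0)
    inv = proj₂ (invertible scale≉0)
    inv-pos = inverse-pos scale-pos inv
    t = Y u * D⁻¹
    Y-pos : 0# < Y u
    Y-pos = <-resp ref (sym (cross-∸ p o direction)) (<⇒0<∸ (<-resp (sym (Y-boundary i)) ref (Y-internal v)))
    h = cramer u (trans (cross-∸ p o 𝔩) e)
    at : ∀ {p o l} → scale * (p ∸ o) ≈ Y u * l → p ≈ o + t * l
    at {p} {o} {l} h = trans (solve 2 (λ p o → p := o :+ con 1ℤ :* (p :- o)) ref p o) (+-congˡ
      (trans (*-congʳ (sym inv)) (trans (solve 3 (λ d i x → d :* i :* x := i :* (d :* x)) ref scale D⁻¹ (p ∸ o))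
        (trans (*-congˡ h) (solve 3 (λ i y l → i :* (y :* l) := y :* i :* l) ref D⁻¹ (Y u) l)))))

  coordinates-injective : ∀ u v → coordinates u ≈ₚ coordinates v → u ≈ₚ v
  coordinates-injective u v (p , q) =
    let (r , s) = coordinates-zero (u -ₚ v) (vanish 𝔩 p) (vanish direction q) in equal r , equal s
    where
    vanish : ∀ w → cross u w ≈ cross v w → cross (u -ₚ v) w ≈ 0#
    vanish w e = trans (cross-∸ u v w) (trans (+-congʳ e) (-‿inverseʳ _))
    equal : ∀ {x y} → x ∸ y ≈ 0# → x ≈ y
    equal {x} {y} e = trans (solve 2 (λ x y → x := (x :- y) :+ y) ref x y) (trans (+-congʳ e) (+-identityˡ y))

  -- The gauge condition on directions speaks of internal edges; for an edge at the boundary, the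
  -- vertical through that end misses the other end.
  X-edge : ∀ f → ¬ proj₁ (pt (tgt f)) ∸ proj₁ (pt (src f)) ≈ 0#
  X-edge f e with src f in s | tgt f in t
  ... | inj₁ i | _      = X-distinct i (λ h → no-loops f (≡.trans s (≡.trans (≡.sym h) (≡.sym t)))) e
  ... | inj₂ v | inj₁ i = X-distinct {inj₂ v} i (λ ()) (trans (solve 2 (λ x y → x :- y := :- (y :- x)) ref _ _)
                            (trans (-‿cong e) -0≈0))
  ... | inj₂ u | inj₂ v = not-parallel f (λ i → (λ h → case ≡.trans (≡.sym s) h of λ ()) , (λ h → case ≡.trans (≡.sym t) h of λ ()))
    (sgn-zero (vec f) 𝔩 (trans (cross-cong₁ {vec f} (≡-diff s t)) (trans (cross-∸ (position (internal v)) (position (internal u)) 𝔩) e)))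
    where
    ≡-diff : ∀ {x y} → src f ≡ x → tgt f ≡ y → vec f ≈ₚ position y -ₚ position x
    ≡-diff refl refl = ref , ref

  Common : Edge → Edge → Vertex → Set
  Common f g v = (v ≡ src f ⊎ v ≡ tgt f) × (v ≡ src g ⊎ v ≡ tgt g)

  -- The point at parameter `a / m` of a segment, multiplied by `m`: the weights of `Avoids₀` can be
  -- used undivided.
  along : Carrier → Carrier → Point → Point → Point
  along m a p q = m · p +ₚ a · (q -ₚ p)

  private
    coordinates-along : ∀ m a p q → coordinates (along m a p q) ≈ₚ along m a (coordinates p) (coordinates q)
    coordinates-along m a p q = linear 𝔩 , linear direction
      where
      linear : ∀ w → cross (along m a p q) w ≈ m * cross p w + a * (cross q w ∸ cross p w)
      linear w = trans (cross-+ (m · p) (a · (q -ₚ p)) w)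
        (+-cong (cross-· m p w) (trans (cross-· a (q -ₚ p) w) (*-congˡ (cross-∸ q p w))))

    ≈ₚ-trans : ∀ {u v w} → u ≈ₚ v → v ≈ₚ w → u ≈ₚ w
    ≈ₚ-trans (p , q) (r , s) = trans p r , trans q s

    ≈ₚ-sym : ∀ {u v} → u ≈ₚ v → v ≈ₚ u
    ≈ₚ-sym (p , q) = sym p , sym q

  meet : ∀ {f g m a a′} → f ≢ g → 0# < m → 0# ≤ a → a ≤ m → 0# ≤ a′ → a′ ≤ m →
    along m a (pt (src f)) (pt (tgt f)) ≈ₚ along m a′ (pt (src g)) (pt (tgt g)) →
    ∃[ v ] Common f g v × m · pt v ≈ₚ along m a (pt (src f)) (pt (tgt f))
  meet {f} {g} {m} {a} {a′} f≢g 0<m 0≤a a≤m 0≤a′ a′≤m e =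
    let (v , onf , ong , e′) = planar f≢g x (a * m⁻¹ , lower 0≤a , upper a≤m , (ref , ref))
                                            (a′ * m⁻¹ , lower 0≤a′ , upper a′≤m , (proj₁ on-g , proj₂ on-g))
    in v , (onf , ong) , back v e′
    where
    m⁻¹ = proj₁ (invertible (<⇒≉0 0<m))
    inv = proj₂ (invertible (<⇒≉0 0<m))
    0<m⁻¹ = inverse-pos 0<m inv
    x = position (src f) +ₚ (a * m⁻¹) · vec f
    lower : ∀ {a} → 0# ≤ a → 0# ≤ a * m⁻¹
    lower h = *-nonneg h (inj₁ 0<m⁻¹)
    upper : ∀ {a} → a ≤ m → a * m⁻¹ ≤ 1#
    upper {a} h = 0≤∸⇒≤ (≤-resp ref (trans (solve 3 (λ a m i → (m :- a) :* i := m :* i :- a :* i) ref a m m⁻¹) (+-congʳ inv))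
      (*-nonneg (≤⇒0≤∸ h) (inj₁ 0<m⁻¹)))
    unscale : ∀ {a p d} → m⁻¹ * (m * p + a * d) ≈ p + a * m⁻¹ * d
    unscale {a} {p} {d} = trans (solve 5 (λ a p d m i → i :* (m :* p :+ a :* d) := m :* i :* p :+ a :* i :* d) ref a p d m m⁻¹)
      (+-congʳ (trans (*-congʳ inv) (*-identityˡ p)))
    rescale : ∀ {a p d} → m * (p + a * m⁻¹ * d) ≈ m * p + a * d
    rescale {a} {p} {d} = trans (solve 5 (λ a p d m i → m :* (p :+ a :* i :* d) := m :* p :+ m :* i :* (a :* d)) ref a p d m m⁻¹)
      (+-congˡ (trans (*-congʳ inv) (*-identityˡ _)))
    e-pos : along m a (position (src f)) (position (tgt f)) ≈ₚ along m a′ (position (src g)) (position (tgt g))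
    e-pos = coordinates-injective _ _ (≈ₚ-trans (coordinates-along m a _ _) (≈ₚ-trans e (≈ₚ-sym (coordinates-along m a′ _ _))))
    on-g : x ≈ₚ position (src g) +ₚ (a′ * m⁻¹) · vec g
    on-g = trans (sym unscale) (trans (*-congˡ (proj₁ e-pos)) unscale) , trans (sym unscale) (trans (*-congˡ (proj₂ e-pos)) unscale)
    back : ∀ v → position v ≈ₚ x → m · pt v ≈ₚ along m a (pt (src f)) (pt (tgt f))
    back v (p , q) = ≈ₚ-trans (sym (cross-· m (position v) 𝔩) , sym (cross-· m (position v) direction))
      (≈ₚ-trans (cross-cong₁ {m · position v} scaled , cross-cong₁ {m · position v} scaled) (coordinates-along m a _ _))
      where
      scaled : m · position v ≈ₚ along m a (position (src f)) (position (tgt f))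
      scaled = trans (*-congˡ p) rescale , trans (*-congˡ q) rescale

  -- A vanishing combination makes the two edges meet, and they share no point but the vertex
  -- `tgt f`. Since no edge is vertical, all weights must then be zero.
  corner : ∀ {f g} → src g ≡ tgt f → src f ≢ tgt g → Corner (pt (src f)) (pt (tgt f)) (pt (tgt g))
  corner {f} {g} e s≢t a b d 0≤a 0≤b 0≤d 0<s (e₁ , e₂) = conclude
    (meet {f} {g} {a + b + (b + d)} {b + d} {b + d} f≢g 0<m 0≤β β≤m 0≤β β≤m
      (≡.subst (λ v → along m (b + d) (pt (src f)) (pt (tgt f)) ≈ₚ along m (b + d) (pt v) (pt (tgt g))) (≡.sym e)
        (same e₁ , same e₂)))
    where
    -- Writing the skipping secant as the sum of the two edge vectors puts the weights `a + b` and
    -- `b + d` on them; `m` is the total.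
    m = a + b + (b + d)
    0≤β = +-nonneg 0≤b 0≤d
    f≢g : f ≢ g
    f≢g refl = no-loops f e
    0<m : 0# < m
    0<m = <-resp ref (solve 3 (λ a b d → (a :+ (b :+ d)) :+ b := a :+ b :+ (b :+ d)) ref a b d) (+-pos-nonneg 0<s 0≤b)
    β≤m : b + d ≤ m
    β≤m = 0≤∸⇒≤ (≤-resp ref (solve 3 (λ a b d → a :+ b := a :+ b :+ (b :+ d) :- (b :+ d)) ref a b d) (+-nonneg 0≤a 0≤b))
    same : ∀ {p q r} → a * (q ∸ p) + (b * (r ∸ p) + d * (r ∸ q)) ≈ 0# →
           m * p + (b + d) * (q ∸ p) ≈ m * q + (b + d) * (r ∸ q)
    same {p} {q} {r} h = trans (sym (+-identityʳ _)) (trans (+-congˡ (sym h))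
      (solve 6 (λ a b d p q r → (a :+ b :+ (b :+ d)) :* p :+ (b :+ d) :* (q :- p) :+ (a :* (q :- p) :+ (b :* (r :- p) :+ d :* (r :- q)))
        := (a :+ b :+ (b :+ d)) :* q :+ (b :+ d) :* (r :- q)) ref a b d p q r))
    zero-α : ∀ {p q} → m * q ≈ m * p + (b + d) * (q ∸ p) → (a + b) * (q ∸ p) ≈ 0#
    zero-α {p} {q} h = trans (solve 5 (λ a b d p q → (a :+ b) :* (q :- p) := (a :+ b :+ (b :+ d)) :* q :- ((a :+ b :+ (b :+ d)) :* p :+ (b :+ d) :* (q :- p))) ref a b d p q)
      (trans (+-congʳ h) (-‿inverseʳ _))
    zero-d : ∀ {p q r} → a ≈ 0# → b ≈ 0# → a * p + (b * q + d * r) ≈ 0# → d * r ≈ 0#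
    zero-d a≈0 b≈0 h = trans (sym (trans (+-cong (trans (*-congʳ a≈0) (zeroˡ _)) (+-congʳ (trans (*-congʳ b≈0) (zeroˡ _))))
      (trans (+-identityˡ _) (+-identityˡ _)))) h
    conclude : ∃[ v ] Common f g v × m · pt v ≈ₚ along m (b + d) (pt (src f)) (pt (tgt f)) → ⊥
    conclude (v , (onf , ong) , (h , _)) = <⇒≉0 0<s (trans (+-cong a≈0 (+-cong b≈0 d≈0)) (trans (+-identityˡ _) (+-identityˡ _)))
      where
      v≡ : v ≡ tgt f
      v≡ = case onf , ong of λ
        { (inj₂ h , _) → h
        ; (inj₁ h , inj₁ h′) → ≡.trans h′ e
        ; (inj₁ h , inj₂ h′) → contradiction (≡.trans (≡.sym h) h′) s≢t }
      a+b : a + b ≈ 0#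
      a+b = *-zero-cancel (X-edge f) (trans (*-comm _ _) (zero-α (≡.subst (λ v → m * proj₁ (pt v) ≈ m * proj₁ (pt (src f)) + (b + d) * (proj₁ (pt (tgt f)) ∸ proj₁ (pt (src f)))) v≡ h)))
      a≈0 = nonneg-sum≈0 0≤a 0≤b a+b
      b≈0 = nonneg-sum≈0 0≤b 0≤a (trans (+-comm b a) a+b)
      d≈0 : d ≈ 0#
      d≈0 = *-zero-cancel (X-edge g) (trans (*-comm _ d) (≡.subst (λ v → d * (proj₁ (pt (tgt g)) ∸ proj₁ (pt v)) ≈ 0#) (≡.sym e) (zero-d a≈0 b≈0 e₁)))

  NoCommon : Edge → Edge → Set
  NoCommon f g = ∀ v → ¬ Common f g v

  -- Collected by end points, a vanishing combination of secants equates a point of `f` with a point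
  -- of `g`, whose parameters are partial sums of `a`, `b` and `d`.
  apart-edges : ∀ {f g} → NoCommon f g →
    let p = pt (src f) ; p′ = pt (tgt f) ; q = pt (src g) ; q′ = pt (tgt g) in
    Avoids₀ (q -ₚ p) (q′ -ₚ p) (q′ -ₚ p′) × Avoids₀ (q -ₚ p) (q -ₚ p′) (q′ -ₚ p′)
  apart-edges {f} {g} none =
    (λ a b d 0≤a 0≤b 0≤d 0<s (e₁ , e₂) →
      clash 0<s 0≤d (0≤∸⇒≤ (≤-resp ref (solve 3 (λ a b d → a :+ b := a :+ (b :+ d) :- d) ref a b d) (+-nonneg 0≤a 0≤b)))
        (+-nonneg 0≤b 0≤d) (0≤∸⇒≤ (≤-resp ref (solve 3 (λ a b d → a := a :+ (b :+ d) :- (b :+ d)) ref a b d) 0≤a))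
        (first e₁ , first e₂)) ,
    (λ a b d 0≤a 0≤b 0≤d 0<s (e₁ , e₂) →
      clash 0<s (+-nonneg 0≤b 0≤d) (0≤∸⇒≤ (≤-resp ref (solve 3 (λ a b d → a := a :+ (b :+ d) :- (b :+ d)) ref a b d) 0≤a))
        0≤d (0≤∸⇒≤ (≤-resp ref (solve 3 (λ a b d → a :+ b := a :+ (b :+ d) :- d) ref a b d) (+-nonneg 0≤a 0≤b)))
        (second e₁ , second e₂))
    where
    f≢g : f ≢ g
    f≢g refl = none (src f) (inj₁ refl , inj₁ refl)
    clash : ∀ {m a a′} → 0# < m → 0# ≤ a → a ≤ m → 0# ≤ a′ → a′ ≤ m →
      along m a (pt (src f)) (pt (tgt f)) ≈ₚ along m a′ (pt (src g)) (pt (tgt g)) → ⊥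
    clash h h₁ h₂ h₃ h₄ e = let (v , common , _) = meet f≢g h h₁ h₂ h₃ h₄ e in none v common
    first : ∀ {a b d p p′ q q′} → a * (q ∸ p) + (b * (q′ ∸ p) + d * (q′ ∸ p′)) ≈ 0# →
            (a + (b + d)) * p + d * (p′ ∸ p) ≈ (a + (b + d)) * q + (b + d) * (q′ ∸ q)
    first {a} {b} {d} {p} {p′} {q} {q′} h = trans (sym (+-identityʳ _)) (trans (+-congˡ (sym h))
      (solve 7 (λ a b d p p′ q q′ → (a :+ (b :+ d)) :* p :+ d :* (p′ :- p) :+ (a :* (q :- p) :+ (b :* (q′ :- p) :+ d :* (q′ :- p′)))
        := (a :+ (b :+ d)) :* q :+ (b :+ d) :* (q′ :- q)) ref a b d p p′ q q′))
    second : ∀ {a b d p p′ q q′} → a * (q ∸ p) + (b * (q ∸ p′) + d * (q′ ∸ p′)) ≈ 0# →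
            (a + (b + d)) * p + (b + d) * (p′ ∸ p) ≈ (a + (b + d)) * q + d * (q′ ∸ q)
    second {a} {b} {d} {p} {p′} {q} {q′} h = trans (sym (+-identityʳ _)) (trans (+-congˡ (sym h))
      (solve 7 (λ a b d p p′ q q′ → (a :+ (b :+ d)) :* p :+ (b :+ d) :* (p′ :- p) :+ (a :* (q :- p) :+ (b :* (q :- p′) :+ d :* (q′ :- p′)))
        := (a :+ (b :+ d)) :* q :+ d :* (q′ :- q)) ref a b d p p′ q q′))

  polyline : Vertex → List Edge → List Point
  polyline u P = pt u ∷ map (pt ∘ tgt) P

  no-common : ∀ {f h} → src f ≢ src h → src f ≢ tgt h → tgt f ≢ src h → tgt f ≢ tgt h → NoCommon f h
  no-common a b c d v (inj₁ h , inj₁ h′) = a (≡.trans (≡.sym h) h′)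
  no-common a b c d v (inj₁ h , inj₂ h′) = b (≡.trans (≡.sym h) h′)
  no-common a b c d v (inj₂ h , inj₁ h′) = c (≡.trans (≡.sym h) h′)
  no-common a b c d v (inj₂ h , inj₂ h′) = d (≡.trans (≡.sym h) h′)

  apart : ∀ f {x w} Q → IsWalk x Q w → (∀ {h} → h ∈ₗ Q → NoCommon f h) → Apart (pt (src f)) (pt (tgt f)) (polyline x Q)
  apart f []      _          _    = lift tt
  apart f (h ∷ Q) (refl , q) none =
    let (l , r) = apart-edges (none (here refl)) in l , r , apart f Q q (none ∘ there)

  private
    later-fresh : ∀ {u w x} P → IsWalk u P w → x ∉ₗ sources P → x ≢ w → ∀ {h} → h ∈ₗ P → x ≢ src h × x ≢ tgt h
    later-fresh P p x∉ x≢w h∈ = (λ { refl → x∉ (∈-map⁺ src h∈) }) ,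
      (λ { refl → [ x∉ , x≢w ]′ (walk-next P p h∈) })

  simple-polyline : ∀ {u w} P → IsWalk u P w → Unique (sources P) → w ∉ₗ sources P → SimplePolyline (polyline u P)
  simple-polyline []       _ _ _ = lift tt
  simple-polyline (f ∷ []) _ _ _ = lift tt
  simple-polyline (f ∷ g ∷ Q) (refl , (e , q)) u@(_ ∷ u′) w∉ =
    corner e (proj₂ (fresh-f (here refl))) ,
    apart f Q q (λ h∈ → no-common (proj₁ (fresh-f (there h∈))) (proj₂ (fresh-f (there h∈)))
      (proj₁ (fresh-g h∈)) (proj₂ (fresh-g h∈))) ,
    simple-polyline (g ∷ Q) (e , q) u′ (w∉ ∘ there)
    where
    fresh-f : ∀ {h} → h ∈ₗ g ∷ Q → src f ≢ src h × src f ≢ tgt h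
    fresh-f = later-fresh (g ∷ Q) (e , q) (Unique[x∷xs]⇒x∉xs u) (λ h → w∉ (here (≡.sym h)))
    fresh-g : ∀ {h} → h ∈ₗ Q → tgt f ≢ src h × tgt f ≢ tgt h
    fresh-g = later-fresh Q q (≡.subst (_∉ₗ sources Q) e (Unique[x∷xs]⇒x∉xs u′)) (λ h → w∉ (there (here (≡.trans (≡.sym h) (≡.sym e)))))

  -- The local winding as a turn, and its change when a loop is cut out.

  edgeVector : Edge → Point
  edgeVector f = pt (tgt f) -ₚ pt (src f)

  X-vec : ∀ f → X (vec f) ≈ proj₁ (edgeVector f)
  X-vec f = cross-∸ (position (tgt f)) (position (src f)) 𝔩

  side-positive : ∀ {u} → ¬ proj₁ u ≈ 0# → side u ≡ positive (proj₁ u) ⁻¹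
  side-positive {x , y} x≉0 with compare 0# x
  ... | tri< h _ _ = refl
  ... | tri≈ _ h _ = contradiction (sym h) x≉0
  ... | tri> _ _ h = refl

  parityᶻ : ℤ → Parity
  parityᶻ z = parity ℤ.∣ z ∣

  private
    -- The shape of `windₑ` with its three signs as variables.
    choose : ℤ → ℤ → ℤ → ℤ
    choose s t t′ = if does (s ℤP.≟ t ×-dec s ℤP.≟ t′) then s else 0ℤ

    sgn-cases : ∀ u v → (0# < cross u v × sgn u v ≡ 1ℤ) ⊎ (cross u v ≈ 0# × sgn u v ≡ 0ℤ) ⊎ (cross u v < 0# × sgn u v ≡ -1ℤ)
    sgn-cases u v with compare 0# (cross u v)
    ... | tri< h _ _ = inj₁ (h , refl)
    ... | tri≈ _ h _ = inj₂ (inj₁ (sym h , refl))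
    ... | tri> _ _ h = inj₂ (inj₂ (h , refl))

    sgn-pos : ∀ {u v} → 0# < cross u v → sgn u v ≡ 1ℤ
    sgn-pos {u} {v} h with compare 0# (cross u v)
    ... | tri< _ _ _ = refl
    ... | tri≈ n _ _ = contradiction h n
    ... | tri> n _ _ = contradiction h n

    sgn-neg′ : ∀ {u v} → cross u v < 0# → sgn u v ≡ -1ℤ
    sgn-neg′ {u} {v} h with compare 0# (cross u v)
    ... | tri< _ _ n = contradiction h n
    ... | tri≈ _ _ n = contradiction h n
    ... | tri> _ _ _ = refl

    choose-mixed : ∀ s → s ≡ 1ℤ ⊎ s ≡ 0ℤ ⊎ s ≡ -1ℤ → choose s 1ℤ -1ℤ ≡ 0ℤ × choose s -1ℤ 1ℤ ≡ 0ℤ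
    choose-mixed _ (inj₁ refl) = refl , refl
    choose-mixed _ (inj₂ (inj₁ refl)) = refl , refl
    choose-mixed _ (inj₂ (inj₂ refl)) = refl , refl

    choose-right : ∀ u v → parityᶻ (choose (sgn u v) 1ℤ 1ℤ) ≡ positive (cross u v)
    choose-right u v = go (sgn-cases u v)
      where
      go : _ → _
      go (inj₁ (h , e)) = ≡.trans (≡.cong (λ s → parityᶻ (choose s 1ℤ 1ℤ)) e) (≡.sym (positive-1 h))
      go (inj₂ (inj₁ (h , e))) = ≡.trans (≡.cong (λ s → parityᶻ (choose s 1ℤ 1ℤ)) e) (≡.sym (positive-0 (inj₂ h)))
      go (inj₂ (inj₂ (h , e))) = ≡.trans (≡.cong (λ s → parityᶻ (choose s 1ℤ 1ℤ)) e) (≡.sym (positive-0 (inj₁ h)))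

    choose-left : ∀ u v → parityᶻ (choose (sgn u v) -1ℤ -1ℤ) ≡ positive (cross v u)
    choose-left u v = go (sgn-cases u v)
      where
      go : _ → _
      go (inj₁ (h , e)) = ≡.trans (≡.cong (λ s → parityᶻ (choose s -1ℤ -1ℤ)) e) (≡.sym (positive-0 (≤-resp (cross-flip u v) ref (inj₁ (pos⇒-neg h)))))
      go (inj₂ (inj₁ (h , e))) = ≡.trans (≡.cong (λ s → parityᶻ (choose s -1ℤ -1ℤ)) e) (≡.sym (positive-0 (inj₂ (trans (sym (cross-flip u v)) (trans (-‿cong h) -0≈0)))))
      go (inj₂ (inj₂ (h , e))) = ≡.trans (≡.cong (λ s → parityᶻ (choose s -1ℤ -1ℤ)) e) (≡.sym (positive-1 (<-resp ref (cross-flip u v) (neg⇒0<- h))))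

    positive-cross : ∀ f g → positive (cross (vec f) (vec g)) ≡ positive (cross (edgeVector f) (edgeVector g))
    positive-cross f g = scaled (cross (vec f) (vec g)) _ (trans
      (solve 8 (λ u₁ u₂ v₁ v₂ l₁ l₂ d₁ d₂ → (l₁ :* d₂ :- l₂ :* d₁) :* (u₁ :* v₂ :- u₂ :* v₁)
        := (u₁ :* l₂ :- u₂ :* l₁) :* (v₁ :* d₂ :- v₂ :* d₁) :- (u₁ :* d₂ :- u₂ :* d₁) :* (v₁ :* l₂ :- v₂ :* l₁)) ref
        (proj₁ (vec f)) (proj₂ (vec f)) (proj₁ (vec g)) (proj₂ (vec g)) (proj₁ 𝔩) (proj₂ 𝔩) (proj₁ direction) (proj₂ direction))
      (+-cong (*-cong (X-vec f) (Y-vec g)) (-‿cong (*-cong (Y-vec f) (X-vec g)))))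
      where
      Y-vec : ∀ f → Y (vec f) ≈ proj₂ (edgeVector f)
      Y-vec f = cross-∸ (position (tgt f)) (position (src f)) direction
      scaled : ∀ x y → scale * x ≈ y → positive x ≡ positive y
      scaled x y e with 0# <? x
      ... | yes h = ≡.sym (positive-1 (<-resp ref e (*-pos scale-pos h)))
      ... | no ¬h = ≡.sym (positive-0 (≰⇒> (λ h → ¬h (*-cancel-pos scale-pos (<-resp ref (sym e) h)))))

    nonzero-cases : ∀ {x} → ¬ x ≈ 0# → 0# < x ⊎ x < 0#
    nonzero-cases {x} x≉0 with compare 0# x
    ... | tri< h _ _ = inj₁ h
    ... | tri≈ _ h _ = contradiction (sym h) x≉0
    ... | tri> _ _ h = inj₂ h

    turn-sides : ∀ u v {s t} → side u ≡ s → side v ≡ t →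
      (s ≡ t → turn u v ≡ 0ℙ) × (s ≡ 0ℙ → t ≡ 1ℙ → turn u v ≡ positive (cross u v)) × (s ≡ 1ℙ → t ≡ 0ℙ → turn u v ≡ positive (cross v u))
    turn-sides u v refl refl with side u | side v
    ... | 0ℙ | 0ℙ = (λ _ → refl) , (λ _ ()) , λ ()
    ... | 1ℙ | 1ℙ = (λ _ → refl) , (λ ()) , λ _ ()
    ... | 0ℙ | 1ℙ = (λ ()) , (λ _ _ → refl) , λ ()
    ... | 1ℙ | 0ℙ = (λ ()) , (λ ()) , λ _ _ → refl

  -- For edges on the same side of the gauge direction, the signs of the first edge against it and
  -- of it against the second are opposite, so `windₑ` is zero. On different sides these signs
  -- agree, and the remaining test of the cross product is the one in `turn`.
  windₑ-turn : ∀ f g → parityᶻ (windₑ f g) ≡ turn (edgeVector f) (edgeVector g)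
  windₑ-turn f g = go (nonzero-cases (X-edge f)) (nonzero-cases (X-edge g))
    where
    three : sgn (vec f) (vec g) ≡ 1ℤ ⊎ sgn (vec f) (vec g) ≡ 0ℤ ⊎ sgn (vec f) (vec g) ≡ -1ℤ
    three = Sum.map proj₂ (Sum.map proj₂ proj₂) (sgn-cases (vec f) (vec g))
    left+ : ∀ {f} → 0# < proj₁ (edgeVector f) → side (edgeVector f) ≡ 0ℙ × sgn (vec f) 𝔩 ≡ 1ℤ × sgn 𝔩 (vec f) ≡ -1ℤ
    left+ {f} h = Right⇒0 {edgeVector f} (inj₁ h) , sgn-pos (<-resp ref (sym (X-vec f)) h) ,
      sgn-neg′ (<-resp (sym (trans (sym (cross-flip (vec f) 𝔩)) (-‿cong (X-vec f)))) ref (pos⇒-neg h))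
    left- : ∀ {f} → proj₁ (edgeVector f) < 0# → side (edgeVector f) ≡ 1ℙ × sgn (vec f) 𝔩 ≡ -1ℤ × sgn 𝔩 (vec f) ≡ 1ℤ
    left- {f} h = Right-⇒1 {edgeVector f} (inj₁ (neg⇒0<- h)) , sgn-neg′ (<-resp (sym (X-vec f)) ref h) ,
      sgn-pos (<-resp ref (sym (trans (sym (cross-flip (vec f) 𝔩)) (-‿cong (X-vec f)))) (neg⇒0<- h))
    form : ∀ {s t} → sgn (vec f) 𝔩 ≡ s → sgn 𝔩 (vec g) ≡ t → parityᶻ (windₑ f g) ≡ parityᶻ (choose (sgn (vec f) (vec g)) s t)
    form p q = ≡.cong₂ (λ s t → parityᶻ (choose (sgn (vec f) (vec g)) s t)) p q
    go : 0# < proj₁ (edgeVector f) ⊎ proj₁ (edgeVector f) < 0# → 0# < proj₁ (edgeVector g) ⊎ proj₁ (edgeVector g) < 0# →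
         parityᶻ (windₑ f g) ≡ turn (edgeVector f) (edgeVector g)
    go (inj₁ h) (inj₁ h′) = let (s , p , _) = left+ h ; (t , _ , q) = left+ h′ in
      ≡.trans (form p q) (≡.trans (≡.cong parityᶻ (proj₁ (choose-mixed _ three))) (≡.sym (proj₁ (turn-sides _ _ s t) refl)))
    go (inj₂ h) (inj₂ h′) = let (s , p , _) = left- h ; (t , _ , q) = left- h′ in
      ≡.trans (form p q) (≡.trans (≡.cong parityᶻ (proj₂ (choose-mixed _ three))) (≡.sym (proj₁ (turn-sides _ _ s t) refl)))
    go (inj₁ h) (inj₂ h′) = let (s , p , _) = left+ h ; (t , _ , q) = left- h′ in
      ≡.trans (form p q) (≡.trans (choose-right (vec f) (vec g)) (≡.trans (positive-cross f g) (≡.sym (proj₁ (proj₂ (turn-sides _ _ s t)) refl refl))))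
    go (inj₂ h) (inj₁ h′) = let (s , p , _) = left- h ; (t , _ , q) = left+ h′ in
      ≡.trans (form p q) (≡.trans (choose-left (vec f) (vec g)) (≡.trans (positive-cross g f) (≡.sym (proj₂ (proj₂ (turn-sides _ _ s t)) refl refl))))

  parityᶻ-+ : ∀ x y → parityᶻ (x ℤ.+ y) ≡ parityᶻ x ℙ.+ parityᶻ y
  parityᶻ-+ (ℤ.+ m)    (ℤ.+ n)    = ℙP.+-homo-+ m n
  parityᶻ-+ (ℤ.+ m)    ℤ.-[1+ n ] = parity-⊖ m (suc n)
    where
    parity-⊖ : ∀ m n → parityᶻ (m ℤ.⊖ n) ≡ parity m ℙ.+ parity n
    parity-⊖ m       zero    = ≡.sym (ℙP.+-identityʳ _)
    parity-⊖ zero    (suc n) = refl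
    parity-⊖ (suc m) (suc n) = ≡.trans (≡.cong parityᶻ (ℤP.[1+m]⊖[1+n]≡m⊖n m n)) (≡.trans (parity-⊖ m n)
      (≡.trans (≡.sym (ℙP.+-homo-+ m n)) (≡.trans (≡.cong (parity ∘ suc) (≡.sym (ℕP.+-suc m n))) (ℙP.+-homo-+ (suc m) (suc n)))))
  parityᶻ-+ ℤ.-[1+ m ] (ℤ.+ n)    = ≡.trans (≡.cong parityᶻ (ℤP.+-comm ℤ.-[1+ m ] (ℤ.+ n)))
    (≡.trans (parityᶻ-+ (ℤ.+ n) ℤ.-[1+ m ]) (ℙP.+-comm (parity n) _))
  parityᶻ-+ ℤ.-[1+ m ] ℤ.-[1+ n ] = ≡.trans (≡.cong (parity ∘ suc) (≡.sym (ℕP.+-suc m n))) (ℙP.+-homo-+ (suc m) (suc n))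

  windParity : List Edge → Parity
  windParity P = parityᶻ (wind P)

  turnParity : Edge → Edge → Parity
  turnParity f g = parityᶻ (windₑ f g)

  tangent-wind : ∀ {u w} P → IsWalk u P w → tangentTurns (polyline u P) ≡ windParity P
  tangent-wind []           _ = refl
  tangent-wind (f ∷ [])     _ = refl
  tangent-wind (f ∷ g ∷ P) (refl , (e , p)) = ≡.trans
    (≡.cong₂ ℙ._+_ (≡.trans (≡.cong (λ v → turn (edgeVector f) (pt (tgt g) -ₚ pt v)) (≡.sym e)) (≡.sym (windₑ-turn f g)))
                   (tangent-wind (g ∷ P) (e , p)))
    (≡.sym (parityᶻ-+ (windₑ f g) (wind (g ∷ P))))

  wind-split : ∀ A a f Q → windParity (A ++ a ∷ f ∷ Q) ≡ (windParity (A ++ a ∷ []) ℙ.+ turnParity a f) ℙ.+ windParity (f ∷ Q)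
  wind-split []          a f Q = parityᶻ-+ (windₑ a f) _
  wind-split (x ∷ [])    a f Q = ≡.trans (parityᶻ-+ (windₑ x a) _) (≡.trans (≡.cong (turnParity x a ℙ.+_) (parityᶻ-+ (windₑ a f) (wind (f ∷ Q))))
    (≡.trans (≡.sym (ℙP.+-assoc (turnParity x a) (turnParity a f) (windParity (f ∷ Q)))) (≡.cong (λ z → (z ℙ.+ turnParity a f) ℙ.+ windParity (f ∷ Q))
      (≡.sym (≡.trans (parityᶻ-+ (windₑ x a) 0ℤ) (ℙP.+-identityʳ (turnParity x a)))))))
  wind-split (x ∷ y ∷ A) a f Q = ≡.trans (parityᶻ-+ (windₑ x y) _) (≡.trans (≡.cong (turnParity x y ℙ.+_) (wind-split (y ∷ A) a f Q))
    (≡.trans (≡.sym (ℙP.+-assoc (turnParity x y) _ _)) (≡.cong (ℙ._+ windParity (f ∷ Q))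
      (≡.trans (≡.sym (ℙP.+-assoc (turnParity x y) _ _)) (≡.cong (ℙ._+ turnParity a f)
        (≡.sym (parityᶻ-+ (windₑ x y) _)))))))

  -- Two straight edges joining the same vertices in opposite directions would share their midpoint,
  -- at parameter 1 out of 2, which is a vertex of neither.
  no-two-cycle : ∀ {f g} → src g ≡ tgt f → tgt g ≢ src f
  no-two-cycle {f} {g} e e′ = conclude (meet {f} {g} {1# + 1#} {1#} {1#} f≢g 0<2 (inj₁ 0<1) 1≤2 (inj₁ 0<1) 1≤2
    (≡.subst₂ (λ v v′ → along (1# + 1#) 1# (pt (src f)) (pt (tgt f)) ≈ₚ along (1# + 1#) 1# (pt v) (pt v′)) (≡.sym e) (≡.sym e′)
      (mid _ _ , mid _ _)))
    where
    f≢g : f ≢ g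
    f≢g refl = no-loops f e
    0<2 = +-pos 0<1 0<1
    1≤2 : 1# ≤ 1# + 1#
    1≤2 = 0≤∸⇒≤ (≤-resp ref (solve 0 (con 1ℤ := con 1ℤ :+ con 1ℤ :- con 1ℤ) ref) (inj₁ 0<1))
    mid : ∀ p q → (1# + 1#) * p + 1# * (q ∸ p) ≈ (1# + 1#) * q + 1# * (p ∸ q)
    mid = solve 2 (λ p q → (con 1ℤ :+ con 1ℤ) :* p :+ con 1ℤ :* (q :- p) := (con 1ℤ :+ con 1ℤ) :* q :+ con 1ℤ :* (p :- q)) ref
    at-src : ∀ {p q} → (1# + 1#) * p ≈ (1# + 1#) * p + 1# * (q ∸ p) → q ∸ p ≈ 0#
    at-src {p} {q} h = trans (solve 2 (λ p q → q :- p := ((con 1ℤ :+ con 1ℤ) :* p :+ con 1ℤ :* (q :- p)) :- (con 1ℤ :+ con 1ℤ) :* p) ref p q)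
      (trans (+-congʳ (sym h)) (-‿inverseʳ _))
    at-tgt : ∀ {p q} → (1# + 1#) * q ≈ (1# + 1#) * p + 1# * (q ∸ p) → q ∸ p ≈ 0#
    at-tgt {p} {q} h = trans (solve 2 (λ p q → q :- p := (con 1ℤ :+ con 1ℤ) :* q :- ((con 1ℤ :+ con 1ℤ) :* p :+ con 1ℤ :* (q :- p))) ref p q)
      (trans (+-congʳ h) (-‿inverseʳ _))
    conclude : ∃[ v ] Common f g v × (1# + 1#) · pt v ≈ₚ along (1# + 1#) 1# (pt (src f)) (pt (tgt f)) → ⊥
    conclude (_ , (inj₁ refl , _) , (h , _)) = X-edge f (at-src h)
    conclude (_ , (inj₂ refl , _) , (h , _)) = X-edge f (at-tgt h)

  -- The shape that `closed-turning` needs: at least three edges, the last one exposed.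
  data LongCycle : List Edge → Set where
    longCycle : ∀ f g S l → LongCycle (f ∷ g ∷ S ++ l ∷ [])

  cycle-long : ∀ {v γ} → IsCycle v γ → LongCycle γ
  cycle-long {γ = f ∷ []}        ((refl , e) , _) = ⊥-elim (no-loops f (≡.sym e))
  cycle-long {γ = f ∷ g ∷ Q} cyc@((refl , (e , q)) , _) = go Q (List.initLast Q) q
    where
    go : ∀ Q → List.InitLast Q → IsWalk (tgt g) Q (src f) → LongCycle (f ∷ g ∷ Q)
    go _ List.[]        q = ⊥-elim (no-two-cycle {f} {g} e q)
    go _ (S List.∷ʳ′ l) q = longCycle f g S l

  endpoint-walk : ∀ {u w} P → IsWalk u P w → endpoint (pt u) (map (pt ∘ tgt) P) ≡ pt w
  endpoint-walk []      refl    = refl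
  endpoint-walk (f ∷ P) (_ , p) = endpoint-walk P p

  -- `wind` stops at the last edge, so the turn back to the first edge is added to close the
  -- polygon.
  cycle-turning : ∀ {v} f g S l → IsCycle v (f ∷ g ∷ S ++ l ∷ []) → windParity (f ∷ g ∷ S ++ l ∷ []) ℙ.+ turnParity l f ≡ 1ℙ
  cycle-turning f g S l cyc@((refl , p@(e , q)) , u@(_ ∷ u′) , _) = go (walk-split S q)
    where
    open ≡.≡-Reasoning
    ps = map (pt ∘ tgt) S
    v∉ : src f ∉ₗ sources (g ∷ S ++ l ∷ [])
    v∉ = Unique[x∷xs]⇒x∉xs u
    go : (∃[ y ] IsWalk (tgt g) S y × IsWalk y (l ∷ []) (src f)) →
         windParity (f ∷ g ∷ S ++ l ∷ []) ℙ.+ turnParity l f ≡ 1ℙ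
    go (_ , s , (refl , l-tgt)) = begin
      windParity (f ∷ g ∷ S ++ l ∷ []) ℙ.+ turnParity l f
        ≡⟨ ≡.cong₂ ℙ._+_ (≡.sym (tangent-wind (f ∷ g ∷ S ++ l ∷ []) (refl , p))) (windₑ-turn l f) ⟩
      tangentTurns (polyline (src f) (f ∷ g ∷ S ++ l ∷ [])) ℙ.+ turn (edgeVector l) (edgeVector f)
        ≡⟨ ≡.cong₂ (λ ps z → tangentTurns (pt (src f) ∷ pt (tgt f) ∷ pt (tgt g) ∷ ps) ℙ.+ turn z (edgeVector f)) points vector ⟩
      tangentTurns (pt (src f) ∷ pt (tgt f) ∷ pt (tgt g) ∷ ps ++ pt (src f) ∷ []) ℙ.+
        turn (pt (src f) -ₚ endpoint (pt (tgt g)) ps) (edgeVector f)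
        ≡⟨ closed-turning (pt (src f)) (pt (tgt f)) (pt (tgt g)) ps
             (≡.subst (λ ps → SimplePolyline (pt (tgt f) ∷ pt (tgt g) ∷ ps)) points (simple-polyline (g ∷ S ++ l ∷ []) p u′ v∉))
             (corner e f-g)
             (apart f S s λ h∈ → no-common (proj₁ (fresh-f h∈)) (proj₂ (fresh-f h∈)) (proj₁ (fresh-g h∈)) (proj₂ (fresh-g h∈)))
             last-corner ⟩
      1ℙ ∎
      where
      points : map (pt ∘ tgt) (S ++ l ∷ []) ≡ ps ++ pt (src f) ∷ []
      points = ≡.trans (map-++ (pt ∘ tgt) S (l ∷ [])) (≡.cong (λ v → ps ++ pt v ∷ []) l-tgt)
      end : endpoint (pt (tgt g)) ps ≡ pt (src l)
      end = endpoint-walk S s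
      vector : edgeVector l ≡ pt (src f) -ₚ endpoint (pt (tgt g)) ps
      vector = ≡.cong₂ (λ v z → pt v -ₚ z) l-tgt (≡.sym end)
      f-g : src f ≢ tgt g
      f-g h = no-two-cycle {f} {g} e (≡.sym h)
      v∉S : src f ∉ₗ sources S
      v∉S h = v∉ (there (sources-++⁺ˡ S (l ∷ []) h))
      v≢l : src f ≢ src l
      v≢l h = v∉ (there (sources-++⁺ʳ S (l ∷ []) (here h)))
      g∉ : tgt f ∉ₗ sources (S ++ l ∷ [])
      g∉ = ≡.subst (_∉ₗ sources (S ++ l ∷ [])) e (Unique[x∷xs]⇒x∉xs u′)
      fresh-f : ∀ {h} → h ∈ₗ S → src f ≢ src h × src f ≢ tgt h
      fresh-f = later-fresh S s v∉S v≢l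
      fresh-g : ∀ {h} → h ∈ₗ S → tgt f ≢ src h × tgt f ≢ tgt h
      fresh-g = later-fresh S s (λ h → g∉ (sources-++⁺ˡ S (l ∷ []) h)) (λ h → g∉ (sources-++⁺ʳ S (l ∷ []) (here h)))
      last-corner : Corner (endpoint (pt (tgt g)) ps) (pt (src f)) (pt (tgt f))
      last-corner = ≡.subst₂ (λ z p → Corner z p (pt (tgt f))) (≡.sym end) (≡.cong pt l-tgt)
        (corner {l} {f} (≡.sym l-tgt) (λ h → g∉ (sources-++⁺ʳ S (l ∷ []) (here (≡.sym h)))))

  wind-splice : ∀ {v} A a γ r R → tgt a ≡ v → IsCycle v γ → src r ≡ v →
    windParity ((A ++ a ∷ []) ++ γ ++ r ∷ R) ≡ windParity ((A ++ a ∷ []) ++ r ∷ R) ⁻¹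
  wind-splice A a γ r R a-tgt cyc r-src = go (cycle-long cyc) cyc
    where
    open ≡.≡-Reasoning
    go : ∀ {γ} → LongCycle γ → IsCycle _ γ → windParity ((A ++ a ∷ []) ++ γ ++ r ∷ R) ≡ windParity ((A ++ a ∷ []) ++ r ∷ R) ⁻¹
    go (longCycle f g S l) cyc = begin
      windParity ((A ++ a ∷ []) ++ (f ∷ g ∷ S ++ l ∷ []) ++ r ∷ R)
        ≡⟨ ≡.cong windParity (≡.trans (++-assoc A (a ∷ []) _) (≡.cong (λ Q → A ++ a ∷ f ∷ g ∷ Q) (++-assoc S (l ∷ []) (r ∷ R)))) ⟩
      windParity (A ++ a ∷ f ∷ g ∷ S ++ l ∷ r ∷ R)
        ≡⟨ wind-split A a f (g ∷ S ++ l ∷ r ∷ R) ⟩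
      (α ℙ.+ turnParity a f) ℙ.+ windParity (f ∷ g ∷ S ++ l ∷ r ∷ R)
        ≡⟨ ≡.cong ((α ℙ.+ turnParity a f) ℙ.+_) (wind-split (f ∷ g ∷ S) l r R) ⟩
      (α ℙ.+ turnParity a f) ℙ.+ ((ω ℙ.+ turnParity l r) ℙ.+ β)
        ≡⟨ solveℙ 5 (λ α x ω y β → (α ⊞ x) ⊞ ((ω ⊞ y) ⊞ β)
             ⊜ (ω ⊞ (x ⊞ y)) ⊞ (α ⊞ β)) refl α (turnParity a f) ω (turnParity l r) β ⟩
      (ω ℙ.+ (turnParity a f ℙ.+ turnParity l r)) ℙ.+ (α ℙ.+ β)
        ≡⟨ ≡.cong (λ z → (ω ℙ.+ z) ℙ.+ (α ℙ.+ β)) exchange ⟩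
      (ω ℙ.+ (turnParity l f ℙ.+ turnParity a r)) ℙ.+ (α ℙ.+ β)
        ≡⟨ solveℙ 5 (λ α x ω y β → (ω ⊞ (x ⊞ y)) ⊞ (α ⊞ β)
             ⊜ (ω ⊞ x) ⊞ ((α ⊞ y) ⊞ β)) refl α (turnParity l f) ω (turnParity a r) β ⟩
      (ω ℙ.+ turnParity l f) ℙ.+ ((α ℙ.+ turnParity a r) ℙ.+ β)
        ≡⟨ ≡.cong₂ ℙ._+_ (cycle-turning f g S l cyc) (≡.sym (wind-split A a r R)) ⟩
      windParity (A ++ a ∷ r ∷ R) ⁻¹
        ≡⟨ ≡.cong (λ P → windParity P ⁻¹) (≡.sym (++-assoc A (a ∷ []) (r ∷ R))) ⟩
      windParity ((A ++ a ∷ []) ++ r ∷ R) ⁻¹ ∎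
      where
      α = windParity (A ++ a ∷ [])
      ω = windParity (f ∷ g ∷ S ++ l ∷ [])
      β = windParity (r ∷ R)
      l-tgt : tgt l ≡ _
      l-tgt = let (_ , _ , p) = walk-split (f ∷ g ∷ S) (proj₁ cyc) in proj₂ p
      exchange : turnParity a f ℙ.+ turnParity l r ≡ turnParity l f ℙ.+ turnParity a r
      -- With one incoming edge at the base point `a` and `l` coincide, with one outgoing edge `f`
      -- and `r` do; either way the two pairs of turns have the same sum.
      exchange = [ (λ uin → ≡.cong (λ x → turnParity x f ℙ.+ turnParity l r) (uin a-tgt l-tgt) ∙ ≡.cong (λ x → turnParity l f ℙ.+ turnParity x r) (uin l-tgt a-tgt))
                 , (λ uout → ≡.trans (≡.cong (λ x → turnParity a x ℙ.+ turnParity l r) (uout (proj₁ (proj₁ cyc)) r-src))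
                     (≡.trans (ℙP.+-comm (turnParity a r) _) (≡.cong (λ x → turnParity l x ℙ.+ turnParity a r) (uout r-src (proj₁ (proj₁ cyc)))))) ]′ (fork _)
        where
        _∙_ = ≡.trans

  -- Crossings of an edge with the gauge rays.

  ∑ℙ : ∀ {a} {A : Set a} → List A → (A → Parity) → Parity
  ∑ℙ []       g = 0ℙ
  ∑ℙ (x ∷ xs) g = g x ℙ.+ ∑ℙ xs g

  bit : ∀ {p} {P : Set p} → Dec P → Parity
  bit d = if does d then 1ℙ else 0ℙ

  bit-yes : ∀ {p} {P : Set p} (d : Dec P) → P → bit d ≡ 1ℙ
  bit-yes (yes _) _ = refl
  bit-yes (no ¬p) p = contradiction p ¬p

  bit-no : ∀ {p} {P : Set p} (d : Dec P) → ¬ P → bit d ≡ 0ℙ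
  bit-no (yes p) ¬p = contradiction p ¬p
  bit-no (no _)  _  = refl

  module _ {a} {A : Set a} where

    ∑ℙ-cong : ∀ (xs : List A) {g h} → (∀ x → g x ≡ h x) → ∑ℙ xs g ≡ ∑ℙ xs h
    ∑ℙ-cong []       e = refl
    ∑ℙ-cong (x ∷ xs) e = ≡.cong₂ ℙ._+_ (e x) (∑ℙ-cong xs e)

    ∑ℙ-zero : ∀ (xs : List A) {g} → (∀ x → g x ≡ 0ℙ) → ∑ℙ xs g ≡ 0ℙ
    ∑ℙ-zero []       e = refl
    ∑ℙ-zero (x ∷ xs) e = ≡.cong₂ ℙ._+_ (e x) (∑ℙ-zero xs e)

    ∑ℙ-+ : ∀ (xs : List A) g h → ∑ℙ xs (λ x → g x ℙ.+ h x) ≡ ∑ℙ xs g ℙ.+ ∑ℙ xs h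
    ∑ℙ-+ []       g h = refl
    ∑ℙ-+ (x ∷ xs) g h = ≡.trans (≡.cong ((g x ℙ.+ h x) ℙ.+_) (∑ℙ-+ xs g h))
      (interchange (g x) (h x) (∑ℙ xs g) (∑ℙ xs h))

    -- Singles out the ray of the walk's own source: its crossings differ by a correction `T` from
    -- the pattern followed by the other rays.
    ∑ℙ-except : ∀ {g h T x₀} (xs : List A) → Unique xs → x₀ ∈ₗ xs → (∀ {x} → x ≢ x₀ → g x ≡ h x) →
                g x₀ ≡ h x₀ ℙ.+ T → ∑ℙ xs g ≡ ∑ℙ xs h ℙ.+ T
    ∑ℙ-except {g} {h} {T} (x ∷ xs) u (here refl) same e = ≡.trans
      (≡.cong₂ ℙ._+_ e (same-tail xs (Unique[x∷xs]⇒x∉xs u)))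
      (solveℙ 3 (λ a t s → (a ⊞ t) ⊞ s ⊜ (a ⊞ s) ⊞ t)
        refl (h x) T (∑ℙ xs h))
      where
      same-tail : ∀ ys → x ∉ₗ ys → ∑ℙ ys g ≡ ∑ℙ ys h
      same-tail []       _  = refl
      same-tail (y ∷ ys) x∉ = ≡.cong₂ ℙ._+_ (same (λ { refl → x∉ (here refl) })) (same-tail ys (x∉ ∘ there))
    ∑ℙ-except {h = h} (x ∷ xs) u@(_ ∷ u′) (there x₀∈) same e = ≡.trans
      (≡.cong₂ ℙ._+_ (same λ { refl → Unique[x∷xs]⇒x∉xs u x₀∈ }) (∑ℙ-except xs u′ x₀∈ same e)) (≡.sym (ℙP.+-assoc (h x) _ _))

    parity-filter : ∀ {p} {P : A → Set p} (P? : ∀ x → Dec (P x)) xs → parity (length (filter P? xs)) ≡ ∑ℙ xs (λ x → bit (P? x))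
    parity-filter P? [] = refl
    parity-filter P? (x ∷ xs) with P? x
    ... | yes _ = ≡.trans (ℙP.+-homo-+ 1 (length (filter P? xs))) (≡.cong _⁻¹ (parity-filter P? xs))
    ... | no  _ = parity-filter P? xs

  ray : Fin k → Fin n
  ray = Columns.at I

  ray∈I : ∀ r → ray r ∈ Columns.set I
  ray∈I r = ∈-⋃ (List.tabulate (λ s → ⁅ ray s ⁆)) (∈-tabulate⁺ r) (x∈⁅x⁆ (ray r))
    where
    ∈-⋃ : ∀ {m} {x : Fin m} {p} ps → p ∈ₗ ps → x ∈ p → x ∈ ⋃ ps
    ∈-⋃ (p ∷ ps) (here refl) h = x∈p∪q⁺ (inj₁ h)
    ∈-⋃ (p ∷ ps) (there p∈)  h = x∈p∪q⁺ (inj₂ (∈-⋃ ps p∈ h))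

  ray-injective : ∀ {r s} → ray r ≡ ray s → r ≡ s
  ray-injective {r} {s} e with FinP.<-cmp r s
  ... | tri< h _ _ = contradiction (Columns.increasing I h) (ℕP.<-irrefl (≡.cong Fin.toℕ e))
  ... | tri≈ _ h _ = h
  ... | tri> _ _ h = contradiction (Columns.increasing I h) (ℕP.<-irrefl (≡.cong Fin.toℕ (≡.sym e)))

  shift : Fin n → Vertex → Carrier
  shift i v = X (position v) ∸ X (position (b i))

  rightOf : Fin n → Vertex → Parity
  rightOf i v = positive (shift i v)

  Crossing : Edge → Fin n → Set _
  Crossing f i = Crosses (position (src f)) (vec f) (position (b i)) 𝔩

  crossing? : ∀ f i → Dec (Crossing f i)
  crossing? f i = crosses? (position (src f)) (vec f) (position (b i)) 𝔩

  private
    module _ {f i a t} (e : position (src f) +ₚ a · vec f ≈ₚ position (b i) +ₚ t · 𝔩) where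

      X-crossing : shift i (src f) + a * (shift i (tgt f) ∸ shift i (src f)) ≈ 0#
      X-crossing = trans (solve 4 (λ p p′ o a → (p :- o) :+ a :* ((p′ :- o) :- (p :- o)) := (p :+ a :* (p′ :- p)) :- o) ref _ _ _ a)
        (trans (+-congʳ (trans
          (trans (sym (trans (cross-+ (position (src f)) (a · vec f) 𝔩) (+-congˡ (trans (cross-· a (vec f) 𝔩) (*-congˡ (X-vec f))))))
                 (cross-cong₁ {w = 𝔩} e))
          (trans (cross-+ (position (b i)) (t · 𝔩) 𝔩) (trans (+-congˡ (trans (cross-· t 𝔩 𝔩) (trans (*-congˡ (cross-self 𝔩)) (zeroʳ t)))) (+-identityʳ _)))))
          (-‿inverseʳ _))

    weighted : ∀ x y a → x + a * (y ∸ x) ≈ (1# ∸ a) * x + a * y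
    weighted = solve 3 (λ x y a → x :+ a :* (y :- x) := (con 1ℤ :- a) :* x :+ a :* y) ref

    same-sign : ∀ {x y a} → 0# ≤ a → a ≤ 1# → 0# < x → 0# < y → ¬ x + a * (y ∸ x) ≈ 0#
    same-sign {x} {y} {a} 0≤a a≤1 0<x 0<y e = <⇒≉0 0<1 (trans
      (trans (solve 1 (λ a → con 1ℤ := (con 1ℤ :- a) :+ a) ref a) (+-cong 1-a a≈0)) (+-identityˡ 0#))
      where
      e′ = trans (sym (weighted x y a)) e
      l = *-nonneg (≤⇒0≤∸ a≤1) (inj₁ 0<x)
      r = *-nonneg 0≤a (inj₁ 0<y)
      1-a = *-zero-cancel (<⇒≉0 0<x) (trans (*-comm _ _) (nonneg-sum≈0 l r e′))
      a≈0 = *-zero-cancel (<⇒≉0 0<y) (trans (*-comm _ _) (nonneg-sum≈0 r l (trans (+-comm _ _) e′)))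

    no-crossing : ∀ {f i} → (0# < shift i (src f) × 0# < shift i (tgt f)) ⊎ (shift i (src f) < 0# × shift i (tgt f) < 0#) → ¬ Crossing f i
    no-crossing {f} {i} (inj₁ (h , h′)) (_ , a , t , 0≤a , a≤1 , _ , e) = same-sign 0≤a a≤1 h h′ (X-crossing {f} {i} e)
    no-crossing {f} {i} (inj₂ (h , h′)) (_ , a , t , 0≤a , a≤1 , _ , e) = same-sign 0≤a a≤1 (neg⇒0<- h) (neg⇒0<- h′)
      (trans (solve 3 (λ x y a → (:- x) :+ a :* ((:- y) :- (:- x)) := :- (x :+ a :* (y :- x))) ref _ _ a)
        (trans (-‿cong (X-crossing {f} {i} e)) -0≈0))

    X-vec≉0 : ∀ f → ¬ cross (vec f) 𝔩 ≈ 0#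
    X-vec≉0 f e = X-edge f (trans (sym (X-vec f)) e)

    -- Planarity concerns pairs of edges, so the edge leaving the boundary source stands in for that
    -- vertex.
    ray-misses : ∀ {f r a} → src f ≢ b (ray r) → tgt f ≢ b (ray r) → 0# ≤ a → a ≤ 1# →
                 ¬ position (b (ray r)) ≈ₚ position (src f) +ₚ a · vec f
    ray-misses {f} {r} {a} f≢ f≢′ 0≤a a≤1 e = conclude (count-witness (λ g → src g ≟ᵥ b (ray r))
      (ℕP.≤-reflexive (≡.sym (Equivalence.to (boundary-source (ray r)) (ray∈I r)))))
      where
      zero-along : ∀ p d → p ≈ p + 0# * d
      zero-along = solve 2 (λ p d → p := p :+ con 0ℤ :* d) ref
      conclude : (∃[ g ] src g ≡ b (ray r)) → ⊥
      conclude (g , g-src) = finish (planar {f} {g} (λ { refl → f≢ g-src }) (position (b (ray r)))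
        (a , 0≤a , a≤1 , e)
        (0# , inj₂ ref , inj₁ 0<1 , ≡.subst (λ v → position (b (ray r)) ≈ₚ position v +ₚ 0# · (position (tgt g) -ₚ position v)) (≡.sym g-src)
          (zero-along _ _ , zero-along _ _)))
        where
        finish : ∃[ v ] (v ≡ src f ⊎ v ≡ tgt f) × (v ≡ src g ⊎ v ≡ tgt g) × position v ≈ₚ position (b (ray r)) → ⊥
        finish (v , inj₁ h , _ , e′) = f≢ (≡.trans (≡.sym h) (injective e′))
        finish (v , inj₂ h , _ , e′) = f≢′ (≡.trans (≡.sym h) (injective e′))

    -- The interpolated `shift` vanishes at parameter `y₀ / (y₀ + y₁)`. Both ends are on or above
    -- the boundary, so this point is on the ray or at its origin, and `ray-misses` excludes the
    -- origin.
    crosses-between : ∀ {f r y₀ y₁} → src f ≢ b (ray r) → tgt f ≢ b (ray r) → 0# < y₀ → 0# < y₁ →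
      y₁ * shift (ray r) (src f) + y₀ * shift (ray r) (tgt f) ≈ 0# → Crossing f (ray r)
    crosses-between {f} {r} {y₀} {y₁} f≢ f≢′ 0<y₀ 0<y₁ balance =
      X-vec≉0 f , a , Y q * D⁻¹ , inj₁ 0<a , inj₁ a<1 , *-pos (Y-q-pos Y-q-nonneg) (inverse-pos scale-pos D-inv) , at (proj₁ q-ray) , at (proj₂ q-ray)
      where
      o = position (b (ray r))
      s⁻¹ = proj₁ (invertible (<⇒≉0 (+-pos 0<y₀ 0<y₁)))
      s-inv = proj₂ (invertible (<⇒≉0 (+-pos 0<y₀ 0<y₁)))
      0<s⁻¹ = inverse-pos (+-pos 0<y₀ 0<y₁) s-inv
      D⁻¹ = proj₁ (invertible scale≉0)
      D-inv = proj₂ (invertible scale≉0)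
      a = y₀ * s⁻¹
      0<a = *-pos 0<y₀ 0<s⁻¹
      1-a : y₁ * s⁻¹ ≈ 1# ∸ a
      1-a = trans (solve 3 (λ y₀ y₁ s → y₁ :* s := (y₀ :+ y₁) :* s :- y₀ :* s) ref y₀ y₁ s⁻¹) (+-congʳ s-inv)
      a<1 = 0<∸⇒< (<-resp ref 1-a (*-pos 0<y₁ 0<s⁻¹))
      q = (position (src f) +ₚ a · vec f) -ₚ o
      cross-q : ∀ w → cross q w ≈ (1# ∸ a) * (cross (position (src f)) w ∸ cross o w) + a * (cross (position (tgt f)) w ∸ cross o w)
      cross-q w = trans (cross-∸ _ o w) (trans (+-congʳ (trans (cross-+ _ _ w) (+-congˡ (trans (cross-· a (vec f) w) (*-congˡ (cross-∸ _ _ w))))))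
        (solve 4 (λ p p′ o a → (p :+ a :* (p′ :- p)) :- o := (con 1ℤ :- a) :* (p :- o) :+ a :* (p′ :- o)) ref _ _ _ a))
      X-q : X q ≈ 0#
      X-q = trans (cross-q 𝔩) (trans (+-congʳ (*-congʳ (sym 1-a)))
        (trans (solve 5 (λ y₀ y₁ s p p′ → y₁ :* s :* p :+ y₀ :* s :* p′ := s :* (y₁ :* p :+ y₀ :* p′)) ref y₀ y₁ s⁻¹ _ _)
          (trans (*-congˡ balance) (zeroʳ _))))
      above : ∀ v → 0# ≤ Y (position v) ∸ Y o
      above v = ≤⇒0≤∸ (≤-resp (sym (Y-boundary (ray r))) ref (Y-above v))
      Y-q-nonneg : 0# ≤ Y q
      Y-q-nonneg = ≤-resp ref (sym (cross-q direction)) (+-nonneg (*-nonneg (≤⇒0≤∸ (inj₁ a<1)) (above (src f))) (*-nonneg (inj₁ 0<a) (above (tgt f))))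
      Y-q-pos : 0# ≤ Y q → 0# < Y q
      Y-q-pos (inj₁ h) = h
      Y-q-pos (inj₂ h) = ⊥-elim (ray-misses {f} {r} {a} f≢ f≢′ (inj₁ 0<a) (inj₁ a<1)
        (equal (proj₁ q≈0) , equal (proj₂ q≈0)))
        where
        q≈0 = coordinates-zero q X-q (sym h)
        equal : ∀ {x y} → x ∸ y ≈ 0# → y ≈ x
        equal {x} {y} e = trans (solve 2 (λ x y → y := x :- (x :- y)) ref x y) (trans (+-congˡ (-‿cong e)) (solve 1 (λ x → x :- con 0ℤ := x) ref x))
      q-ray = cramer q X-q
      at : ∀ {p o l} → scale * (p ∸ o) ≈ Y q * l → p ≈ o + Y q * D⁻¹ * l
      at {p} {o} {l} h = trans (solve 2 (λ p o → p := o :+ con 1ℤ :* (p :- o)) ref p o) (+-congˡ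
        (trans (*-congʳ (sym D-inv)) (trans (solve 3 (λ d i x → d :* i :* x := i :* (d :* x)) ref scale D⁻¹ (p ∸ o))
          (trans (*-congˡ h) (solve 3 (λ i y l → i :* (y :* l) := y :* i :* l) ref D⁻¹ (Y q) l)))))

  crossing-parity : ∀ {f r} → src f ≢ b (ray r) → tgt f ≢ b (ray r) →
    bit (crossing? f (ray r)) ≡ rightOf (ray r) (src f) ℙ.+ rightOf (ray r) (tgt f)
  crossing-parity {f} {r} f≢ f≢′ = go (nonzero-cases (X-distinct (ray r) f≢)) (nonzero-cases (X-distinct (ray r) f≢′))
    where
    d = crossing? f (ray r)
    go : 0# < shift (ray r) (src f) ⊎ shift (ray r) (src f) < 0# → 0# < shift (ray r) (tgt f) ⊎ shift (ray r) (tgt f) < 0# →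
         bit d ≡ rightOf (ray r) (src f) ℙ.+ rightOf (ray r) (tgt f)
    go (inj₁ h) (inj₁ h′) = ≡.trans (bit-no d (no-crossing {f} (inj₁ (h , h′)))) (≡.sym (≡.cong₂ ℙ._+_ (positive-1 h) (positive-1 h′)))
    go (inj₂ h) (inj₂ h′) = ≡.trans (bit-no d (no-crossing {f} (inj₂ (h , h′)))) (≡.sym (≡.cong₂ ℙ._+_ (positive-0 (inj₁ h)) (positive-0 (inj₁ h′))))
    go (inj₁ h) (inj₂ h′) = ≡.trans (bit-yes d (crosses-between {f} {r} f≢ f≢′ h (neg⇒0<- h′)
      (solve 2 (λ x y → (:- y) :* x :+ x :* y := con 0ℤ) ref _ _))) (≡.sym (≡.cong₂ ℙ._+_ (positive-1 h) (positive-0 (inj₁ h′))))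
    go (inj₂ h) (inj₁ h′) = ≡.trans (bit-yes d (crosses-between {f} {r} f≢ f≢′ (neg⇒0<- h) h′
      (solve 2 (λ x y → y :* x :+ (:- x) :* y := con 0ℤ) ref _ _))) (≡.sym (≡.cong₂ ℙ._+_ (positive-0 (inj₁ h)) (positive-1 h′)))

  -- The edge is not vertical, so it meets the line of its own ray at the common starting point
  -- only, which `Crosses` leaves out.
  crossing-source : ∀ {f i} → src f ≡ b i → bit (crossing? f i) ≡ 0ℙ
  crossing-source {f} {i} refl′ = bit-no (crossing? f i) λ (_ , a , t , _ , _ , 0<t , e) →
    let a≈0 = *-zero-cancel (X-edge f) (trans (*-comm _ a) (a-zero (X-crossing {f} {i} e))) in
    <⇒≉0 0<t (t-zero a≈0 e)
    where
    a-zero : ∀ {a} → shift i (src f) + a * (shift i (tgt f) ∸ shift i (src f)) ≈ 0# → a * proj₁ (edgeVector f) ≈ 0#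
    a-zero {a} h = trans (solve 4 (λ p p′ o a → a :* (p′ :- p) := ((p :- o) :+ a :* ((p′ :- o) :- (p :- o))) :- (p :- o)) ref _ _ (X (position (b i))) a)
      (trans (+-cong h (-‿cong (trans (+-congʳ (reflexive (≡.cong (X ∘ position) refl′))) (-‿inverseʳ _)))) (solve 0 (con 0ℤ :- con 0ℤ := con 0ℤ) ref))
    t-zero : ∀ {a t} → a ≈ 0# → position (src f) +ₚ a · vec f ≈ₚ position (b i) +ₚ t · 𝔩 → t ≈ 0#
    t-zero {a} {t} a≈0 e = *-zero-cancel scale≉0 (trans (*-comm _ t) (trans
      (solve 2 (λ y o → y := (o :+ y) :- o) ref (t * scale) (Y (position (b i))))
      (trans (+-congʳ (trans (sym (trans (cross-+ (position (b i)) (t · 𝔩) direction) (+-congˡ (cross-· t 𝔩 direction))))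
        (trans (sym (cross-cong₁ {w = direction} e)) (trans (cross-+ (position (src f)) (a · vec f) direction)
          (trans (+-cong (reflexive (≡.cong (Y ∘ position) refl′)) (trans (cross-· a (vec f) direction) (trans (*-congʳ a≈0) (zeroˡ _)))) (+-identityʳ _))))))
        (-‿inverseʳ _))))

-- The parity of winding plus crossings along a walk.

module WalkParity {c ℓ₁ ℓ₂ : Level} (K : OrderedField c ℓ₁ ℓ₂) {k n : ℕ} (N : Plabic.PlabicNetwork K k n)
  (𝔩 : Plabic.Point K) (gauge : Plabic.PlabicNetwork.IsGaugeRay N 𝔩) where
  open OrderedField K hiding (zero; refl) renaming (_-_ to _∸_)
  open Plabic K hiding (PlabicNetwork)
  open Plabic.PlabicNetwork N
  open Gauge 𝔩
  open FieldOrder K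
  open PlaneGeometry K
  open Walks digraph
  open Flows graph
  open NetworkGeometry K N 𝔩 gauge

  intParity : List Edge → Parity
  intParity P = parity (int P)

  rayCrossings : Fin k → List Edge → Parity
  rayCrossings r P = ∑ℙ P (λ f → bit (crossing? f (ray r)))

  intParity-rays : ∀ P → intParity P ≡ ∑ℙ (allFin k) (λ r → rayCrossings r P)
  intParity-rays []      = ≡.sym (∑ℙ-zero (allFin k) (λ _ → refl))
  intParity-rays (f ∷ P) = ≡.trans (ℙP.+-homo-+ (intₑ f) (int P)) (≡.trans
    (≡.cong₂ ℙ._+_ (parity-filter (λ r → crossing? f (ray r)) (allFin k)) (intParity-rays P))
    (≡.sym (∑ℙ-+ (allFin k) _ _)))

  intParity-++ : ∀ P Q → intParity (P ++ Q) ≡ intParity P ℙ.+ intParity Q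
  intParity-++ []      Q = refl
  intParity-++ (f ∷ P) Q = ≡.trans (ℙP.+-homo-+ (intₑ f) (int (P ++ Q))) (≡.trans
    (≡.cong (parity (intₑ f) ℙ.+_) (intParity-++ P Q)) (≡.trans (≡.sym (ℙP.+-assoc (parity (intₑ f)) _ _))
    (≡.cong (ℙ._+ intParity Q) (≡.sym (ℙP.+-homo-+ (intₑ f) (int P))))))

  rayCrossings-walk : ∀ {u w} r P → IsWalk u P w → (∀ {f} → f ∈ₗ P → src f ≢ b (ray r)) →
                      rayCrossings r P ≡ rightOf (ray r) u ℙ.+ rightOf (ray r) w
  rayCrossings-walk {u} r [] refl _ = ≡.sym (ℙP.p+p≡0ℙ (rightOf (ray r) u))
  rayCrossings-walk {u} {w} r (f ∷ P) (refl , p) h = ≡.trans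
    (≡.cong₂ ℙ._+_ (crossing-parity {f} {r} (h (here refl)) (source-no-in (ray∈I r))) (rayCrossings-walk r P p (h ∘ there)))
    (telescope (rightOf (ray r) (src f)) (rightOf (ray r) (tgt f)) (rightOf (ray r) w))

  cycle-int : ∀ {v γ} → IsCycle v γ → intParity γ ≡ 0ℙ
  cycle-int {v} {γ} cyc = ≡.trans (intParity-rays γ) (∑ℙ-zero (allFin k) λ r → ≡.trans
    (rayCrossings-walk r γ (proj₁ cyc) (λ f∈ e → let (g , _ , e′) = cycle-prev cyc f∈ in source-no-in (ray∈I r) (≡.trans e′ e)))
    (ℙP.p+p≡0ℙ (rightOf (ray r) v)))

  private
    between? : ∀ (i j s : Fin n) → Dec (Fin.toℕ i ℕ.⊓ Fin.toℕ j ℕ.< Fin.toℕ s × Fin.toℕ s ℕ.< Fin.toℕ i ℕ.⊔ Fin.toℕ j)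
    between? i j s = Fin.toℕ i ℕ.⊓ Fin.toℕ j ℕP.<? Fin.toℕ s ×-dec Fin.toℕ s ℕP.<? Fin.toℕ i ℕ.⊔ Fin.toℕ j

    -- In the adapted coordinates the boundary runs from right to left, so smaller indices are
    -- further right.
    right-below : ∀ {i s} → i Fin.< s → rightOf s (b i) ≡ 1ℙ
    right-below h = positive-1 (<⇒0<∸ (X-decreasing h))

    right-above : ∀ {i s} → s Fin.< i → rightOf s (b i) ≡ 0ℙ
    right-above {i} {s} h = positive-0 (inj₁ (0<-⇒neg (<-resp ref (flip-difference _ _) (<⇒0<∸ (X-decreasing h)))))
      where
      open IntegerSolver K
      flip-difference : ∀ x y → x ∸ y ≈ - (y ∸ x)
      flip-difference = solve 2 (λ x y → x :- y := :- (y :- x)) ref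

    between-parity : ∀ i j s → i ≢ s → j ≢ s → bit (between? i j s) ≡ rightOf s (b i) ℙ.+ rightOf s (b j)
    between-parity i j s i≢s j≢s = go (FinP.<-cmp i s) (FinP.<-cmp j s)
      where
      x = Fin.toℕ i
      y = Fin.toℕ j
      go : Tri (i Fin.< s) (i ≡ s) (s Fin.< i) → Tri (j Fin.< s) (j ≡ s) (s Fin.< j) →
           bit (between? i j s) ≡ rightOf s (b i) ℙ.+ rightOf s (b j)
      go (tri≈ _ h _) _ = contradiction h i≢s
      go (tri< _ _ _) (tri≈ _ h _) = contradiction h j≢s
      go (tri> _ _ _) (tri≈ _ h _) = contradiction h j≢s
      go (tri< h _ _) (tri< h′ _ _) = ≡.trans (bit-no (between? i j s) (λ (_ , l) → ℕP.<-asym l (ℕP.⊔-pres-<m h h′)))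
        (≡.sym (≡.cong₂ ℙ._+_ (right-below h) (right-below h′)))
      go (tri> _ _ h) (tri> _ _ h′) = ≡.trans (bit-no (between? i j s) (λ (l , _) → ℕP.<-asym l (ℕP.⊓-glb h h′)))
        (≡.sym (≡.cong₂ ℙ._+_ (right-above h) (right-above h′)))
      go (tri< h _ _) (tri> _ _ h′) = ≡.trans (bit-yes (between? i j s) (ℕP.≤-<-trans (ℕP.m⊓n≤m x y) h , ℕP.<-≤-trans h′ (ℕP.m≤n⊔m x y)))
        (≡.sym (≡.cong₂ ℙ._+_ (right-below h) (right-above h′)))
      go (tri> _ _ h) (tri< h′ _ _) = ≡.trans (bit-yes (between? i j s) (ℕP.≤-<-trans (ℕP.m⊓n≤n x y) h′ , ℕP.<-≤-trans h (ℕP.m≤m⊔n x y)))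
        (≡.sym (≡.cong₂ ℙ._+_ (right-above h) (right-below h′)))

    between-end : ∀ i j → bit (between? i j i) ≡ 0ℙ
    between-end i j = bit-no (between? i j i) λ (l , l′) → case ℕP.≤-total (Fin.toℕ i) (Fin.toℕ j) of λ
      { (inj₁ h) → ℕP.<-irrefl (ℕP.m≤n⇒m⊓n≡m h) l
      ; (inj₂ h) → ℕP.<-irrefl (≡.sym (ℕP.m≥n⇒m⊔n≡m h)) l′ }

  module _ (r : Fin k) {j : Fin n} (j∉I : j ∉ Columns.set I) where

    private
      i = ray r

      i≢j : i ≢ j
      i≢j e = j∉I (≡.subst (_∈ Columns.set I) e (ray∈I r))

    -- Crossings with another source's ray telescope to whether it separates `i` from `j`. On the
    -- own ray the first edge does not count and the telescoping begins at `tgt e`; this leaves the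
    -- extra term.
    path-int : ∀ e P → IsWalk (b i) (e ∷ P) (b j) →
      intParity (e ∷ P) ≡ parity (sourcesBetween i j) ℙ.+ (rightOf i (tgt e) ℙ.+ rightOf i (b j))
    path-int e P (e-src , p) = ≡.trans (intParity-rays (e ∷ P)) (≡.trans
      (∑ℙ-except (allFin k) (allFin⁺ k) (∈-allFin r) others own)
      (≡.cong (ℙ._+ (rightOf i (tgt e) ℙ.+ rightOf i (b j)))
        (≡.sym (parity-filter (λ s → between? i j (ray s)) (allFin k)))))
      where
      inner : ∀ {f} → f ∈ₗ P → ∀ s → src f ≢ b (ray s)
      inner f∈ s h with walk-prev P p f∈
      ... | inj₁ h′           = source-no-in (ray∈I s) (≡.trans (≡.sym h′) h)
      ... | inj₂ (g , _ , h′) = source-no-in (ray∈I s) (≡.trans h′ h)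
      others : ∀ {s} → s ≢ r → rayCrossings s (e ∷ P) ≡ bit (between? i j (ray s))
      others {s} s≢r = ≡.trans
        (rayCrossings-walk s (e ∷ P) (e-src , p) (λ { (here refl) h → s≢r (ray-injective (b-injective (≡.trans (≡.sym h) e-src)))
                                                    ; (there f∈) h → inner f∈ s h }))
        (≡.sym (between-parity i j (ray s) (λ h → s≢r (ray-injective (≡.sym h)))
          (λ h → j∉I (≡.subst (_∈ Columns.set I) (≡.sym h) (ray∈I s)))))
      own : rayCrossings r (e ∷ P) ≡ bit (between? i j i) ℙ.+ (rightOf i (tgt e) ℙ.+ rightOf i (b j))
      own = ≡.cong₂ ℙ._+_ (≡.trans (crossing-source {e} e-src) (≡.sym (between-end i j))) (rayCrossings-walk r P p (λ f∈ → inner f∈ r))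

    private
      walk-above : ∀ {x} P → IsWalk x P (b j) → (∃[ f ] tgt f ≡ x) → Above (pt (b i)) (polyline x P)
      walk-above []      refl       _       = lift (trans (Y-boundary j) (sym (Y-boundary i)))
      walk-above (g ∷ P) (refl , p) (f , e) = lift (high (src g) refl) , walk-above P p (g , refl)
        where
        high : ∀ x → src g ≡ x → Y (position (b i)) < Y (position (src g))
        high (inj₁ l) h = ⊥-elim (no-transit (≡.trans e h) h)
        high (inj₂ v) h = <-resp (sym (Y-boundary i)) (reflexive (≡.cong (Y ∘ position) (≡.sym h))) (Y-internal v)

      -- All intermediate vertices are internal, so the path is an arch over the boundary and
      -- `arch-turning` applies with feet `b i` and `b j`. The result is the extra term of
      -- `path-int`.
      path-wind : ∀ e P → IsWalk (b i) (e ∷ P) (b j) → Unique (sources (e ∷ P)) → b j ∉ₗ sources (e ∷ P) →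
        windParity (e ∷ P) ≡ rightOf i (tgt e) ℙ.+ rightOf i (b j)
      path-wind e P (e-src , p) uq j∉ = begin
        windParity (e ∷ P)  ≡⟨ tangent-wind (e ∷ P) (e-src , p) ⟨
        tangentTurns (polyline (b i) (e ∷ P))
          ≡⟨ arch-turning (pt (b i)) (pt (tgt e)) (map (pt ∘ tgt) P) (simple-polyline (e ∷ P) (e-src , p) uq j∉)
               (walk-above P p (e , refl)) (λ (h , _) → apart-ends (≡.subst (λ z → proj₁ (z -ₚ pt (b i)) ≈ 0#) end h)) ⟩
        side (pt (tgt e) -ₚ pt (b i)) ℙ.+ side (endpoint (pt (tgt e)) (map (pt ∘ tgt) P) -ₚ pt (b i))
          ≡⟨ ≡.cong (λ z → side (pt (tgt e) -ₚ pt (b i)) ℙ.+ side (z -ₚ pt (b i))) end ⟩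
        side (pt (tgt e) -ₚ pt (b i)) ℙ.+ side (pt (b j) -ₚ pt (b i))
          ≡⟨ ≡.cong₂ ℙ._+_ (side-positive {pt (tgt e) -ₚ pt (b i)} (X-distinct i (source-no-in (ray∈I r))))
                           (side-positive {pt (b j) -ₚ pt (b i)} apart-ends) ⟩
        rightOf i (tgt e) ⁻¹ ℙ.+ rightOf i (b j) ⁻¹  ≡⟨ flip-both (rightOf i (tgt e)) (rightOf i (b j)) ⟩
        rightOf i (tgt e) ℙ.+ rightOf i (b j) ∎
        where
        open ≡.≡-Reasoning
        end = endpoint-walk P p
        apart-ends : ¬ shift i (b j) ≈ 0#
        apart-ends = X-distinct i (λ h → i≢j (≡.sym (b-injective h)))
        flip-both : ∀ x y → x ⁻¹ ℙ.+ y ⁻¹ ≡ x ℙ.+ y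
        flip-both 0ℙ 0ℙ = refl
        flip-both 0ℙ 1ℙ = refl
        flip-both 1ℙ 0ℙ = refl
        flip-both 1ℙ 1ℙ = refl

    path-parity : ∀ P → IsWalk (b i) P (b j) → Unique (sources P) → b j ∉ₗ sources P →
      windParity P ℙ.+ intParity P ≡ parity (sourcesBetween i j)
    path-parity []      p _  _  = contradiction (b-injective p) i≢j
    path-parity (e ∷ P) p uq j∉ = ≡.trans (≡.cong₂ ℙ._+_ (path-wind e P p uq j∉) (path-int e P p))
      (solveℙ 3 (λ x y z → (x ⊞ y) ⊞ (z ⊞ (x ⊞ y)) ⊜ z)
        refl (rightOf i (tgt e)) (rightOf i (b j)) (parity (sourcesBetween i j)))

    private
      transfer-parity : ∀ {x y} → Transfer (b i) (b j) x y →
        windParity (proj₂ x) ℙ.+ intParity (proj₂ x) ≡ (windParity (proj₂ y) ℙ.+ intParity (proj₂ y)) ⁻¹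
      transfer-parity (transfer {P₀} {γ} {R} {v} refl refl p cyc r _ _ _) = go P₀ (List.initLast P₀) R p r
        where
        -- The loop enters and leaves its base point, which is therefore internal. So the walk has
        -- an edge before the loop and one after it, as `wind-splice` requires.
        v-inner : ∀ l → v ≢ b l
        v-inner l refl = let (f , f∈ , e) = source⁻ γ (proj₂ (proj₂ cyc)) ; (g , _ , e′) = cycle-prev cyc f∈ in no-transit (≡.trans e′ e) e
        go : ∀ P₀ → List.InitLast P₀ → ∀ R → IsWalk (b i) P₀ v → IsWalk v R (b j) →
          windParity ((P₀ ++ γ) ++ R) ℙ.+ intParity ((P₀ ++ γ) ++ R) ≡ (windParity (P₀ ++ R) ℙ.+ intParity (P₀ ++ R)) ⁻¹
        go _ List.[] R p r = ⊥-elim (v-inner i (≡.sym p))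
        go _ (A List.∷ʳ′ a) [] p r = ⊥-elim (v-inner j r)
        go _ (A List.∷ʳ′ a) (f ∷ R) p (f-src , r) = ≡.trans
          (≡.cong₂ ℙ._+_ (≡.trans (≡.cong windParity (++-assoc (A ++ a ∷ []) γ (f ∷ R)))
                                  (wind-splice A a γ f R (proj₂ (proj₂ (proj₂ (walk-split A p)))) cyc f-src)) ints)
          (inverse-+ (windParity ((A ++ a ∷ []) ++ f ∷ R)) _)
          where
          ints : intParity (((A ++ a ∷ []) ++ γ) ++ f ∷ R) ≡ intParity ((A ++ a ∷ []) ++ f ∷ R)
          ints = ≡.trans (intParity-++ ((A ++ a ∷ []) ++ γ) (f ∷ R)) (≡.trans
            (≡.cong (ℙ._+ intParity (f ∷ R)) (≡.trans (intParity-++ (A ++ a ∷ []) γ)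
              (≡.trans (≡.cong (intParity (A ++ a ∷ []) ℙ.+_) (cycle-int cyc)) (ℙP.+-identityʳ (intParity (A ++ a ∷ []))))))
            (≡.sym (intParity-++ (A ++ a ∷ []) (f ∷ R))))
          inverse-+ : ∀ x y → x ⁻¹ ℙ.+ y ≡ (x ℙ.+ y) ⁻¹
          inverse-+ 0ℙ y = refl
          inverse-+ 1ℙ y = ≡.sym (ℙP.⁻¹-involutive y)

      transfer-shorter : ∀ {x y} → Transfer (b i) (b j) x y → length (proj₂ y) ℕ.< length (proj₂ x)
      transfer-shorter (transfer {γ = []} _ _ _ (_ , _ , ()) _ _ _ _)
      transfer-shorter (transfer {P₀} {f ∷ Q} {R} refl refl _ _ _ _ _ _) = ≡.subst₂ ℕ._<_
        (≡.sym (ListP.length-++ P₀)) (≡.sym (≡.trans (≡.cong length (++-assoc P₀ (f ∷ Q) R)) (ListP.length-++ P₀)))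
        (ℕP.+-monoʳ-< (length P₀) (s≤s (≡.subst (length R ℕ.≤_) (≡.sym (ListP.length-++ Q)) (ℕP.m≤n+m (length R) (length Q)))))

      empty-circulation : Circulation Subset.⊥
      empty-circulation = record
        { out = λ f∈ → ⊥-elim (∉⊥ f∈) ; inn = λ f∈ → ⊥-elim (∉⊥ f∈) ; next = λ f∈ → ⊥-elim (∉⊥ f∈) ; prev = λ f∈ → ⊥-elim (∉⊥ f∈) }

    -- Starting from the empty flow, a transfer is the removal of the first loop of the walk. The
    -- flow collected is discarded each time, and the walk gets shorter.
    walk-parity : ∀ P → IsWalk (b i) P (b j) →
      windParity P ℙ.+ intParity P ≡ parity (sourcesBetween i j) ℙ.+ parity (loopsErased (b i) P)
    walk-parity P p = go (suc (length P)) P p ℕP.≤-refl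
      where
      go : ∀ fuel P → IsWalk (b i) P (b j) → length P ℕ.< fuel →
           windParity P ℙ.+ intParity P ≡ parity (sourcesBetween i j) ℙ.+ parity (loopsErased (b i) P)
      go (suc fuel) P p (s≤s short) with transfer-total empty-circulation p
      ... | inj₁ ((uq , _) , j∉ , _) = ≡.trans (path-parity P p uq j∉) (≡.sym (≡.trans
        (≡.cong (λ l → parity (sourcesBetween i j) ℙ.+ parity l) (loopsErased-simple P p uq j∉)) (ℙP.+-identityʳ _)))
      ... | inj₂ (inj₁ (y , t)) = ≡.trans (transfer-parity t) (≡.trans
        (≡.cong _⁻¹ (go fuel (proj₂ y) (proj₂ (transfer-walk t)) (ℕP.<-≤-trans (transfer-shorter t) short)))
        (≡.trans (inverse-out (parity (sourcesBetween i j)) (loopsErased (b i) (proj₂ y)))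
          (≡.cong (λ l → parity (sourcesBetween i j) ℙ.+ parity l) (≡.sym (transfer-loops t)))))
        where
        inverse-out : ∀ x l → (x ℙ.+ parity l) ⁻¹ ≡ x ℙ.+ parity (suc l)
        inverse-out 0ℙ l = ≡.sym (ℙP.+-homo-+ 1 l)
        inverse-out 1ℙ l = ≡.cong _⁻¹ (≡.sym (ℙP.+-homo-+ 1 l))
      ... | inj₂ (inj₂ (y , t)) = ⊥-elim (let (f , f∈ , _) = source⁻ (Transfer.γ t) (proj₂ (proj₂ (Transfer.cycle t))) in ∉⊥ (flow⁺ʳ t f∈))

-- Power series that represent rational functions.

module Series {c ℓ₁ ℓ₂ : Level} (K : OrderedField c ℓ₁ ℓ₂) where
  open OrderedField K hiding (zero; refl) renaming (_-_ to _∸_)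
  open Plabic K hiding (PlabicNetwork)
  open IntegerSolver K
  open FieldOrder K
  open Algebra.Properties.Semiring.Exp semiring using (_^_; ^-homo-*)
  open import Relation.Binary.Reasoning.Setoid setoid

  when : ∀ {p} {P : Set p} → Dec P → Carrier → Carrier
  when d x = if does d then x else 0#

  when-cong : ∀ {p q} {P : Set p} {Q : Set q} (d : Dec P) (d′ : Dec Q) → (P → Q) → (Q → P) →
              ∀ {x y} → (P → x ≈ y) → when d x ≈ when d′ y
  when-cong (yes p) (yes _) _ _ e = e p
  when-cong (no _)  (no _)  _ _ e = ref
  when-cong (yes p) (no ¬q) f _ e = contradiction (f p) ¬q
  when-cong (no ¬p) (yes q) _ g e = contradiction (g q) ¬p

  *-when : ∀ {p} {P : Set p} (d : Dec P) a {x} → a * when d x ≈ when d (a * x)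
  *-when (yes _) a = ref
  *-when (no _)  a = zeroʳ a

  when-* : ∀ {p} {P : Set p} (d : Dec P) a {x} → when d x * a ≈ when d (x * a)
  when-* (yes _) a = ref
  when-* (no _)  a = zeroˡ a

  module _ {a} {A : Set a} where

    ∑-cong : ∀ (xs : List A) {f g} → (∀ x → f x ≈ g x) → ∑ xs f ≈ ∑ xs g
    ∑-cong []       e = ref
    ∑-cong (x ∷ xs) e = +-cong (e x) (∑-cong xs e)

    ∑-cong-∈ : ∀ (xs : List A) {f g} → (∀ {x} → x ∈ₗ xs → f x ≈ g x) → ∑ xs f ≈ ∑ xs g
    ∑-cong-∈ []       e = ref
    ∑-cong-∈ (x ∷ xs) e = +-cong (e (here refl)) (∑-cong-∈ xs (e ∘ there))

    ∑-zero : ∀ (xs : List A) {f} → (∀ x → f x ≈ 0#) → ∑ xs f ≈ 0#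
    ∑-zero []       e = ref
    ∑-zero (x ∷ xs) e = trans (+-cong (e x) (∑-zero xs e)) (+-identityˡ 0#)

    ∑-++ : ∀ (xs ys : List A) f → ∑ (xs ++ ys) f ≈ ∑ xs f + ∑ ys f
    ∑-++ []       ys f = sym (+-identityˡ _)
    ∑-++ (x ∷ xs) ys f = trans (+-congˡ (∑-++ xs ys f)) (sym (+-assoc _ _ _))

    ∑-+ : ∀ (xs : List A) f g → ∑ xs (λ x → f x + g x) ≈ ∑ xs f + ∑ xs g
    ∑-+ []       f g = sym (+-identityˡ 0#)
    ∑-+ (x ∷ xs) f g = trans (+-congˡ (∑-+ xs f g))
      (solve 4 (λ a b c d → (a :+ b) :+ (c :+ d) := (a :+ c) :+ (b :+ d)) ref _ _ _ _)

    ∑-*ˡ : ∀ (xs : List A) c f → c * ∑ xs f ≈ ∑ xs (λ x → c * f x)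
    ∑-*ˡ []       c f = zeroʳ c
    ∑-*ˡ (x ∷ xs) c f = trans (distribˡ c _ _) (+-congˡ (∑-*ˡ xs c f))

    ∑-*ʳ : ∀ (xs : List A) c f → ∑ xs f * c ≈ ∑ xs (λ x → f x * c)
    ∑-*ʳ []       c f = zeroˡ c
    ∑-*ʳ (x ∷ xs) c f = trans (distribʳ c _ _) (+-congˡ (∑-*ʳ xs c f))

    ∑-swap : ∀ {b} {B : Set b} (xs : List A) (ys : List B) (f : A → B → Carrier) → ∑ xs (λ x → ∑ ys (f x)) ≈ ∑ ys (λ y → ∑ xs (λ x → f x y))
    ∑-swap []       ys f = sym (∑-zero′ ys)
      where
      ∑-zero′ : ∀ {b} {B : Set b} (ys : List B) → ∑ ys (λ _ → 0#) ≈ 0#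
      ∑-zero′ []       = ref
      ∑-zero′ (y ∷ ys) = trans (+-identityˡ _) (∑-zero′ ys)
    ∑-swap {B = B} (x ∷ xs) ys f = trans (+-congˡ (∑-swap xs ys f)) (sym (∑-+′ ys))
      where
      ∑-+′ : (ys : List B) → ∑ ys (λ y → f x y + ∑ xs (λ x → f x y)) ≈ ∑ ys (f x) + ∑ ys (λ y → ∑ xs (λ x → f x y))
      ∑-+′ []       = sym (+-identityˡ 0#)
      ∑-+′ (y ∷ ys) = trans (+-congˡ (∑-+′ ys)) (solve 4 (λ a b c d → (a :+ b) :+ (c :+ d) := (a :+ c) :+ (b :+ d)) ref _ _ _ _)

    ∑-map : ∀ {b} {B : Set b} (h : B → A) ys f → ∑ (map h ys) f ≈ ∑ ys (f ∘ h)
    ∑-map h []       f = ref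
    ∑-map h (y ∷ ys) f = +-congˡ (∑-map h ys f)

    ∑-concatMap : ∀ {b} {B : Set b} (h : B → List A) ys f → ∑ (concatMap h ys) f ≈ ∑ ys (λ y → ∑ (h y) f)
    ∑-concatMap h []       f = ref
    ∑-concatMap h (y ∷ ys) f = trans (∑-++ (h y) (concatMap h ys) f) (+-congˡ (∑-concatMap h ys f))

    ∑-filter : ∀ {p} {P : A → Set p} (P? : ∀ x → Dec (P x)) xs f → ∑ (filter P? xs) f ≈ ∑ xs (λ x → when (P? x) (f x))
    ∑-filter P? []       f = ref
    ∑-filter P? (x ∷ xs) f with P? x
    ... | yes _ = +-congˡ (∑-filter P? xs f)
    ... | no  _ = trans (∑-filter P? xs f) (sym (+-identityˡ _))

    ∑-single : ∀ {x₀} (_≟_ : ∀ (x y : A) → Dec (x ≡ y)) xs → Unique xs → x₀ ∈ₗ xs → (f : A → Carrier) → ∑ xs (λ x → when (x₀ ≟ x) (f x)) ≈ f x₀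
    ∑-single {x₀} _≟_ (x ∷ xs) u (here refl) f = trans (+-cong (first (x₀ ≟ x₀)) (others xs (Unique[x∷xs]⇒x∉xs u))) (+-identityʳ _)
      where
      first : (d : Dec (x₀ ≡ x₀)) → when d (f x₀) ≈ f x₀
      first (yes _) = ref
      first (no ¬e) = contradiction refl ¬e
      others : ∀ ys → x₀ ∉ₗ ys → ∑ ys (λ x → when (x₀ ≟ x) (f x)) ≈ 0#
      others []       _  = ref
      others (y ∷ ys) x∉ with x₀ ≟ y
      ... | yes refl = contradiction (here refl) x∉
      ... | no _     = trans (+-identityˡ _) (others ys (x∉ ∘ there))
    ∑-single {x₀} _≟_ (x ∷ xs) u@(_ ∷ u′) (there x₀∈) f with x₀ ≟ x
    ... | yes refl = contradiction x₀∈ (Unique[x∷xs]⇒x∉xs u)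
    ... | no _     = trans (+-identityˡ _) (∑-single _≟_ xs u′ x₀∈ f)

    ∏-cong : ∀ (xs : List A) {f g} → (∀ x → f x ≈ g x) → ∏ xs f ≈ ∏ xs g
    ∏-cong []       e = ref
    ∏-cong (x ∷ xs) e = *-cong (e x) (∏-cong xs e)

    ∏-* : ∀ (xs : List A) f g → ∏ xs (λ x → f x * g x) ≈ ∏ xs f * ∏ xs g
    ∏-* []       f g = sym (*-identityˡ 1#)
    ∏-* (x ∷ xs) f g = trans (*-congˡ (∏-* xs f g)) (solve 4 (λ a b c d → (a :* b) :* (c :* d) := (a :* c) :* (b :* d)) ref _ _ _ _)

  module _ {m : ℕ} where

    infixl 6 _⊕_ _⊖_
    infix 4 _≼_ _≼?_
    _⊕_ _⊖_ : Monomial m → Monomial m → Monomial m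
    _⊕_ = zipWith ℕ._+_
    _⊖_ = zipWith ℕ._∸_

    _≼_ : Monomial m → Monomial m → Set
    _≼_ = Pointwise ℕ._≤_

    _≼?_ : ∀ β α → Dec (β ≼ α)
    _≼?_ = Pointwise.decidable ℕP._≤?_

  ⊕⇒≼ : ∀ {m} {α β γ : Monomial m} → β ⊕ γ ≡ α → β ≼ α
  ⊕⇒≼ {α = []}    {[]}    {[]}    _    = []
  ⊕⇒≼ {α = _ ∷ _} {b ∷ β} {g ∷ γ} refl = ℕP.m≤m+n b g ∷ ⊕⇒≼ {β = β} refl

  ⊕⇒⊖ : ∀ {m} {α β γ : Monomial m} → β ⊕ γ ≡ α → γ ≡ α ⊖ β
  ⊕⇒⊖ {α = []}    {[]}    {[]}    _    = refl
  ⊕⇒⊖ {α = _ ∷ _} {b ∷ β} {g ∷ γ} refl = ≡.cong₂ _∷_ (≡.sym (ℕP.m+n∸m≡n b g)) (⊕⇒⊖ {β = β} refl)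

  ⊕-⊖ : ∀ {m} {α β : Monomial m} → β ≼ α → β ⊕ (α ⊖ β) ≡ α
  ⊕-⊖ []      = refl
  ⊕-⊖ (h ∷ t) = ≡.cong₂ _∷_ (ℕP.m+[n∸m]≡n h) (⊕-⊖ t)

  ⊕-assoc : ∀ {m} (α β γ : Monomial m) → (α ⊕ β) ⊕ γ ≡ α ⊕ (β ⊕ γ)
  ⊕-assoc = VecP.zipWith-assoc ℕP.+-assoc

  ⊕-comm : ∀ {m} (α β : Monomial m) → α ⊕ β ≡ β ⊕ α
  ⊕-comm = VecP.zipWith-comm ℕP.+-comm

  -- The hypotheses say that β ⊕ γ ≼ α, which is symmetric.
  ≼-exchange : ∀ {m} {α β γ : Monomial m} → β ≼ α → γ ≼ α ⊖ β → γ ≼ α × β ≼ α ⊖ γ × (α ⊖ β) ⊖ γ ≡ (α ⊖ γ) ⊖ β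
  ≼-exchange {α = α} {β} {γ} h k = ⊕⇒≼ {β = γ} total , ≡.subst (β ≼_) rest (⊕⇒≼ {β = β} refl) ,
    ⊕⇒⊖ {β = β} (≡.subst (β ⊕ δ ≡_) rest refl)
    where
    δ = (α ⊖ β) ⊖ γ
    total : γ ⊕ (β ⊕ δ) ≡ α
    total = ≡.trans (≡.sym (⊕-assoc γ β δ)) (≡.trans (≡.cong (_⊕ δ) (⊕-comm γ β))
      (≡.trans (⊕-assoc β γ δ) (≡.trans (≡.cong (β ⊕_) (⊕-⊖ k)) (⊕-⊖ h))))
    rest : β ⊕ δ ≡ α ⊖ γ
    rest = ⊕⇒⊖ {β = γ} total

  module _ {m : ℕ} where

    ⊛-cong : ∀ (q : Polynomial m) {S T : Series m} → (∀ α → S α ≈ T α) → ∀ α → (q ⊛ S) α ≈ (q ⊛ T) α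
    ⊛-cong q e α = ∑-cong q λ (a , β) → when-cong (β ≼? α) (β ≼? α) id id (λ _ → *-congˡ (e _))

    -- Both sides are sums over pairs of terms whose product divides `α`, a symmetric condition.
    ⊛-comm : ∀ (q r : Polynomial m) (S : Series m) α → (q ⊛ (r ⊛ S)) α ≈ (r ⊛ (q ⊛ S)) α
    ⊛-comm q r S α = begin
      (q ⊛ (r ⊛ S)) α                          ≈⟨ ∑-cong q (λ (a , β) → expand r α a β) ⟩
      ∑ q (λ x → ∑ r (λ y → term x y))         ≈⟨ ∑-swap q r term ⟩
      ∑ r (λ y → ∑ q (λ x → term x y))         ≈⟨ ∑-cong r (λ (b , γ) → ∑-cong q (λ (a , β) → exchange a b β γ)) ⟩
      ∑ r (λ y → ∑ q (λ x → term y x))         ≈⟨ ∑-cong r (λ (b , γ) → expand q α b γ) ⟨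
      (r ⊛ (q ⊛ S)) α ∎
      where
      term : Carrier × Monomial m → Carrier × Monomial m → Carrier
      term (a , β) (b , γ) = when (β ≼? α ×-dec γ ≼? (α ⊖ β)) (a * (b * S ((α ⊖ β) ⊖ γ)))
      nested : ∀ {p q} {P : Set p} {Q : Set q} (d : Dec P) (d′ : Dec Q) {a x} → when d (a * when d′ x) ≈ when (d ×-dec d′) (a * x)
      nested (yes _) (yes _) = ref
      nested (yes _) (no _)  = zeroʳ _
      nested (no _)  _       = ref
      expand : ∀ r α a β → when (β ≼? α) (a * (r ⊛ S) (α ⊖ β)) ≈
               ∑ r (λ (b , γ) → when (β ≼? α ×-dec γ ≼? (α ⊖ β)) (a * (b * S ((α ⊖ β) ⊖ γ))))
      expand r α a β = trans (trans (when-cong (β ≼? α) (β ≼? α) id id (λ _ → ∑-*ˡ r a _)) (pull r))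
        (∑-cong r λ (b , γ) → nested (β ≼? α) (γ ≼? (α ⊖ β)))
        where
        pull : ∀ r {f} → when (β ≼? α) (∑ r f) ≈ ∑ r (λ y → when (β ≼? α) (f y))
        pull r with β ≼? α
        ... | yes _ = ref
        ... | no _  = sym (∑-zero r (λ _ → ref))
      exchange : ∀ a b β γ → term (a , β) (b , γ) ≈ term (b , γ) (a , β)
      exchange a b β γ = when-cong (β ≼? α ×-dec γ ≼? (α ⊖ β)) (γ ≼? α ×-dec β ≼? (α ⊖ γ))
        (λ (h , k) → let (h′ , k′ , _) = ≼-exchange h k in h′ , k′)
        (λ (h , k) → let (h′ , k′ , _) = ≼-exchange h k in h′ , k′)
        (λ (h , k) → let (_ , _ , e) = ≼-exchange h k in
          trans (solve 3 (λ a b s → a :* (b :* s) := b :* (a :* s)) ref a b _) (*-congˡ (*-congˡ (reflexive (≡.cong S e)))))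

    multiply : Polynomial m → Polynomial m → Polynomial m
    multiply q p = concatMap (λ (a , β) → map (λ (b , γ) → a * b , β ⊕ γ) p) q

    coefficient-multiply : ∀ q p α → coefficient (multiply q p) α ≈ (q ⊛ coefficient p) α
    coefficient-multiply q p α = trans (∑-concatMap _ q _) (∑-cong q λ (a , β) → trans (∑-map _ p _) (row a β))
      where
      row : ∀ a β → ∑ p (λ (b , γ) → when ((β ⊕ γ) ≟ₘ α) (a * b)) ≈ when (β ≼? α) (a * coefficient p (α ⊖ β))
      row a β with β ≼? α
      ... | yes h = trans (∑-cong p λ (b , γ) → trans
              (when-cong ((β ⊕ γ) ≟ₘ α) (γ ≟ₘ (α ⊖ β)) (⊕⇒⊖ {β = β}) (λ { refl → ⊕-⊖ h }) (λ _ → ref))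
              (sym (*-when (γ ≟ₘ (α ⊖ β)) a)))
            (sym (∑-*ˡ p a _))
      ... | no ¬h = ∑-zero p λ (b , γ) → vanish ((β ⊕ γ) ≟ₘ α) (λ e → ¬h (⊕⇒≼ {β = β} e))
        where
        vanish : ∀ {P : Set} (d : Dec P) → ¬ P → ∀ {x} → when d x ≈ 0#
        vanish (yes p) ¬p = contradiction p ¬p
        vanish (no _)  _  = ref

    module _ (w : Fin m → Carrier) where

      monomial : Monomial m → Carrier
      monomial β = ∏ (allFin m) (λ i → w i ^ lookup β i)

      monomial-⊕ : ∀ β γ → monomial (β ⊕ γ) ≈ monomial β * monomial γ
      monomial-⊕ β γ = trans (∏-cong (allFin m) λ i → trans
          (reflexive (≡.cong (w i ^_) (VecP.lookup-zipWith ℕ._+_ i β γ))) (^-homo-* (w i) (lookup β i) (lookup γ i)))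
        (∏-* (allFin m) _ _)

      evaluate-multiply : ∀ q p → evaluate (multiply q p) w ≈ evaluate q w * evaluate p w
      evaluate-multiply q p = trans (∑-concatMap _ q _) (trans (∑-cong q λ (a , β) → trans (∑-map _ p _) (trans
          (∑-cong p λ (b , γ) → trans (*-congˡ (monomial-⊕ β γ))
            (solve 4 (λ a b x y → a :* b :* (x :* y) := (a :* x) :* (b :* y)) ref a b (monomial β) (monomial γ)))
          (sym (∑-*ˡ p _ _))))
        (sym (∑-*ʳ q _ _)))

      private
        -- A polynomial is a list in which monomials may repeat; a duplicate-free box containing
        -- them regroups its terms by coefficient.
        evaluate-box : ∀ (box : List (Monomial m)) → Unique box → ∀ p → (∀ {x} → x ∈ₗ p → proj₂ x ∈ₗ box) →
                       evaluate p w ≈ ∑ box (λ α → coefficient p α * monomial α)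
        evaluate-box box u p p⊆ = sym (begin
          ∑ box (λ α → coefficient p α * monomial α)
            ≈⟨ ∑-cong box (λ α → trans (∑-*ʳ p _ _) (∑-cong p (λ (a , β) → when-* (β ≟ₘ α) (monomial α)))) ⟩
          ∑ box (λ α → ∑ p (λ (a , β) → when (β ≟ₘ α) (a * monomial α)))
            ≈⟨ ∑-swap box p (λ α (a , β) → when (β ≟ₘ α) (a * monomial α)) ⟩
          ∑ p (λ (a , β) → ∑ box (λ α → when (β ≟ₘ α) (a * monomial α)))
            ≈⟨ ∑-cong-∈ p (λ {x} x∈ → ∑-single _≟ₘ_ box u (p⊆ x∈) (λ α → proj₁ x * monomial α)) ⟩
          evaluate p w ∎)

      evaluate-ext : ∀ p p′ → (∀ α → coefficient p α ≈ coefficient p′ α) → evaluate p w ≈ evaluate p′ w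
      evaluate-ext p p′ e = begin
        evaluate p w   ≈⟨ evaluate-box box u p (λ x∈ → ∈-deduplicate⁺ _≟ₘ_ (∈-++⁺ˡ (∈-map⁺ proj₂ x∈))) ⟩
        ∑ box (λ α → coefficient p α * monomial α)   ≈⟨ ∑-cong box (λ α → *-congʳ (e α)) ⟩
        ∑ box (λ α → coefficient p′ α * monomial α)
          ≈⟨ evaluate-box box u p′ (λ x∈ → ∈-deduplicate⁺ _≟ₘ_ (∈-++⁺ʳ (map proj₂ p) (∈-map⁺ proj₂ x∈))) ⟨
        evaluate p′ w  ∎
        where
        box = deduplicate _≟ₘ_ (map proj₂ p ++ map proj₂ p′)
        u = UniqueDec.deduplicate-! _≟ₘ_ (map proj₂ p ++ map proj₂ p′)

      -- As power series `q′ p = q′ q S = q q′ S = q p′`. Evaluation depends on the coefficients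
      -- alone, and neither denominator vanishes at `w`.
      SumsTo-unique : ∀ {S : Series m} {x y} → SumsTo S w x → SumsTo S w y → x ≈ y
      SumsTo-unique {S} {x} {y} (p , q , S-p , q≉0 , x-p) (p′ , q′ , S-p′ , q′≉0 , y-p′) =
        *-cancelˡ-≉0 q≉0 (*-cancelˡ-≉0 q′≉0 (begin
          Q′ * (Q * x)      ≈⟨ *-congˡ (trans (*-comm Q x) x-p) ⟩
          Q′ * evaluate p w ≈⟨ evaluate-multiply q′ p ⟨
          evaluate (multiply q′ p) w ≈⟨ evaluate-ext (multiply q′ p) (multiply q p′) same ⟩
          evaluate (multiply q p′) w ≈⟨ evaluate-multiply q p′ ⟩
          Q * evaluate p′ w ≈⟨ *-congˡ (sym y-p′) ⟩
          Q * (y * Q′)      ≈⟨ solve 3 (λ q q′ y → q :* (y :* q′) := q′ :* (q :* y)) ref Q Q′ y ⟩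
          Q′ * (Q * y)      ∎))
        where
        Q = evaluate q w
        Q′ = evaluate q′ w
        same : ∀ α → coefficient (multiply q′ p) α ≈ coefficient (multiply q p′) α
        same α = begin
          coefficient (multiply q′ p) α  ≈⟨ coefficient-multiply q′ p α ⟩
          (q′ ⊛ coefficient p) α         ≈⟨ ⊛-cong q′ S-p α ⟨
          (q′ ⊛ (q ⊛ S)) α               ≈⟨ ⊛-comm q′ q S α ⟩
          (q ⊛ (q′ ⊛ S)) α               ≈⟨ ⊛-cong q S-p′ α ⟩
          (q ⊛ coefficient p′) α         ≈⟨ coefficient-multiply q p′ α ⟨
          coefficient (multiply q p′) α  ∎

      SumsTo-resp : ∀ {S : Series m} {x y} → x ≈ y → SumsTo S w y → SumsTo S w x
      SumsTo-resp e (p , q , S-p , q≉0 , y-p) = p , q , S-p , q≉0 , trans (*-congʳ e) y-p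

-- Enumerations without repetition, and multiplicities of edges.

module _ {a} {A : Set a} where

  Unique-map-∈ : ∀ {b} {B : Set b} (h : A → B) xs → (∀ {x y} → x ∈ₗ xs → y ∈ₗ xs → h x ≡ h y → x ≡ y) → Unique xs → Unique (map h xs)
  Unique-map-∈ h []       inj []         = []
  Unique-map-∈ h (x ∷ xs) inj u@(_ ∷ u′) =
    AllP.¬Any⇒All¬ _ (λ k → let (y , y∈ , e) = ∈-map⁻ h k in
      Unique[x∷xs]⇒x∉xs u (≡.subst (_∈ₗ xs) (≡.sym (inj (here refl) (there y∈) e)) y∈))
    ∷ Unique-map-∈ h xs (λ p q → inj (there p) (there q)) u′

  ∈-concatMap⁻′ : ∀ {b} {B : Set b} (h : B → List A) {z} ys → z ∈ₗ concatMap h ys → ∃[ y ] y ∈ₗ ys × z ∈ₗ h y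
  ∈-concatMap⁻′ h (y ∷ ys) k with ∈-++⁻ (h y) k
  ... | inj₁ l = y , here refl , l
  ... | inj₂ l = let (y′ , y′∈ , l′) = ∈-concatMap⁻′ h ys l in y′ , there y′∈ , l′

  Unique-concatMap : ∀ {b} {B : Set b} (h : B → List A) ys → (∀ y → Unique (h y)) →
    (∀ {y y′ z} → z ∈ₗ h y → z ∈ₗ h y′ → y ≡ y′) → Unique ys → Unique (concatMap h ys)
  Unique-concatMap h []       uh disj []         = []
  Unique-concatMap h (y ∷ ys) uh disj u@(_ ∷ u′) =
    UniqueP.++⁺ (uh y) (Unique-concatMap h ys uh disj u′) λ (z∈ , z∈′) →
      let (y′ , y′∈ , z∈″) = ∈-concatMap⁻′ h ys z∈′ in
      Unique[x∷xs]⇒x∉xs u (≡.subst (_∈ₗ ys) (disj z∈″ z∈) y′∈)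

  ∈-concatMap⁺′ : ∀ {b} {B : Set b} (h : B → List A) {y z} ys → y ∈ₗ ys → z ∈ₗ h y → z ∈ₗ concatMap h ys
  ∈-concatMap⁺′ h (y ∷ ys) (here refl) k = ∈-++⁺ˡ k
  ∈-concatMap⁺′ h (y ∷ ys) (there y∈)  k = ∈-++⁺ʳ (h y) (∈-concatMap⁺′ h ys y∈ k)

subsets-complete : ∀ {m} (C : Subset m) → C ∈ₗ subsets m
subsets-complete []            = here refl
subsets-complete (outside ∷ C) = ∈-++⁺ˡ (∈-map⁺ (outside ∷_) (subsets-complete C))
subsets-complete (inside ∷ C)  = ∈-++⁺ʳ (map (outside ∷_) (subsets _)) (∈-map⁺ (inside ∷_) (subsets-complete C))

subsets-unique : ∀ m → Unique (subsets m)
subsets-unique zero    = [] ∷ []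
subsets-unique (suc m) = UniqueP.++⁺ (UniqueP.map⁺ VecP.∷-injectiveʳ (subsets-unique m)) (UniqueP.map⁺ VecP.∷-injectiveʳ (subsets-unique m))
  λ (h , k) → case ∈-map⁻ (outside ∷_) h of λ (_ , _ , e) → case ∈-map⁻ (inside ∷_) k of λ (_ , _ , e′) → case ≡.trans (≡.sym e) e′ of λ ()

module _ {m : ℕ} where

  occurrences : Fin m → List (Fin m) → ℕ
  occurrences f P = length (filter (FinP._≟ f) P)

  occurrences-++ : ∀ f P Q → occurrences f (P ++ Q) ≡ occurrences f P ℕ.+ occurrences f Q
  occurrences-++ f P Q = ≡.trans (≡.cong length (ListP.filter-++ (FinP._≟ f) P Q)) (ListP.length-++ (filter (FinP._≟ f) P))

  membership : Fin m → Subset m → ℕ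
  membership f C = if does (f ∈? C) then 1 else 0

  indicator : Subset m → Vec ℕ m
  indicator C = tabulate λ f → membership f C

  occurrences-fresh : ∀ f P → f ∉ₗ P → occurrences f P ≡ 0
  occurrences-fresh f []      _  = refl
  occurrences-fresh f (g ∷ P) f∉ with g FinP.≟ f
  ... | yes refl = contradiction (here refl) f∉
  ... | no _     = occurrences-fresh f P (f∉ ∘ there)

  occurrences-unique : ∀ f P → Unique P → f ∈ₗ P → occurrences f P ≡ 1
  occurrences-unique f (g ∷ P) u@(_ ∷ u′) h with g FinP.≟ f
  ... | yes refl = ≡.cong suc (occurrences-fresh f P (Unique[x∷xs]⇒x∉xs u))
  occurrences-unique f (g ∷ P) u (here refl) | no g≢f = contradiction refl g≢f
  occurrences-unique f (g ∷ P) (_ ∷ u) (there h) | no _ = occurrences-unique f P u h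

  membership-yes : ∀ {f C} → f ∈ C → membership f C ≡ 1
  membership-yes {f} {C} h with f ∈? C
  ... | yes _ = refl
  ... | no ¬h = contradiction h ¬h

  membership-no : ∀ {f C} → f ∉ C → membership f C ≡ 0
  membership-no {f} {C} h with f ∈? C
  ... | yes k = contradiction k h
  ... | no _  = refl

  membership-union : ∀ f C P → Unique P → (∀ {g} → g ∈ₗ P → g ∉ C) →
                     membership f (C ∪ support P) ≡ membership f C ℕ.+ occurrences f P
  membership-union f C P u disj with f ∈ₗ? P
  ... | yes h = ≡.trans (membership-yes {f} {C ∪ support P} (x∈p∪q⁺ (inj₂ (∈-support⁺ h))))
    (≡.sym (≡.cong₂ ℕ._+_ (membership-no (disj h)) (occurrences-unique f P u h)))
  ... | no ¬h = ≡.sym (≡.trans (≡.cong (membership f C ℕ.+_) (occurrences-fresh f P ¬h)) (≡.trans (ℕP.+-identityʳ _) same))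
    where
    same : membership f C ≡ membership f (C ∪ support P)
    same with f ∈? C
    ... | yes k = ≡.sym (membership-yes {f} {C ∪ support P} (x∈p∪q⁺ (inj₁ k)))
    ... | no ¬k = ≡.sym (membership-no {f} {C ∪ support P} (λ l → [ ¬k , (λ l′ → ¬h (∈-support⁻ l′)) ]′ (x∈p∪q⁻ C (support P) l)))

  vector-ext : ∀ {u v : Vec ℕ m} → (∀ f → lookup u f ≡ lookup v f) → u ≡ v
  vector-ext {u} {v} e = ≡.trans (≡.sym (VecP.tabulate∘lookup u)) (≡.trans (VecP.tabulate-cong e) (VecP.tabulate∘lookup v))

-- Cancellation along a matching.

module Cancellation {c ℓ₁ ℓ₂ : Level} (K : OrderedField c ℓ₁ ℓ₂) where
  open OrderedField K hiding (zero; refl) renaming (_-_ to _∸_)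
  open Plabic K hiding (PlabicNetwork)
  open IntegerSolver K
  open FieldOrder K
  open Series K

  module _ {a r} {A : Set a} (M : A → A → Set r) (M-sym : ∀ {x y} → M x y → M y x)
           (M-functional : ∀ {x y z} → M x y → M x z → y ≡ z) (M-irreflexive : ∀ {x} → ¬ M x x)
           (s : A → Carrier) where

    -- A symmetric functional relation gives each element one partner only, so deleting a pair
    -- leaves the partners of all other elements in the list.
    ∑-matched : ∀ L → Unique L → (∀ {x} → x ∈ₗ L → ∃[ y ] y ∈ₗ L × M x y × s x + s y ≈ 0#) → ∑ L s ≈ 0#
    ∑-matched L = go (length L) L ℕP.≤-refl
      where
      go : ∀ fuel L → length L ℕ.≤ fuel → Unique L → (∀ {x} → x ∈ₗ L → ∃[ y ] y ∈ₗ L × M x y × s x + s y ≈ 0#) → ∑ L s ≈ 0#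
      go _          []      _           _          _       = ref
      go (suc fuel) (x ∷ L) (s≤s short) u@(_ ∷ u′) partner with partner (here refl)
      ... | y , here refl , m , _ = contradiction m M-irreflexive
      ... | y , there y∈ , m , e with ∈-∃++ y∈
      ...   | A₁ , A₂ , refl = trans (+-congˡ (trans (∑-++ A₁ (y ∷ A₂) s) (trans
                (solve 3 (λ a b c → a :+ (b :+ c) := b :+ (a :+ c)) ref (∑ A₁ s) (s y) (∑ A₂ s)) (+-congˡ (sym (∑-++ A₁ A₂ s))))))
              (trans (sym (+-assoc _ _ _)) (trans (+-cong e (go fuel (A₁ ++ A₂) (ℕP.≤-trans shorter short) unique′ partner′)) (+-identityˡ 0#)))
        where
        shorter : length (A₁ ++ A₂) ℕ.≤ length (A₁ ++ y ∷ A₂)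
        shorter = ≡.subst₂ ℕ._≤_ (≡.sym (ListP.length-++ A₁)) (≡.sym (ListP.length-++ A₁)) (ℕP.+-monoʳ-≤ (length A₁) (ℕP.n≤1+n _))
        pieces = Unique-++⁻ A₁ u′
        tail-unique : Unique A₂ × y ∉ₗ A₂
        tail-unique with proj₁ (proj₂ pieces)
        ... | v@(_ ∷ v′) = v′ , Unique[x∷xs]⇒x∉xs v
        unique′ : Unique (A₁ ++ A₂)
        unique′ = UniqueP.++⁺ (proj₁ pieces) (proj₁ tail-unique) (λ (h , k) → proj₂ (proj₂ pieces) (h , there k))
        y∉ : y ∉ₗ A₁ ++ A₂
        y∉ h = [ (λ k → proj₂ (proj₂ pieces) (k , here refl)) , proj₂ tail-unique ]′ (∈-++⁻ A₁ h)
        widen : ∀ {z} → z ∈ₗ A₁ ++ A₂ → z ∈ₗ A₁ ++ y ∷ A₂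
        widen h = [ ∈-++⁺ˡ , (λ k → ∈-++⁺ʳ A₁ (there k)) ]′ (∈-++⁻ A₁ h)
        partner′ : ∀ {z} → z ∈ₗ A₁ ++ A₂ → ∃[ z′ ] z′ ∈ₗ A₁ ++ A₂ × M z z′ × s z + s z′ ≈ 0#
        partner′ {z} h with partner (there (widen h))
        ... | z′ , here refl , m′ , _ = contradiction (≡.subst (_∈ₗ A₁ ++ A₂) (≡.sym (M-functional m (M-sym m′))) h) y∉
        ... | z′ , there k , m′ , e′ with ∈-++⁻ A₁ k
        ...   | inj₁ l         = z′ , ∈-++⁺ˡ l , m′ , e′
        ...   | inj₂ (there l) = z′ , ∈-++⁺ʳ A₁ l , m′ , e′
        ...   | inj₂ (here refl) = contradiction (≡.subst (_∈ₗ A₁ ++ y ∷ A₂) (≡.sym (M-functional (M-sym m) (M-sym m′))) (widen h)) (Unique[x∷xs]⇒x∉xs u)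

  ∑-partition : ∀ {a p} {A : Set a} {P : A → Set p} (P? : ∀ x → Dec (P x)) (L : List A) s →
                ∑ L s ≈ ∑ (filter P? L) s + ∑ (filter (λ x → ¬? (P? x)) L) s
  ∑-partition P? []      s = sym (+-identityˡ 0#)
  ∑-partition P? (x ∷ L) s with P? x
  ... | yes _ = trans (+-congˡ (∑-partition P? L s)) (sym (+-assoc _ _ _))
  ... | no _  = trans (+-congˡ (∑-partition P? L s)) (solve 3 (λ a b c → a :+ (b :+ c) := b :+ (a :+ c)) ref (s x) _ _)

  ∑-constant : ∀ {a b} {A : Set a} {B : Set b} (xs : List A) (ys : List B) x → length xs ≡ length ys → ∑ xs (λ _ → x) ≈ ∑ ys (λ _ → x)
  ∑-constant []       []       x e = ref
  ∑-constant (_ ∷ xs) (_ ∷ ys) x e = +-congˡ (∑-constant xs ys x (ℕP.suc-injective e))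

-- The signed walk series as a quotient of flow polynomials.

module FlowSeries {c ℓ₁ ℓ₂ : Level} (K : OrderedField c ℓ₁ ℓ₂) {k n : ℕ} (N : Plabic.PlabicNetwork K k n) (𝔩 : Plabic.Point K) where
  open OrderedField K hiding (zero; refl) renaming (_-_ to _∸_)
  open Plabic K hiding (PlabicNetwork)
  open Plabic.PlabicNetwork N
  open Gauge 𝔩
  open IntegerSolver K
  open FieldOrder K
  open Series K
  open Cancellation K
  open Walks digraph
  open Flows graph
  open Algebra.Properties.Semiring.Exp semiring using (_^_)
  open import Relation.Binary.Reasoning.Setoid setoid
  private
    m : ℕ
    m = #edges

  words-unique : ∀ l → Unique (words {m} l)
  words-unique zero    = [] ∷ []
  words-unique (suc l) = Unique-concatMap _ (words l) (λ P → UniqueP.map⁺ ListP.∷-injectiveˡ (allFin⁺ m))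
    (λ {P} {P′} h k → let (_ , _ , e) = ∈-map⁻ (_∷ P) h ; (_ , _ , e′) = ∈-map⁻ (_∷ P′) k in ListP.∷-injectiveʳ (≡.trans (≡.sym e) e′))
    (words-unique l)

  words-complete : ∀ (P : List Edge) → P ∈ₗ words (length P)
  words-complete []      = here refl
  words-complete (f ∷ P) = ∈-concatMap⁺′ _ (words (length P)) (words-complete P) (∈-map⁺ (_∷ P) (∈-allFin f))

  multiplicity-occurrences : ∀ f (P : List Edge) → lookup (multiplicity P) f ≡ occurrences f P
  multiplicity-occurrences f P = VecP.lookup∘tabulate _ f

  -- The reason why a search among words of length `Vec.sum α` finds every word of multiplicity `α`.
  multiplicity-total : ∀ (P : List Edge) → Vec.sum (multiplicity P) ≡ length P
  multiplicity-total []      = sum-zero m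
    where
    sum-zero : ∀ m → Vec.sum (tabulate {n = m} (λ _ → 0)) ≡ 0
    sum-zero zero    = refl
    sum-zero (suc m) = sum-zero m
  multiplicity-total (g ∷ P) = ≡.trans (step (λ f → occurrences f (g ∷ P)) (λ f → occurrences f P) g bump same) (≡.cong suc (multiplicity-total P))
    where
    bump : occurrences g (g ∷ P) ≡ suc (occurrences g P)
    bump with g FinP.≟ g
    ... | yes _ = refl
    ... | no ¬e = contradiction refl ¬e
    same : ∀ {f} → f ≢ g → occurrences f (g ∷ P) ≡ occurrences f P
    same {f} f≢g with g FinP.≟ f
    ... | yes e = contradiction (≡.sym e) f≢g
    ... | no _  = refl
    step : ∀ {m} (u v : Fin m → ℕ) g → u g ≡ suc (v g) → (∀ {f} → f ≢ g → u f ≡ v f) → Vec.sum (tabulate u) ≡ suc (Vec.sum (tabulate v))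
    step u v zero e h = ≡.cong₂ ℕ._+_ e (≡.cong Vec.sum (VecP.tabulate-cong (λ f → h {suc f} λ ())))
    step u v (suc g) e h = ≡.trans (≡.cong₂ ℕ._+_ (h {zero} λ ()) (step (u ∘ suc) (v ∘ suc) g e (λ f≢ → h (f≢ ∘ FinP.suc-injective)))) (ℕP.+-suc _ _)

  weightOf : Configuration → Monomial m
  weightOf (C , P) = indicator C ⊕ multiplicity P

  lookup-weight : ∀ f C P → lookup (weightOf (C , P)) f ≡ membership f C ℕ.+ occurrences f P
  lookup-weight f C P = ≡.trans (VecP.lookup-zipWith ℕ._+_ f (indicator C) (multiplicity P))
    (≡.cong₂ ℕ._+_ (VecP.lookup∘tabulate _ f) (multiplicity-occurrences f P))

  -- The edges of the loop pass from the walk to a flow that contained none of them, so the exponent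
  -- of each edge is preserved and the cancellation stays within one coefficient.
  transfer-weight : ∀ {u w x y} → Transfer u w x y → weightOf x ≡ weightOf y
  transfer-weight {x = C , P} {C′ , P′} t@(transfer {P₀} {γ} {R} refl refl _ cyc _ _ _ refl) = vector-ext λ f → ≡.trans (lookup-weight f C ((P₀ ++ γ) ++ R))
    (≡.trans (pointwise f) (≡.sym (lookup-weight f (C ∪ support γ) (P₀ ++ R))))
    where
    open +-*-Solver using () renaming (solve to solveℕ; _:+_ to _⊹_; _:=_ to _≐_)
    pointwise : ∀ f → membership f C ℕ.+ occurrences f ((P₀ ++ γ) ++ R) ≡ membership f (C ∪ support γ) ℕ.+ occurrences f (P₀ ++ R)
    pointwise f = ≡.trans (≡.cong (membership f C ℕ.+_) (≡.trans (occurrences-++ f (P₀ ++ γ) R) (≡.cong (ℕ._+ occurrences f R) (occurrences-++ f P₀ γ))))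
      (≡.trans (solveℕ 4 (λ a p q r → a ⊹ ((p ⊹ q) ⊹ r) ≐ (a ⊹ q) ⊹ (p ⊹ r)) refl (membership f C) (occurrences f P₀) (occurrences f γ) (occurrences f R))
        (≡.sym (≡.cong₂ ℕ._+_ (membership-union f C γ (UniqueP.map⁻ (proj₁ (proj₂ cyc))) (disjoint-cycle (cycle-avoids t))) (occurrences-++ f P₀ R))))

  union-weight : ∀ {C P} → Unique P → (∀ {f} → f ∈ₗ P → f ∉ C) → indicator (C ∪ support P) ≡ weightOf (C , P)
  union-weight {C} {P} u disj = vector-ext λ f → ≡.trans (VecP.lookup∘tabulate _ f)
    (≡.trans (membership-union f C P u disj) (≡.sym (lookup-weight f C P)))

  -1^-suc : ∀ l → -1^ (ℤ.+ suc l) ≈ - -1^ (ℤ.+ l)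
  -1^-suc l with parity (suc l) | parity l | ℙP.suc-homo-⁻¹ l
  ... | 1ℙ | 0ℙ | _ = ref
  ... | 0ℙ | 1ℙ | _ = solve 0 (con 1ℤ := :- (:- con 1ℤ)) ref

  monomial-indicator : ∀ C → monomial weight (indicator C) ≈ w C
  monomial-indicator C = trans
    (∏-cong (allFin m) (λ f → reflexive (≡.cong (weight f ^_) (VecP.lookup∘tabulate (λ f → membership f C) f)))) (go (allFin m))
    where
    go : ∀ fs → ∏ fs (λ f → weight f ^ membership f C) ≈ ∏ (filter (_∈? C) fs) weight
    go [] = ref
    go (f ∷ fs) with f ∈? C
    ... | yes _ = *-cong (*-identityʳ (weight f)) (go fs)
    ... | no _  = trans (*-identityˡ _) (go fs)

  -- All that matters about the signs is that each lost loop flips them, with `s` the value on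
  -- simple paths. The edge vector and the boundary measurement are the two instances.
  module _ {i j : Fin n} (i≢j : i ≢ j) {e : Edge} (e-src : src e ≡ b i) {Q : List Edge → Set} (Q? : Decidable Q)
           (Q⇔walk : ∀ P → Q P ⇔ IsWalk (b i) P (b j)) (s : Carrier) (ε : List Edge → Carrier)
           (ε-sign : ∀ P → IsWalk (b i) P (b j) → ε P ≈ s * -1^ (ℤ.+ loopsErased (b i) P)) where

    open SourceFlows {i} {j} i≢j {e} e-src

    private
      Reduced′ : Configuration → Set
      Reduced′ = Reduced {u = b i} {w = b j}

      reduced? : ∀ x → Dec (Reduced′ x)
      reduced? (C , P) = (unique? _≟ᵥ_ (sources P) ×-dec
          map′ All.lookup (λ h → All.tabulate h) (All.all? (λ v → ¬? (touches? C v)) (sources P)))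
        ×-dec ¬? (mem? _≟ᵥ_ (b j) (sources P)) ×-dec ¬? (touches? C (b j))

      module _ (α : Monomial m) where

        -- The subtraction of exponents is truncated, so flows whose monomial does not divide `α`
        -- have to be left out explicitly. The decision is an argument so that it can be matched
        -- with the one in `⊛`.
        walksOf : ∀ {C} → Dec (indicator C ≼ α) → List (List Edge)
        walksOf {C} (yes _) = filter (λ P → Q? P ×-dec multiplicity P ≟ₘ (α ⊖ indicator C)) (words (Vec.sum (α ⊖ indicator C)))
        walksOf (no _)      = []

        block : Subset m → List Configuration
        block C = map (C ,_) (walksOf {C} (indicator C ≼? α))

        configurations : List Configuration
        configurations = concatMap block conservativeFlows

        IsConfiguration : Configuration → Set
        IsConfiguration x = Circulation (proj₁ x) × IsWalk (b i) (proj₂ x) (b j) × weightOf x ≡ α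

        configuration⁻ : ∀ {x} → x ∈ₗ configurations → IsConfiguration x
        configuration⁻ {x} h = case ∈-concatMap⁻′ block conservativeFlows h of λ (C , C∈ , k) →
          case ∈-map⁻ (C ,_) k of λ { (P , P∈ , refl) → conservative⇒circulation (proj₂ (∈-filter⁻ isConservativeFlow? {xs = subsets m} C∈)) , from P (indicator C ≼? α) P∈ }
          where
          from : ∀ {C} P (d : Dec (indicator C ≼ α)) → P ∈ₗ walksOf {C} d → IsWalk (b i) P (b j) × weightOf (C , P) ≡ α
          from {C} P (yes h) P∈ = let (_ , q , e) = ∈-filter⁻ (λ P → Q? P ×-dec multiplicity P ≟ₘ (α ⊖ indicator C)) {xs = words (Vec.sum (α ⊖ indicator C))} P∈ in
            Equivalence.to (Q⇔walk P) q , ≡.trans (≡.cong (indicator C ⊕_) e) (⊕-⊖ h)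

        configuration⁺ : ∀ {x} → IsConfiguration x → x ∈ₗ configurations
        configuration⁺ {C , P} (c , p , e) = ∈-concatMap⁺′ block conservativeFlows
          (∈-filter⁺ isConservativeFlow? (subsets-complete C) (circulation⇒conservative c)) (∈-map⁺ (C ,_) (into (indicator C ≼? α)))
          where
          e′ : multiplicity P ≡ α ⊖ indicator C
          e′ = ⊕⇒⊖ {β = indicator C} e
          into : (d : Dec (indicator C ≼ α)) → P ∈ₗ walksOf {C} d
          into (yes h) = ∈-filter⁺ (λ P → Q? P ×-dec multiplicity P ≟ₘ (α ⊖ indicator C))
            (≡.subst (λ l → P ∈ₗ words l) (≡.trans (≡.sym (multiplicity-total P)) (≡.cong Vec.sum e′)) (words-complete P))
            (Equivalence.from (Q⇔walk P) p , e′)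
          into (no ¬h) = contradiction (⊕⇒≼ {β = indicator C} e) ¬h

        configurations-unique : Unique configurations
        configurations-unique = Unique-concatMap block conservativeFlows
          (λ C → UniqueP.map⁺ (λ e → ≡.cong proj₂ e) (walks-unique (indicator C ≼? α)))
          (λ {C} {C′} h k → let (_ , _ , e) = ∈-map⁻ (C ,_) h ; (_ , _ , e′) = ∈-map⁻ (C′ ,_) k in ≡.cong proj₁ (≡.trans (≡.sym e) e′))
          (UniqueP.filter⁺ isConservativeFlow? (subsets-unique m))
          where
          walks-unique : ∀ {C} (d : Dec (indicator C ≼ α)) → Unique (walksOf {C} d)
          walks-unique {C} (yes _) = UniqueP.filter⁺ (λ P → Q? P ×-dec multiplicity P ≟ₘ (α ⊖ indicator C)) (words-unique (Vec.sum (α ⊖ indicator C)))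
          walks-unique (no _)      = []

        private
          Matched : Configuration → Configuration → Set
          Matched x y = Transfer (b i) (b j) x y ⊎ Transfer (b i) (b j) y x

          total : Configuration → Carrier
          total x = ε (proj₂ x)

          transfer-sign : ∀ {x y} → Transfer (b i) (b j) x y → total x + total y ≈ 0#
          transfer-sign {x} {y} t = begin
            ε (proj₂ x) + ε (proj₂ y)
              ≈⟨ +-cong (ε-sign (proj₂ x) (proj₁ (transfer-walk t))) (ε-sign (proj₂ y) (proj₂ (transfer-walk t))) ⟩
            s * -1^ (ℤ.+ loopsErased (b i) (proj₂ x)) + s * σ
              ≈⟨ +-congʳ (*-congˡ (trans (reflexive (≡.cong (λ l → -1^ (ℤ.+ l)) (transfer-loops t))) (-1^-suc (loopsErased (b i) (proj₂ y))))) ⟩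
            s * - σ + s * σ  ≈⟨ solve 2 (λ s x → s :* (:- x) :+ s :* x := con 0ℤ) ref s σ ⟩
            0# ∎
            where σ = -1^ (ℤ.+ loopsErased (b i) (proj₂ y))

          matched-functional : ∀ {x y z} → Circulation (proj₁ x) → Matched x y → Matched x z → y ≡ z
          matched-functional c (inj₁ t) (inj₁ t′) = transfer-functional t t′
          matched-functional c (inj₁ t) (inj₂ t′) = ⊥-elim (transfer-acyclic t t′)
          matched-functional c (inj₂ t) (inj₁ t′) = ⊥-elim (transfer-acyclic t′ t)
          matched-functional c (inj₂ t) (inj₂ t′) = transfer-injective c t t′

          -- A transfer can be undone in one way only when the flow is a circulation, so this is
          -- made part of the matching.
          Matchedᶜ : Configuration → Configuration → Set
          Matchedᶜ x y = Circulation (proj₁ x) × Circulation (proj₁ y) × Matched x y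

          rest : List Configuration
          rest = filter (λ x → ¬? (reduced? x)) configurations

          reduced : List Configuration
          reduced = filter reduced? configurations

          rest⁺ : ∀ {x y} → IsConfiguration y → Matched y x → y ∈ₗ rest
          rest⁺ c m = ∈-filter⁺ (λ x → ¬? (reduced? x)) (configuration⁺ c) (λ free → reduced-no-transfer free m)

          partner : ∀ {x} → x ∈ₗ rest → ∃[ y ] y ∈ₗ rest × Matchedᶜ x y × total x + total y ≈ 0#
          partner {x} x∈ = go (∈-filter⁻ (λ x → ¬? (reduced? x)) {xs = configurations} x∈)
            where
            go : x ∈ₗ configurations × ¬ Reduced′ x → ∃[ y ] y ∈ₗ rest × Matchedᶜ x y × total x + total y ≈ 0#
            go (h , ¬free) = pick (transfer-total circ p)
              where
              circ = proj₁ (configuration⁻ h)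
              p = proj₁ (proj₂ (configuration⁻ h))
              e′ = proj₂ (proj₂ (configuration⁻ h))
              pick : Reduced′ x ⊎ (∃[ y ] Transfer (b i) (b j) x y) ⊎ (∃[ y ] Transfer (b i) (b j) y x) →
                     ∃[ y ] y ∈ₗ rest × Matchedᶜ x y × total x + total y ≈ 0#
              pick (inj₁ free) = contradiction free ¬free
              pick (inj₂ (inj₁ (y , t))) = y ,
                rest⁺ (transfer-circulation⁺ t circ , proj₂ (transfer-walk t) , ≡.trans (≡.sym (transfer-weight t)) e′) (inj₂ t) ,
                (circ , transfer-circulation⁺ t circ , inj₁ t) , transfer-sign t
              pick (inj₂ (inj₂ (y , t))) = y ,
                rest⁺ (transfer-circulation⁻ t circ , proj₁ (transfer-walk t) , ≡.trans (transfer-weight t) e′) (inj₁ t) ,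
                (circ , transfer-circulation⁻ t circ , inj₂ t) , trans (+-comm _ _) (transfer-sign t)

          rest-cancels : ∑ rest total ≈ 0#
          rest-cancels = ∑-matched Matchedᶜ (λ (c , c′ , m) → c′ , c , Sum.swap m) (λ (c , _ , m) (_ , _ , m′) → matched-functional c m m′)
            (λ (c , _ , m) → [ (λ t → transfer-acyclic t t) , (λ t → transfer-acyclic t t) ]′ m) total rest
            (UniqueP.filter⁺ (λ x → ¬? (reduced? x)) configurations-unique) partner

          merge : Configuration → Subset m
          merge (C , P) = C ∪ support P

          flows : List (Subset m)
          flows = filter (λ F → indicator F ≟ₘ α) (edgeFlows e j)

          reduced⁻ : ∀ {x} → x ∈ₗ reduced → IsConfiguration x × Reduced′ x
          reduced⁻ h = let (h′ , free) = ∈-filter⁻ reduced? {xs = configurations} h in configuration⁻ h′ , free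

          decomposition : ∀ {x} → x ∈ₗ reduced → Decomposition (merge x)
          decomposition {C , P} h = let ((c , p , _) , free) = reduced⁻ h in
            record { C = C ; P = P ; circulation = c ; walk = p ; reduced = free ; union = refl }

          merge-injective : ∀ {x y} → x ∈ₗ reduced → y ∈ₗ reduced → merge x ≡ merge y → x ≡ y
          merge-injective {x} {y} h k eq = ≡.cong₂ _,_ (proj₁ same) (proj₂ same)
            where
            relabel : ∀ {F F′} (eq : F ≡ F′) (D : Decomposition F′) →
              ∃[ D′ ] Decomposition.C {F} D′ ≡ Decomposition.C D × Decomposition.P D′ ≡ Decomposition.P D
            relabel refl D = D , refl , refl
            other = relabel eq (decomposition k)
            same : proj₁ x ≡ proj₁ y × proj₂ x ≡ proj₂ y
            same = let (p , q) = decomposition-unique (decomposition h) (proj₁ other) in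
              ≡.trans p (proj₁ (proj₂ other)) , ≡.trans q (proj₂ (proj₂ other))

          merge-weight : ∀ {C P} → Reduced′ (C , P) → indicator (C ∪ support P) ≡ weightOf (C , P)
          merge-weight ((uq , avoid) , _) = union-weight (UniqueP.map⁻ uq) (disjoint-cycle avoid)

          merge-into : ∀ {F} → F ∈ₗ map merge reduced → F ∈ₗ flows
          merge-into h = case ∈-map⁻ merge h of λ { ((C , P) , x∈ , refl) → let ((_ , _ , e′) , free) = reduced⁻ x∈ in
            ∈-filter⁺ (λ F → indicator F ≟ₘ α)
              (∈-filter⁺ (ℱ? e j) (subsets-complete (C ∪ support P)) (Decomposition.isFlow (decomposition x∈)))
              (≡.trans (merge-weight free) e′) }

          merge-onto : ∀ {F} → F ∈ₗ flows → F ∈ₗ map merge reduced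
          merge-onto {F} h = ≡.subst (_∈ₗ map merge reduced) (≡.sym D.union) (∈-map⁺ merge
            (∈-filter⁺ reduced? (configuration⁺ (D.circulation , D.walk , ≡.trans (≡.sym (merge-weight D.reduced)) (≡.trans (≡.cong indicator (≡.sym D.union)) e′))) D.reduced))
            where
            inner = ∈-filter⁻ (λ F → indicator F ≟ₘ α) {xs = edgeFlows e j} h
            e′ = proj₂ inner
            module D = Decomposition (decompose (proj₂ (∈-filter⁻ (ℱ? e j) {xs = subsets m} (proj₁ inner))))

          -- `merge` is injective by uniqueness of the decomposition and reaches every flow of
          -- weight `α` by its existence.
          same-number : length reduced ≡ length flows
          same-number = ≡.trans (≡.sym (ListP.length-map merge reduced)) (↭-length (∼bag⇒↭ (unique∧set⇒bag
            (Unique-map-∈ merge reduced merge-injective (UniqueP.filter⁺ reduced? configurations-unique))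
            (UniqueP.filter⁺ (λ F → indicator F ≟ₘ α) (UniqueP.filter⁺ (ℱ? e j) (subsets-unique m)))
            (mk⇔ merge-into merge-onto))))

          reduced-total : ∀ {x} → x ∈ₗ reduced → total x ≈ s
          reduced-total {C , P} h = let ((_ , p , _) , ((uq , _) , j∉ , _)) = reduced⁻ h in
            trans (ε-sign P p) (trans (*-congˡ (reflexive (≡.cong (λ l → -1^ (ℤ.+ l)) (loopsErased-simple P p uq j∉)))) (*-identityʳ s))

        configuration-sum : ∑ configurations total ≈ ∑ (edgeFlows e j) (λ F → when (indicator F ≟ₘ α) s)
        configuration-sum = begin
          ∑ configurations total       ≈⟨ ∑-partition reduced? configurations total ⟩
          ∑ reduced total + ∑ rest total  ≈⟨ +-cong (∑-cong-∈ reduced reduced-total) rest-cancels ⟩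
          ∑ reduced (λ _ → s) + 0#     ≈⟨ +-identityʳ _ ⟩
          ∑ reduced (λ _ → s)          ≈⟨ ∑-constant reduced flows s same-number ⟩
          ∑ flows (λ _ → s)            ≈⟨ ∑-filter (λ F → indicator F ≟ₘ α) (edgeFlows e j) (λ _ → s) ⟩
          ∑ (edgeFlows e j) (λ F → when (indicator F ≟ₘ α) s) ∎

    flowPolynomial conservativePolynomial : Polynomial m
    flowPolynomial = map (λ F → s , indicator F) (edgeFlows e j)
    conservativePolynomial = map (λ C → 1# , indicator C) conservativeFlows

    -- The left side collects the signs of all pairs of a conservative flow and a walk of total
    -- weight `α`; after cancellation each edge flow of that weight contributes `s` once.
    flow-equation : ∀ α → (conservativePolynomial ⊛ series Q? ε) α ≈ coefficient flowPolynomial α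
    flow-equation α = begin
      (conservativePolynomial ⊛ series Q? ε) α
        ≈⟨ ∑-map (λ C → 1# , indicator C) conservativeFlows _ ⟩
      ∑ conservativeFlows (λ C → when (indicator C ≼? α) (1# * series Q? ε (α ⊖ indicator C)))
        ≈⟨ ∑-cong conservativeFlows (λ C → trans (block-sum C (indicator C ≼? α)) (sym (∑-map (C ,_) (walksOf α {C} (indicator C ≼? α)) (ε ∘ proj₂)))) ⟩
      ∑ conservativeFlows (λ C → ∑ (block α C) (ε ∘ proj₂))
        ≈⟨ ∑-concatMap (block α) conservativeFlows (ε ∘ proj₂) ⟨
      ∑ (configurations α) (ε ∘ proj₂)     ≈⟨ configuration-sum α ⟩
      ∑ (edgeFlows e j) (λ F → when (indicator F ≟ₘ α) s)  ≈⟨ ∑-map (λ F → s , indicator F) (edgeFlows e j) _ ⟨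
      coefficient flowPolynomial α ∎
      where
      block-sum : ∀ C (d : Dec (indicator C ≼ α)) → when d (1# * series Q? ε (α ⊖ indicator C)) ≈ ∑ (walksOf α {C} d) ε
      block-sum C (yes _) = *-identityˡ _
      block-sum C (no _)  = ref

    series-sum : SumsTo (series Q? ε) weight (s * divide (edgeFlowSum e j) conservativeFlowSum≉0)
    series-sum = flowPolynomial , conservativePolynomial , flow-equation ,
      (λ h → conservativeFlowSum≉0 (trans (sym evaluate-conservative) h)) ,
      (begin
        s * (edgeFlowSum e j * Z⁻¹) * evaluate conservativePolynomial weight  ≈⟨ *-congˡ evaluate-conservative ⟩
        s * (edgeFlowSum e j * Z⁻¹) * conservativeFlowSum
          ≈⟨ solve 4 (λ s x i z → s :* (x :* i) :* z := s :* x :* (z :* i)) ref s (edgeFlowSum e j) Z⁻¹ conservativeFlowSum ⟩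
        s * edgeFlowSum e j * (conservativeFlowSum * Z⁻¹)  ≈⟨ *-congˡ (proj₂ (invertible conservativeFlowSum≉0)) ⟩
        s * edgeFlowSum e j * 1#     ≈⟨ *-identityʳ _ ⟩
        s * edgeFlowSum e j          ≈⟨ ∑-*ˡ (edgeFlows e j) s w ⟩
        ∑ (edgeFlows e j) (λ F → s * w F)  ≈⟨ ∑-cong (edgeFlows e j) (λ F → *-congˡ (monomial-indicator F)) ⟨
        ∑ (edgeFlows e j) (λ F → s * monomial weight (indicator F)) ≈⟨ ∑-map (λ F → s , indicator F) (edgeFlows e j) _ ⟨
        evaluate flowPolynomial weight ∎)
      where
      Z⁻¹ = proj₁ (invertible conservativeFlowSum≉0)
      evaluate-conservative : evaluate conservativePolynomial weight ≈ conservativeFlowSum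
      evaluate-conservative = trans (∑-map (λ C → 1# , indicator C) conservativeFlows _)
        (∑-cong conservativeFlows (λ C → trans (*-identityˡ _) (monomial-indicator C)))

-- Uniqueness of the reduced echelon matrix.

module LinearAlgebra {c ℓ₁ ℓ₂ : Level} (K : OrderedField c ℓ₁ ℓ₂) where
  open OrderedField K hiding (zero; refl) renaming (_-_ to _∸_)
  open Plabic K hiding (PlabicNetwork)
  open IntegerSolver K
  open FieldOrder K
  open Algebra.Properties.Semiring.Sum semiring
    using (sum; sum-cong-≋; sum-replicate-zero; sum-remove; ∑-distrib-+; ∑-comm; *-distribˡ-sum; *-distribʳ-sum)
  open import Relation.Binary.Reasoning.Setoid setoid

  sum-zero : ∀ {m} (f : Fin m → Carrier) → (∀ i → f i ≈ 0#) → sum f ≈ 0#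
  sum-zero {m} f e = trans (sum-cong-≋ e) (sum-replicate-zero m)

  sum-delta : ∀ {m} (a : Fin m → Carrier) t → sum (λ r → a r * (if does (r FinP.≟ t) then 1# else 0#)) ≈ a t
  sum-delta {suc m} a t = trans (sum-remove {i = t} (λ r → a r * (if does (r FinP.≟ t) then 1# else 0#)))
    (trans (+-cong (diagonal (t FinP.≟ t)) (sum-zero _ (λ r → off (FinP.punchInᵢ≢i t r) (Fin.punchIn t r FinP.≟ t)))) (+-identityʳ _))
    where
    diagonal : (d : Dec (t ≡ t)) → a t * (if does d then 1# else 0#) ≈ a t
    diagonal (yes _) = *-identityʳ _
    diagonal (no ¬e) = contradiction refl ¬e
    off : ∀ {r} → r ≢ t → (d : Dec (r ≡ t)) → a r * (if does d then 1# else 0#) ≈ 0#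
    off r≢t (yes e) = contradiction e r≢t
    off r≢t (no _)  = zeroʳ _

  -- Gaussian elimination on the first coordinate. If it vanishes throughout, one vector is given
  -- coefficient zero and that coordinate is dropped; otherwise multiples of the pivot vector are
  -- subtracted from the others, and its own coefficient `- t` makes up for them.
  dependent : ∀ m (v : Fin (suc m) → Fin m → Carrier) →
    Σ[ a ∈ (Fin (suc m) → Carrier) ] (∃[ i ] ¬ a i ≈ 0#) × (∀ j → sum (λ i → a i * v i j) ≈ 0#)
  dependent zero    v = (λ _ → 1#) , (Fin.zero , <⇒≉0 0<1) , λ ()
  dependent (suc m) v with FinP.any? (λ i → ¬? (v i Fin.zero ≟ 0#))
  ... | no none = b , (Fin.suc i₀ , a≉0) , λ
      { Fin.zero → sum-zero (λ i → b i * v i Fin.zero) (λ i → trans (*-congˡ (decidable-stable (v i Fin.zero ≟ 0#) (λ ne → none (i , ne)))) (zeroʳ (b i)))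
      ; (Fin.suc j) → trans (+-cong (zeroˡ _) (relation j)) (+-identityˡ 0#) }
    where
    induct = dependent m (λ i j → v (Fin.suc i) (Fin.suc j))
    a = proj₁ induct
    i₀ = proj₁ (proj₁ (proj₂ induct))
    a≉0 = proj₂ (proj₁ (proj₂ induct))
    relation = proj₂ (proj₂ induct)
    b : Fin (suc (suc m)) → Carrier
    b Fin.zero    = 0#
    b (Fin.suc i) = a i
  ... | yes (p , vₚ≉0) = b , (Fin.punchIn p i₀ , λ h → a≉0 (trans (reflexive (≡.sym (VFP.insertAt-punchIn a p (- t) i₀))) h)) , λ
      { Fin.zero → trans (expand Fin.zero) (trans (+-congˡ (sym cleared)) (solve 2 (λ t x → (:- t) :* x :+ t :* x := con 0ℤ) ref t (v p Fin.zero)))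
      ; (Fin.suc j) → trans (expand (Fin.suc j)) (trans (+-congˡ (eliminated j)) (solve 2 (λ t x → (:- t) :* x :+ t :* x := con 0ℤ) ref t (v p (Fin.suc j)))) }
    where
    q⁻¹ = proj₁ (invertible vₚ≉0)
    ratio : Fin (suc m) → Carrier
    ratio i = v (Fin.punchIn p i) Fin.zero * q⁻¹
    induct = dependent m (λ i j → v (Fin.punchIn p i) (Fin.suc j) ∸ ratio i * v p (Fin.suc j))
    a = proj₁ induct
    i₀ = proj₁ (proj₁ (proj₂ induct))
    a≉0 = proj₂ (proj₁ (proj₂ induct))
    relation = proj₂ (proj₂ induct)
    t = sum (λ i → a i * ratio i)
    b = VF.insertAt a p (- t)
    expand : ∀ j → sum (λ i → b i * v i j) ≈ - t * v p j + sum (λ i → a i * v (Fin.punchIn p i) j)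
    expand j = trans (sum-remove {i = p} (λ i → b i * v i j)) (+-cong (*-congʳ (reflexive (VFP.insertAt-lookup a p (- t))))
      (sum-cong-≋ (λ i → *-congʳ {v (Fin.punchIn p i) j} (reflexive (VFP.insertAt-punchIn a p (- t) i)))))
    cleared : t * v p Fin.zero ≈ sum (λ i → a i * v (Fin.punchIn p i) Fin.zero)
    cleared = trans (*-distribʳ-sum (v p Fin.zero) (λ i → a i * ratio i)) (sum-cong-≋ (λ i →
      trans (solve 4 (λ a v q x → a :* (v :* q) :* x := a :* v :* (x :* q)) ref (a i) (v (Fin.punchIn p i) Fin.zero) q⁻¹ (v p Fin.zero))
        (trans (*-congˡ (proj₂ (invertible vₚ≉0))) (*-identityʳ _))))
    eliminated : ∀ j → sum (λ i → a i * v (Fin.punchIn p i) (Fin.suc j)) ≈ t * v p (Fin.suc j)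
    eliminated j = begin
      sum (λ i → a i * v (Fin.punchIn p i) (Fin.suc j))
        ≈⟨ sum-cong-≋ (λ i → solve 4 (λ a v r x → a :* v := a :* (v :- r :* x) :+ a :* r :* x) ref (a i) (v (Fin.punchIn p i) (Fin.suc j)) (ratio i) (v p (Fin.suc j))) ⟩
      sum (λ i → a i * (v (Fin.punchIn p i) (Fin.suc j) ∸ ratio i * v p (Fin.suc j)) + a i * ratio i * v p (Fin.suc j))
        ≈⟨ ∑-distrib-+ (λ i → a i * (v (Fin.punchIn p i) (Fin.suc j) ∸ ratio i * v p (Fin.suc j))) (λ i → a i * ratio i * v p (Fin.suc j)) ⟩
      _ + sum (λ i → a i * ratio i * v p (Fin.suc j))
        ≈⟨ +-cong (relation j) (sym (*-distribʳ-sum (v p (Fin.suc j)) (λ i → a i * ratio i))) ⟩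
      0# + t * v p (Fin.suc j)  ≈⟨ +-identityˡ _ ⟩
      t * v p (Fin.suc j) ∎

  identity : ∀ {k} → Fin k → Fin k → Carrier
  identity r s = if does (r FinP.≟ s) then 1# else 0#

  -- The row `a` and the `k` rows of `g` are dependent. Multiplying the relation by `X` kills `a`
  -- and turns the rows of `g` into unit vectors, so their coefficients vanish; that of `a` is then
  -- nonzero, and `a` is zero.
  left-invertible⇒independent : ∀ {k} (g X : Matrix k k) → (∀ r t → sum (λ s → g r s * X s t) ≈ identity r t) →
    ∀ a → (∀ t → sum (λ s → a s * X s t) ≈ 0#) → ∀ s → a s ≈ 0#
  left-invertible⇒independent {k} g X gX≈1 a aX≈0 s = *-zero-cancel head≉0 (trans (sym (+-identityʳ _)) (trans
      (+-congˡ (sym (sum-zero _ (λ r → trans (*-congʳ (tail≈0 r)) (zeroˡ (g r s)))))) (relation s)))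
    where
    rows : Fin (suc k) → Fin k → Carrier
    rows Fin.zero    = a
    rows (Fin.suc r) = g r
    dependence = dependent k rows
    λ′ = proj₁ dependence
    relation = proj₂ (proj₂ dependence)
    tail≈0 : ∀ t → λ′ (Fin.suc t) ≈ 0#
    tail≈0 t = begin
      λ′ (Fin.suc t)                                        ≈⟨ sum-delta (λ′ ∘ Fin.suc) t ⟨
      sum (λ r → λ′ (Fin.suc r) * identity r t)             ≈⟨ sum-cong-≋ (λ r → *-congˡ (gX≈1 r t)) ⟨
      sum (λ r → λ′ (Fin.suc r) * sum (λ s → g r s * X s t)) ≈⟨ trans (sym (+-identityˡ _)) (+-congʳ (sym (trans (*-congˡ (aX≈0 t)) (zeroʳ _)))) ⟩
      λ′ Fin.zero * sum (λ s → a s * X s t) + sum (λ r → λ′ (Fin.suc r) * sum (λ s → g r s * X s t))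
        ≈⟨ +-cong (through a Fin.zero) (sum-cong-≋ (λ r → through (g r) (Fin.suc r))) ⟩
      sum (λ s → λ′ Fin.zero * a s * X s t) + sum (λ r → sum (λ s → λ′ (Fin.suc r) * g r s * X s t))
        ≈⟨ +-congˡ (∑-comm (λ r s → λ′ (Fin.suc r) * g r s * X s t)) ⟩
      sum (λ s → λ′ Fin.zero * a s * X s t) + sum (λ s → sum (λ r → λ′ (Fin.suc r) * g r s * X s t))
        ≈⟨ ∑-distrib-+ (λ s → λ′ Fin.zero * a s * X s t) _ ⟨
      sum (λ s → λ′ Fin.zero * a s * X s t + sum (λ r → λ′ (Fin.suc r) * g r s * X s t))
        ≈⟨ sum-zero _ (λ s → trans (trans (+-congˡ (sym (*-distribʳ-sum (X s t) (λ r → λ′ (Fin.suc r) * g r s)))) (sym (distribʳ (X s t) _ _)))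
             (trans (*-congʳ (relation s)) (zeroˡ _))) ⟩
      0# ∎
      where
      through : ∀ (v : Fin k → Carrier) i → λ′ i * sum (λ s → v s * X s t) ≈ sum (λ s → λ′ i * v s * X s t)
      through v i = trans (*-distribˡ-sum (λ′ i) (λ s → v s * X s t)) (sum-cong-≋ (λ s → sym (*-assoc (λ′ i) (v s) (X s t))))
    head≉0 : ¬ λ′ Fin.zero ≈ 0#
    head≉0 h = nowhere (proj₁ (proj₁ (proj₂ dependence))) (proj₂ (proj₁ (proj₂ dependence)))
      where
      nowhere : ∀ i → ¬ λ′ i ≈ 0# → ⊥
      nowhere Fin.zero    ne = ne h
      nowhere (Fin.suc r) ne = ne (tail≈0 r)

  -- In the columns `I` both matrices are the identity, so the difference of the two transition rows
  -- annihilates the square part of `B` there. That part has the left inverse `g`, hence the rows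
  -- agree.
  echelon-unique : ∀ {k n} (I : Columns k n) {A A′ B : Matrix k n} → SameClass A B → IdentityOn I A →
                   SameClass A′ B → IdentityOn I A′ → ∀ r j → A r j ≈ A′ r j
  echelon-unique I {A} {A′} {B} (g , _ , A≈gB) idA (g′ , _ , A′≈g′B) idA′ r j = begin
    A r j   ≈⟨ solve 2 (λ x y → x := (x :- y) :+ y) ref (A r j) (A′ r j) ⟩
    (A r j ∸ A′ r j) + A′ r j  ≈⟨ +-congʳ (trans (difference j) (sum-zero _ (λ s → trans (*-congʳ (zero-row s)) (zeroˡ _)))) ⟩
    0# + A′ r j   ≈⟨ +-identityˡ _ ⟩
    A′ r j        ∎
    where
    difference : ∀ j → A r j ∸ A′ r j ≈ sum (λ s → (g r s ∸ g′ r s) * B s j)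
    difference j = begin
      A r j ∸ A′ r j  ≈⟨ +-cong (A≈gB r j) (-‿cong (A′≈g′B r j)) ⟩
      sum (λ s → g r s * B s j) ∸ sum (λ s → g′ r s * B s j)
        ≈⟨ +-congˡ (trans (solve 1 (λ x → :- x := (:- con 1ℤ) :* x) ref _) (*-distribˡ-sum (- 1#) (λ s → g′ r s * B s j))) ⟩
      sum (λ s → g r s * B s j) + sum (λ s → - 1# * (g′ r s * B s j))  ≈⟨ ∑-distrib-+ (λ s → g r s * B s j) _ ⟨
      sum (λ s → g r s * B s j + - 1# * (g′ r s * B s j))
        ≈⟨ sum-cong-≋ (λ s → solve 3 (λ x y b → x :* b :+ (:- con 1ℤ) :* (y :* b) := (x :- y) :* b) ref (g r s) (g′ r s) (B s j)) ⟩
      sum (λ s → (g r s ∸ g′ r s) * B s j) ∎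
    zero-row : ∀ s → g r s ∸ g′ r s ≈ 0#
    zero-row = left-invertible⇒independent g (λ s t → B s (Columns.at I t))
      (λ r t → trans (sym (A≈gB r (Columns.at I t))) (idA r t)) (λ s → g r s ∸ g′ r s)
      (λ t → trans (sym (difference (Columns.at I t))) (trans (+-cong (idA r t) (-‿cong (idA′ r t))) (-‿inverseʳ _)))

corollary4p2 : {c ℓ₁ ℓ₂ : Level} (K : OrderedField c ℓ₁ ℓ₂) →
    let open OrderedField K
        open Plabic K
    in
    (k n : ℕ) → 1 ℕ.≤ k → k ℕ.< n →
    (M : Matroid k n) (N : PlabicNetwork k n) →
    let open PlabicNetwork N in
    (𝔩 : Point) → IsGaugeRay 𝔩 →
    let open Gauge 𝔩 in
    Matroid.IsBasis M (Columns.set I) →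
    (B : Matrix k n) → STNN M B → Represents B →
    (A : Matrix k n) → IsReducedEchelon I A B →
    (r : Fin k) (e : Edge) → src e ≡ b (Columns.at I r) →
    (j : Fin n) → j ∉ Columns.set I →
    let N-rj  = sourcesBetween (Columns.at I r) j
        value = -1^ (ℤ.+ N-rj) * divide (edgeFlowSum e j) conservativeFlowSum≉0
    in
    (∀ F → ℱ e j F →
       (∃[ P ] IsPathOf e j F P) ×
       (∀ P → IsPathOf e j F P → ℕ.parity ℤ.∣ wind P ℤ.+ ℤ.+ int P ∣ ≡ ℕ.parity N-rj)) ×
    (∀ x → IsEdgeComponent e j x ⇔ x ≈ value) ×
    value ≈ A r j
corollary4p2 K k n _ _ M N 𝔩 gauge _ B _ (A′ , (idA′ , measurements) , A′∼B) A (A∼B , idA) r e e-src j j∉I =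
  (λ F F∈ℱ → (Decomposition.P (decompose F∈ℱ) , Decomposition.isPathOf (decompose F∈ℱ)) , path-of-parity F∈ℱ) ,
  (λ x → mk⇔ (λ h → SumsTo-unique weight {edge-series} h edge-component) (λ x≈ → SumsTo-resp weight {edge-series} x≈ edge-component)) ,
  -- The measured matrix `A′` and the given `A` both represent the class of `B` and are both the
  -- identity in the columns `I`.
  trans (sym measured) (echelon-unique I A′∼B idA′ A∼B idA r j)
  where
  open OrderedField K hiding (zero; refl)
  open Plabic K hiding (PlabicNetwork)
  open Plabic.PlabicNetwork N
  open Gauge 𝔩
  open Walks digraph
  open Flows graph
  open NetworkGeometry K N 𝔩 gauge
  open WalkParity K N 𝔩 gauge
  open Series K
  open LinearAlgebra K
  open FlowSeries K N 𝔩

  i : Fin n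
  i = Columns.at I r

  i≢j : i ≢ j
  i≢j h = j∉I (≡.subst (_∈ Columns.set I) h (ray∈I r))

  open SourceFlows {i} {j} i≢j {e} e-src

  path-of-parity : ∀ {F} → ℱ e j F → ∀ P → IsPathOf e j F P →
                   ℕ.parity ℤ.∣ wind P ℤ.+ ℤ.+ int P ∣ ≡ ℕ.parity (sourcesBetween i j)
  path-of-parity F∈ℱ P isPath = let (p , uq , j∉) = pathOf-simple F∈ℱ isPath in
    ≡.trans (parityᶻ-+ (wind P) (ℤ.+ int P)) (path-parity r j∉I P p uq j∉)

  -1^-product : ∀ z l l′ → parityᶻ z ≡ ℕ.parity l ℙ.+ ℕ.parity l′ → -1^ z ≈ -1^ (ℤ.+ l) * -1^ (ℤ.+ l′)
  -1^-product z l l′ h with ℕ.parity ℤ.∣ z ∣ | ℕ.parity l | ℕ.parity l′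
  -1^-product z l l′ refl | _ | 0ℙ | 0ℙ = sym (*-identityˡ 1#)
  -1^-product z l l′ refl | _ | 0ℙ | 1ℙ = sym (*-identityˡ (- 1#))
  -1^-product z l l′ refl | _ | 1ℙ | 0ℙ = sym (*-identityʳ (- 1#))
  -1^-product z l l′ refl | _ | 1ℙ | 1ℙ = solve 0 (con 1ℤ := (:- con 1ℤ) :* (:- con 1ℤ)) (OrderedField.refl K)
    where open IntegerSolver K

  flow-ratio : Carrier
  flow-ratio = divide (edgeFlowSum e j) conservativeFlowSum≉0

  edge-series measurement-series : Series _
  edge-series = series (isPathFrom? e j) (λ P → -1^ (wind P ℤ.+ ℤ.+ int P))
  measurement-series = series (λ P → isWalk? (b i) P (b j)) (λ P → -1^ (ℤ.+ loopsErased (b i) P))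

  -- By `walk-parity` the sign of a walk is that of its loop count times the constant given by the
  -- sources in between.
  edge-component : IsEdgeComponent e j (-1^ (ℤ.+ sourcesBetween i j) * flow-ratio)
  edge-component = series-sum i≢j e-src (isPathFrom? e j)
    (λ P → mk⇔ (Equivalence.from (walk⇔path P)) (Equivalence.to (walk⇔path P)))
    (-1^ (ℤ.+ sourcesBetween i j)) (λ P → -1^ (wind P ℤ.+ ℤ.+ int P))
    (λ P p → -1^-product (wind P ℤ.+ ℤ.+ int P) (sourcesBetween i j) (loopsErased (b i) P)
      (≡.trans (parityᶻ-+ (wind P) (ℤ.+ int P)) (walk-parity r j∉I P p)))

  -- The sign is the loop count itself, so the constant is `1#`; the factor from the sources in
  -- between is part of the measured matrix.
  boundary-measurement : IsBoundaryMeasurement i j (1# * flow-ratio)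
  boundary-measurement = series-sum i≢j e-src (λ P → isWalk? (b i) P (b j)) (λ P → mk⇔ id id)
    1# (λ P → -1^ (ℤ.+ loopsErased (b i) P)) (λ P _ → sym (*-identityˡ _))

  measured : A′ r j ≈ -1^ (ℤ.+ sourcesBetween i j) * flow-ratio
  measured = let (m , m-sum , A′≈m) = measurements r j j∉I in
    trans A′≈m (*-congˡ (trans (SumsTo-unique weight {measurement-series} m-sum boundary-measurement) (*-identityˡ _)))
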